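{- Let $\mathcal{G}$ be a hereditary class of graphs for which there is a polynomial $p$ such that for every positive integer $s$, every bipartite graph in $\mathcal{G}$ that does not contain $K_{s,s}$ as a subgraph has average degree at most $p(s)$. Then there is a polynomial $p'$ such that for every positive integer $s$, every graph in $\mathcal{G}$ that does not contain $K_{s,s}$ as a subgraph has average degree at most $p'(s)$.
   Context: A class of graphs is hereditary if it is closed under taking induced subgraphs (and isomorphism). "Subgraph" means not necessarily induced subgraph. -}

module Defs where

open import Data.Nat using (ℕ; zero; suc; _+_; _*_; _≤_)
open import Data.Fin using (Fin; zero; suc)
open import Data.Bool using (Bool; true; false; if_then_else_)
open import Data.List using (List; []; _∷_)
open import Data.Product using (Σ; _×_; ∃)
open import Relation.Binary.PropositionalEquality using (_≡_; _≢_)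
open import Relation.Nullary using (¬_)
open import Function.Definitions using (Injective)

record Graph : Set where
  field
    n     : ℕ
    adj   : Fin n → Fin n → Bool
    sym   : ∀ i j → adj i j ≡ adj j i
    irrefl : ∀ i → adj i i ≡ false
open Graph public

_≤ind_ : Graph → Graph → Set
H ≤ind G = Σ (Fin (n H) → Fin (n G)) λ f →
  Injective _≡_ _≡_ f × (∀ i j → adj G (f i) (f j) ≡ adj H i j)

-- A class of graphs (closed under isomorphism, via the definition below)
-- is hereditary if it is closed under taking induced subgraphs.
Hereditary : (Graph → Set) → Set
Hereditary 𝒢 = ∀ G H → H ≤ind G → 𝒢 G → 𝒢 H

Bipartite : Graph → Set
Bipartite G = Σ (Fin (n G) → Bool) λ c →
  ∀ i j → adj G i j ≡ true → c i ≢ c j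

ContainsKss : ℕ → Graph → Set
ContainsKss s G = Σ (Fin s → Fin (n G)) λ f → Σ (Fin s → Fin (n G)) λ g →
  Injective _≡_ _≡_ f × Injective _≡_ _≡_ g ×
  (∀ i j → f i ≢ g j) × (∀ i j → adj G (f i) (g j) ≡ true)

sumFin : (m : ℕ) → (Fin m → ℕ) → ℕ
sumFin zero    h = 0
sumFin (suc m) h = h zero + sumFin m (λ i → h (suc i))

degree : (G : Graph) → Fin (n G) → ℕ
degree G i = sumFin (n G) (λ j → if adj G i j then 1 else 0)

degreeSum : Graph → ℕ
degreeSum G = sumFin (n G) (degree G)

-- Average degree of G (= degreeSum G / n G) is at most d.
-- (For the empty graph this holds vacuously.)
AvgDegreeAtMost : Graph → ℕ → Set
AvgDegreeAtMost G d = degreeSum G ≤ d * n G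

-- Polynomials with natural-number coefficients, lowest degree first.
Poly : Set
Poly = List ℕ

eval : Poly → ℕ → ℕ
eval []       x = 0
eval (a ∷ as) x = a + x * eval as x

{-# OPTIONS --safe #-}

-- Let P = p(s) and κ = p(2) + 1. In a minimal counterexample G the average degree is about D = λ^C, where
-- λ is a multiple of s, every vertex has degree at least D/2, and G is 2D-degenerate.
--
-- Local sparsity. A point-line incidence graph F without 4-cycles and of large average degree is not an
-- induced subgraph of G. If many pairs between two vertex sets were adjacent, then the homomorphisms of a
-- complete bipartite graph would be dense there; as G has no K_{s,s}, any two large sets have many
-- nonadjacent pairs, so the pairs that are not edges of F can be made nonadjacent one at a time while the
-- homomorphisms stay dense, and an induced F appears. So neighbourhoods span few edges, and few 4-cycles
-- pass through a vertex.
--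
-- Scales. Repeatedly discard the vertices of H with few neighbours in I. Either many vertices of I keep many
-- neighbours among vertices of H of comparable degrees, or the ratio |I| / |H| becomes superexponential.
-- In the second case each vertex of I has P + 1 pairwise nonadjacent neighbours in H, and a random
-- independent subset of H contains them with probability larger than |H| / |I|. In the first case sampling
-- I and H first destroys all triangles and 4-cycles, and then the same extraction needs stars of only κ leaves.
-- Either way an induced bipartite subgraph violates the hypothesis, for s or for 2.

module Submission where

open import Defs renaming (sym to adj-sym; irrefl to adj-irrefl)
open import Data.Bool using (Bool; true; false; if_then_else_; _∧_; _∨_; not)
import Data.Bool as B
import Data.Bool.Properties as B
open import Data.Empty using (⊥; ⊥-elim)
open import Data.Fin using (Fin; zero; suc; inject≤; toℕ; fromℕ<; remQuot; combine; _↑ˡ_; _↑ʳ_; splitAt)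
import Data.Fin as F
open import Data.Fin.Properties using (inject≤-injective; any?; all?; splitAt-↑ˡ; splitAt-↑ʳ; toℕ-↑ˡ; toℕ-↑ʳ; toℕ<n; toℕ-injective; toℕ-fromℕ<; remQuot-combine; combine-remQuot) renaming (suc-injective to suc-inj)
import Data.Fin.Properties as F
open import Data.List using (List; []; _∷_; length; filter; cartesianProduct; allFin; replicate)
import Data.List as List
open import Data.List.Membership.Propositional using (_∈_)
open import Data.List.Membership.Propositional.Properties using (∈-filter⁺; ∈-filter⁻; ∈-cartesianProduct⁺; ∈-allFin)
open import Data.List.Relation.Unary.Any using (here; there)
open import Data.Nat
open import Data.Nat.DivMod using (_/_; _%_; m≡m%n+[m/n]*n; m%n<n)
open import Data.Nat.Induction using (<-rec)
open import Data.Nat.ListAction using (sum)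
open import Data.Nat.Properties
open import Data.Nat.Tactic.RingSolver using (solve-∀)
open import Data.Product using (Σ; ∃; _×_; _,_; proj₁; proj₂)
open import Data.Sum using (_⊎_; inj₁; inj₂)
import Data.Sum
open import Data.Vec using (Vec; []; _∷_; lookup; _[_]≔_; _++_)
open import Data.Vec.Properties using (lookup∘update; lookup∘update′; lookup-++ˡ; lookup-++ʳ)
open import Function using (_∘_; it)
open import Function.Definitions using (Injective)
open import Relation.Binary.Definitions using (tri<; tri≈; tri>)
open import Relation.Binary.PropositionalEquality using (_≡_; _≢_; refl; sym; trans; cong; cong₂; subst; subst₂; module ≡-Reasoning)
open import Relation.Nullary hiding (contradiction)
open import Relation.Nullary.Decidable using (from-yes)
open import Algebra.Properties.CommutativeSemigroup +-commutativeSemigroup using () renaming (interchange to +-interchange)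
open import Algebra.Properties.CommutativeSemigroup *-commutativeSemigroup using (x∙yz≈y∙xz) renaming (interchange to *-interchange)

-- An extraction keeps a star of k leaves with probability about Q^-k, where Q is a power of λ. For
-- k = P + 1 this loss is exponential in P, affordable only against a superexponential |I| / |H|.
-- Stars of κ leaves cost a fixed power of λ, since p(2) does not depend on s; this is why, when |I|
-- and |H| are comparable, 4-cycles have to go first, so that the hypothesis applies with 2 in place
-- of s.
--
-- The obstacle for the constants is circularity: density λ^-e can be forced only on sets of some
-- size λ^μ with μ depending on e, and D has to exceed that size. Sampling H at rate λ^-X with X = e
-- + μ removes the dependence: a sampled neighbourhood has order at most λ^(r + 1), and e has to
-- beat only powers of λ fixed by r and κ. Thus r and e are chosen first, then μ, then X and C = X +
-- r + 1.
--
-- Vertices of H have no upper bound on their degree. To make H independent, edges are therefore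
-- oriented with out-degree at most 2D, and a sampled vertex is discarded only on account of its
-- sampled out-neighbours.

⟦_⟧ : Bool → ℕ
⟦ b ⟧ = if b then 1 else 0

-- Finite sums and indicators

sum-syntax : ∀ n → (Fin n → ℕ) → ℕ
sum-syntax = sumFin

infixr 8 sum-syntax
syntax sum-syntax n (λ i → x) = ∑[ i < n ] x

sum-cong : ∀ n {f g : Fin n → ℕ} → (∀ i → f i ≡ g i) → sumFin n f ≡ sumFin n g
sum-cong zero h = refl
sum-cong (suc n) h = cong₂ _+_ (h zero) (sum-cong n (h ∘ suc))

sum-mono : ∀ n {f g : Fin n → ℕ} → (∀ i → f i ≤ g i) → sumFin n f ≤ sumFin n g
sum-mono zero h = z≤n
sum-mono (suc n) h = +-mono-≤ (h zero) (sum-mono n (h ∘ suc))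

sum-+ : ∀ n (f g : Fin n → ℕ) → ∑[ i < n ] (f i + g i) ≡ sumFin n f + sumFin n g
sum-+ zero f g = refl
sum-+ (suc n) f g = trans (cong (f zero + g zero +_) (sum-+ n _ _))
  (+-interchange (f zero) (g zero) _ _)

sum-*ˡ : ∀ n c (f : Fin n → ℕ) → ∑[ i < n ] (c * f i) ≡ c * sumFin n f
sum-*ˡ zero c f = sym (*-zeroʳ c)
sum-*ˡ (suc n) c f = trans (cong (c * f zero +_) (sum-*ˡ n c _)) (sym (*-distribˡ-+ c _ _))

sum-*ʳ : ∀ n c (f : Fin n → ℕ) → ∑[ i < n ] (f i * c) ≡ sumFin n f * c
sum-*ʳ n c f = trans (sum-cong n (λ i → *-comm (f i) c)) (trans (sum-*ˡ n c f) (*-comm c _))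

sum-const : ∀ n c → ∑[ i < n ] c ≡ n * c
sum-const zero c = refl
sum-const (suc n) c = cong (c +_) (sum-const n c)

sum-zero : ∀ n → ∑[ i < n ] 0 ≡ 0
sum-zero n = trans (sum-const n 0) (*-zeroʳ n)

sum-swap : ∀ m n (f : Fin m → Fin n → ℕ) →
  ∑[ i < m ] ∑[ j < n ] f i j ≡ ∑[ j < n ] ∑[ i < m ] f i j
sum-swap zero n f = sym (sum-zero n)
sum-swap (suc m) n f = trans (cong (sumFin n (f zero) +_) (sum-swap m n (f ∘ suc)))
  (sym (sum-+ n (f zero) _))

term≤sum : ∀ n (f : Fin n → ℕ) i → f i ≤ sumFin n f
term≤sum (suc n) f zero = m≤m+n _ _
term≤sum (suc n) f (suc i) = ≤-trans (term≤sum n (f ∘ suc) i) (m≤n+m _ (f zero))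

sum<⇒∃ : ∀ n {f g : Fin n → ℕ} → sumFin n f < sumFin n g → ∃ λ i → f i < g i
sum<⇒∃ (suc n) {f} {g} h with f zero <? g zero
... | yes q = zero , q
... | no ¬q with sum<⇒∃ n {f ∘ suc} {g ∘ suc}
                  (+-cancelˡ-< (f zero) _ _ (<-≤-trans h (+-monoˡ-≤ _ (≮⇒≥ ¬q))))
... | i , r = suc i , r

sum>0⇒∃ : ∀ n {f : Fin n → ℕ} → 0 < sumFin n f → ∃ λ i → 0 < f i
sum>0⇒∃ n {f} h = sum<⇒∃ n {λ _ → 0} {f} (subst (_< sumFin n f) (sym (sum-zero n)) h)

⟦⟧-≤1 : ∀ b → ⟦ b ⟧ ≤ 1
⟦⟧-≤1 true = ≤-refl
⟦⟧-≤1 false = z≤n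

⟦⟧-≤ : ∀ {b x} → (b ≡ true → 1 ≤ x) → ⟦ b ⟧ ≤ x
⟦⟧-≤ {true} h = h refl
⟦⟧-≤ {false} h = z≤n

⟦⟧-mono : ∀ {b c} → (b ≡ true → c ≡ true) → ⟦ b ⟧ ≤ ⟦ c ⟧
⟦⟧-mono {b} {c} h = ⟦⟧-≤ {b} (λ e → ≤-reflexive (cong ⟦_⟧ (sym (h e))))

⟦∧⟧ : ∀ b c → ⟦ b ∧ c ⟧ ≡ ⟦ b ⟧ * ⟦ c ⟧
⟦∧⟧ true c = sym (+-identityʳ _)
⟦∧⟧ false c = refl

⟦⟧>0 : ∀ {b} → 0 < ⟦ b ⟧ → b ≡ true
⟦⟧>0 {true} _ = refl

⟦⟧*-≤ : ∀ b {x y} → (b ≡ true → x ≤ y) → ⟦ b ⟧ * x ≤ ⟦ b ⟧ * y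
⟦⟧*-≤ true h = *-monoʳ-≤ 1 (h refl)
⟦⟧*-≤ false h = z≤n

⟦⟧*≤ : ∀ b {x y} → (b ≡ true → x ≤ y) → ⟦ b ⟧ * x ≤ y
⟦⟧*≤ true {x} h = ≤-trans (≤-reflexive (+-identityʳ x)) (h refl)
⟦⟧*≤ false h = z≤n

⟦⟧*-1 : ∀ {b} x → b ≡ true → ⟦ b ⟧ * x ≡ x
⟦⟧*-1 x refl = +-identityʳ x

∧ˡ : ∀ a {b} → a ∧ b ≡ true → a ≡ true
∧ˡ true _ = refl

∧ʳ : ∀ a {b} → a ∧ b ≡ true → b ≡ true
∧ʳ true h = h

∧-intro : ∀ {a b} → a ≡ true → b ≡ true → a ∧ b ≡ true
∧-intro refl refl = refl

not-true : ∀ {a} → not a ≡ true → a ≡ false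
not-true {false} _ = refl

true≢false : ∀ {b} → b ≡ true → b ≡ false → ⊥
true≢false refl ()

dec-true : ∀ {P : Set} (d : Dec P) → P → does d ≡ true
dec-true (yes _) _ = refl
dec-true (no ¬p) p = ⊥-elim (¬p p)

dec-proof : ∀ {P : Set} (d : Dec P) → does d ≡ true → P
dec-proof (yes p) _ = p

dec-false : ∀ {P : Set} (d : Dec P) → ¬ P → does d ≡ false
dec-false (yes p) ¬p = ⊥-elim (¬p p)
dec-false (no _) _ = refl

dec-disproof : ∀ {P : Set} (d : Dec P) → does d ≡ false → ¬ P
dec-disproof (no ¬p) _ = ¬p

-- Subsets of a finite vertex set and their sizes

Subset : ℕ → Set
Subset n = Fin n → Bool

_∩_ _∪_ : ∀ {n} → Subset n → Subset n → Subset n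
(U ∩ W) v = U v ∧ W v
(U ∪ W) v = U v ∨ W v

card : ∀ {n} → Subset n → ℕ
card {n} U = ∑[ v < n ] ⟦ U v ⟧

_⊑_ : ∀ {n} → Subset n → Subset n → Set
U ⊑ W = ∀ v → U v ≡ true → W v ≡ true

card-mono : ∀ {n} {U W : Subset n} → U ⊑ W → card U ≤ card W
card-mono {n} {U} {W} h = sum-mono n (λ v → ⟦⟧-mono {U v} {W v} (h v))

card-∩ˡ : ∀ {n} (U W : Subset n) → card (U ∩ W) ≤ card U
card-∩ˡ U W = card-mono {U = U ∩ W} {U} λ v → ∧ˡ (U v)

card-∩ʳ : ∀ {n} (U W : Subset n) → card (U ∩ W) ≤ card W
card-∩ʳ U W = card-mono {U = U ∩ W} {W} λ v → ∧ʳ (U v)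

card≤n : ∀ {n} (U : Subset n) → card U ≤ n
card≤n {n} U = ≤-trans (sum-mono n (λ v → ⟦⟧-≤1 (U v)))
  (≤-reflexive (trans (sum-const n 1) (*-identityʳ n)))

card>0⇒∃ : ∀ {n} {U : Subset n} → 0 < card U → ∃ λ v → U v ≡ true
card>0⇒∃ {n} {U} h with sum>0⇒∃ n h
... | v , q = v , ⟦⟧>0 q

consFin : ∀ {m n} b → (Fin m → Fin n) → Fin (⟦ b ⟧ + m) → Fin (suc n)
consFin true e zero = zero
consFin true e (suc j) = suc (e j)
consFin false e j = suc (e j)

-- The increasing enumeration of `U`; it later numbers the vertices of the subgraph induced on `U`.
enum : ∀ {n} (U : Subset n) → Fin (card U) → Fin n
enum {suc n} U = consFin (U zero) (enum (U ∘ suc))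

enum-∈ : ∀ {n} (U : Subset n) j → U (enum U j) ≡ true
enum-∈ {suc n} U j = aux (U zero) refl j
  where
  aux : ∀ b → U zero ≡ b → (j : Fin (⟦ b ⟧ + card (U ∘ suc))) →
    U (consFin b (enum (U ∘ suc)) j) ≡ true
  aux true q zero = q
  aux true q (suc j) = enum-∈ (U ∘ suc) j
  aux false q j = enum-∈ (U ∘ suc) j

enum-injective : ∀ {n} (U : Subset n) → Injective _≡_ _≡_ (enum U)
enum-injective {suc n} U = aux (U zero)
  where
  aux : ∀ b → Injective _≡_ _≡_ (consFin b (enum (U ∘ suc)))
  aux true {zero} {zero} q = refl
  aux true {suc i} {suc j} q = cong suc (enum-injective (U ∘ suc) (suc-inj q))
  aux false q = enum-injective (U ∘ suc) (suc-inj q)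

sum-enum : ∀ {n} (U : Subset n) (h : Fin n → ℕ) →
  ∑[ j < card U ] h (enum U j) ≡ ∑[ v < n ] (⟦ U v ⟧ * h v)
sum-enum {zero} U h = refl
sum-enum {suc n} U h = aux (U zero)
  where
  aux : ∀ b → ∑[ j < ⟦ b ⟧ + card (U ∘ suc) ] h (consFin b (enum (U ∘ suc)) j)
            ≡ ⟦ b ⟧ * h zero + ∑[ v < n ] (⟦ U (suc v) ⟧ * h (suc v))
  aux true = cong₂ _+_ (sym (+-identityʳ (h zero))) (sum-enum (U ∘ suc) (h ∘ suc))
  aux false = sum-enum (U ∘ suc) (h ∘ suc)

choose : ∀ {n s} (U : Subset n) → s ≤ card U →
  Σ (Fin s → Fin n) λ e → Injective _≡_ _≡_ e × (∀ j → U (e j) ≡ true)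
choose U h = (λ j → enum U (inject≤ j h)) ,
  (λ q → inject≤-injective h h _ _ (enum-injective U q)) ,
  (λ j → enum-∈ U _)

single : ∀ {n} → Fin n → Subset n
single u v = does (u F.≟ v)

card-∪ : ∀ {n} {U W : Subset n} → (∀ v → U v ≡ true → W v ≡ true → ⊥) →
  card (U ∪ W) ≡ card U + card W
card-∪ {n} {U} {W} disj = trans (sum-cong n (λ v → aux (U v) (W v) (disj v))) (sum-+ n _ _)
  where
  aux : ∀ a b → (a ≡ true → b ≡ true → ⊥) → ⟦ a ∨ b ⟧ ≡ ⟦ a ⟧ + ⟦ b ⟧
  aux true true h = ⊥-elim (h refl refl)
  aux true false h = refl
  aux false b h = refl

card-∪-≤ : ∀ {n} (U W : Subset n) → card (U ∪ W) ≤ card U + card W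
card-∪-≤ {n} U W = ≤-trans (sum-mono n (λ v → aux (U v) (W v))) (≤-reflexive (sum-+ n _ _))
  where
  aux : ∀ a b → ⟦ a ∨ b ⟧ ≤ ⟦ a ⟧ + ⟦ b ⟧
  aux true b = s≤s z≤n
  aux false b = ≤-refl

card-single : ∀ {n} (u : Fin n) → card (single u) ≡ 1
card-single {suc n} zero = cong suc (sum-zero n)
card-single {suc n} (suc u) = trans (sum-cong n (λ v → refl)) (card-single u)

card-split : ∀ {n} (U W : Subset n) → card U ≡ card (U ∩ W) + card (U ∩ (not ∘ W))
card-split {n} U W = trans (sum-cong n (λ v → aux (U v) (W v))) (sum-+ n _ _)
  where
  aux : ∀ a b → ⟦ a ⟧ ≡ ⟦ a ∧ b ⟧ + ⟦ a ∧ not b ⟧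
  aux true true = refl
  aux true false = refl
  aux false _ = refl

-- Random subsets: expectations with cleared denominators

-- Weighted sum over all subsets in which an element has weight 1 inside and weight q outside;
-- divided by (1 + q) ^ n it is the expectation for independent sampling with rate 1 / (1 + q).
consSet : ∀ {n} → Bool → Subset n → Subset (suc n)
consSet b A zero = b
consSet b A (suc v) = A v

samp : ℕ → ∀ n → (Subset n → ℕ) → ℕ
samp q zero f = f (λ ())
samp q (suc n) f = samp q n (f ∘ consSet true) + q * samp q n (f ∘ consSet false)

samp-cong : ∀ q n {f g : Subset n → ℕ} → (∀ A → f A ≡ g A) → samp q n f ≡ samp q n g
samp-cong q zero h = h _
samp-cong q (suc n) h = cong₂ (λ x y → x + q * y)
  (samp-cong q n (h ∘ consSet true)) (samp-cong q n (h ∘ consSet false))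

samp-mono : ∀ q n {f g : Subset n → ℕ} → (∀ A → f A ≤ g A) → samp q n f ≤ samp q n g
samp-mono q zero h = h _
samp-mono q (suc n) h = +-mono-≤ (samp-mono q n (h ∘ consSet true))
  (*-monoʳ-≤ q (samp-mono q n (h ∘ consSet false)))

samp-+ : ∀ q n (f g : Subset n → ℕ) → samp q n (λ A → f A + g A) ≡ samp q n f + samp q n g
samp-+ q zero f g = refl
samp-+ q (suc n) f g = trans
  (cong₂ (λ x y → x + q * y) (samp-+ q n (f ∘ consSet true) (g ∘ consSet true))
    (samp-+ q n (f ∘ consSet false) (g ∘ consSet false)))
  (distrib (samp q n (f ∘ consSet true)) _ (samp q n (f ∘ consSet false)) _ q)
  where
  distrib : ∀ a b c d q → a + b + q * (c + d) ≡ a + q * c + (b + q * d)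
  distrib = solve-∀

samp-*ˡ : ∀ q n c (f : Subset n → ℕ) → samp q n (λ A → c * f A) ≡ c * samp q n f
samp-*ˡ q zero c f = refl
samp-*ˡ q (suc n) c f = trans
  (cong₂ (λ x y → x + q * y) (samp-*ˡ q n c _) (samp-*ˡ q n c _))
  (trans (cong (c * samp q n (f ∘ consSet true) +_) (x∙yz≈y∙xz q c _))
    (sym (*-distribˡ-+ c _ _)))

samp-const : ∀ q n c → samp q n (λ _ → c) ≡ c * suc q ^ n
samp-const q zero c = sym (*-identityʳ c)
samp-const q (suc n) c = trans (cong (λ x → x + q * x) (samp-const q n c))
  (x∙yz≈y∙xz (suc q) c _)

samp-sum : ∀ q n m (f : Fin m → Subset n → ℕ) →
  samp q n (λ A → ∑[ i < m ] f i A) ≡ ∑[ i < m ] samp q n (f i)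
samp-sum q n zero f = samp-const q n 0
samp-sum q n (suc m) f = trans (samp-+ q n (f zero) _)
  (cong (samp q n (f zero) +_) (samp-sum q n m (f ∘ suc)))

-- The first-moment method. Every random subset in the proof is fixed through this lemma.
samp-∃ : ∀ q n {f g : Subset n → ℕ} → samp q n f < samp q n g → ∃ λ A → f A < g A
samp-∃ q zero h = _ , h
samp-∃ q (suc n) {f} {g} h
  with samp q n (f ∘ consSet true) <? samp q n (g ∘ consSet true)
... | yes l with samp-∃ q n l
... | A , r = consSet true A , r
samp-∃ q (suc n) {f} {g} h | no ¬l with samp-∃ q n {f ∘ consSet false} {g ∘ consSet false}
      (*-cancelˡ-< q _ _ (+-cancelˡ-< (samp q n (f ∘ consSet true)) _ _
        (<-≤-trans h (+-monoˡ-≤ _ (≮⇒≥ ¬l)))))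
... | A , r = consSet false A , r

sub : ∀ {n} → Subset n → Subset n → Bool
sub {zero} T A = true
sub {suc n} T A = (not (T zero) ∨ A zero) ∧ sub (T ∘ suc) (A ∘ suc)

sub-sound : ∀ {n} (T A : Subset n) → sub T A ≡ true → T ⊑ A
sub-sound T A h zero e with T zero | A zero
... | true | true = refl
sub-sound T A h (suc v) e = sub-sound (T ∘ suc) (A ∘ suc) (∧ʳ (not (T zero) ∨ A zero) h) v e

sub-complete : ∀ {n} (T A : Subset n) → T ⊑ A → sub T A ≡ true
sub-complete {zero} T A h = refl
sub-complete {suc n} T A h = ∧-intro (aux (T zero) (A zero) (h zero))
  (sub-complete (T ∘ suc) (A ∘ suc) (h ∘ suc))
  where
  aux : ∀ a b → (a ≡ true → b ≡ true) → not a ∨ b ≡ true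
  aux true b h = h refl
  aux false b h = refl

-- Pr (T ⊆ A) = (1 + q)^(- card T) without division: an element of `T` contributes the factor 1 to
-- the total weight, any other element 1 + q.
samp-sub : ∀ q n (T : Subset n) →
  samp q n (λ A → ⟦ sub T A ⟧) * suc q ^ card T ≡ suc q ^ n
samp-sub q zero T = refl
samp-sub q (suc n) T with T zero
... | true = trans (cong (_* (suc q * suc q ^ card (T ∘ suc)))
                      (trans (cong (samp q n (λ A → ⟦ sub (T ∘ suc) A ⟧) +_)
                        (trans (cong (q *_) (samp-const q n 0)) (*-zeroʳ q)))
                        (+-identityʳ _)))
  (trans (x∙yz≈y∙xz (samp q n (λ A → ⟦ sub (T ∘ suc) A ⟧)) (suc q) _)
    (cong (suc q *_) (samp-sub q n (T ∘ suc))))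
... | false = trans (*-assoc (suc q) (samp q n (λ A → ⟦ sub (T ∘ suc) A ⟧)) (suc q ^ card (T ∘ suc)))
  (cong (suc q *_) (samp-sub q n (T ∘ suc)))

sub-single : ∀ {n} (u : Fin n) (A : Subset n) → A u ≡ true → sub (single u) A ≡ true
sub-single u A h = sub-complete (single u) A (λ v e → subst (λ w → A w ≡ true) (dec-proof (u F.≟ v) e) h)

sub-∪ : ∀ {n} {T W A : Subset n} → T ⊑ A → W ⊑ A → sub (T ∪ W) A ≡ true
sub-∪ {T = T} {W} {A} h k = sub-complete (T ∪ W) A aux
  where
  aux : (T ∪ W) ⊑ A
  aux v e with T v in q
  ... | true = h v q
  ... | false = k v e

pair : ∀ {n} → Fin n → Fin n → Subset n
pair u v = single u ∪ single v

sub-pair : ∀ {n} (u v : Fin n) (A : Subset n) → A u ≡ true → A v ≡ true → sub (pair u v) A ≡ true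
sub-pair u v A hu hv = sub-∪ {T = single u} {single v} {A}
  (sub-sound (single u) A (sub-single u A hu)) (sub-sound (single v) A (sub-single v A hv))

card-pair : ∀ {n} {u v : Fin n} → u ≢ v → card (pair u v) ≡ 2
card-pair {u = u} {v} h = trans
  (card-∪ {U = single u} {single v}
    (λ w a b → h (trans (dec-proof (u F.≟ w) a) (sym (dec-proof (v F.≟ w) b)))))
  (cong₂ _+_ (card-single u) (card-single v))

samp-single : ∀ q n (u : Fin n) → samp q n (λ A → ⟦ A u ⟧) * suc q ≡ suc q ^ n
samp-single q n u = trans (cong₂ _*_ (samp-cong q n aux)
    (trans (sym (*-identityʳ (suc q))) (cong (suc q ^_) (sym (card-single u)))))
  (samp-sub q n (single u))
  where
  aux : ∀ A → ⟦ A u ⟧ ≡ ⟦ sub (single u) A ⟧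
  aux A = ≤-antisym (⟦⟧-mono {A u} (sub-single u A))
    (⟦⟧-mono {sub (single u) A} (λ h → sub-sound (single u) A h u (dec-true (u F.≟ u) refl)))

samp-card : ∀ q n (U : Subset n) →
  samp q n (λ A → card (U ∩ A)) * suc q ≡ card U * suc q ^ n
samp-card q n U = begin
  samp q n (λ A → card (U ∩ A)) * suc q
    ≡⟨ cong (_* suc q) (samp-sum q n n _) ⟩
  (∑[ u < n ] samp q n (λ A → ⟦ U u ∧ A u ⟧)) * suc q
    ≡⟨ sym (sum-*ʳ n (suc q) _) ⟩
  ∑[ u < n ] (samp q n (λ A → ⟦ U u ∧ A u ⟧) * suc q)
    ≡⟨ sum-cong n (λ u → trans (cong (_* suc q) (trans (samp-cong q n (λ A → ⟦∧⟧ (U u) (A u)))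
         (samp-*ˡ q n ⟦ U u ⟧ _))) (trans (*-assoc ⟦ U u ⟧ _ _) (cong (⟦ U u ⟧ *_) (samp-single q n u)))) ⟩
  ∑[ u < n ] (⟦ U u ⟧ * suc q ^ n)
    ≡⟨ sum-*ʳ n (suc q ^ n) _ ⟩
  card U * suc q ^ n ∎
  where open ≡-Reasoning

Rel : ℕ → Set
Rel n = Fin n → Fin n → Bool

edges : ∀ {n} → Rel n → Subset n → Subset n → ℕ
edges {n} r X Y = ∑[ u < n ] (⟦ X u ⟧ * card (Y ∩ r u))

edges-mono : ∀ {n} (r : Rel n) {X X′ Y Y′ : Subset n} → X ⊑ X′ → Y ⊑ Y′ →
  edges r X Y ≤ edges r X′ Y′
edges-mono {n} r {X} {X′} {Y} {Y′} h k = sum-mono n λ u → *-mono-≤ (⟦⟧-mono {X u} (h u))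
  (card-mono λ v e → ∧-intro (k v (∧ˡ (Y v) e)) (∧ʳ (Y v) e))

-- Linearity of expectation for the number of sampled configurations. Those of weight 0 are allowed
-- another size because a degenerate one may be smaller: `pair u u` is a singleton.
samp-sets : ∀ q n m (w : Fin m → ℕ) (T : Fin m → Subset n) c →
  (∀ i → w i ≡ 0 ⊎ card (T i) ≡ c) →
  samp q n (λ A → ∑[ i < m ] (w i * ⟦ sub (T i) A ⟧)) * suc q ^ c ≡ sumFin m w * suc q ^ n
samp-sets q n m w T c h = trans (cong (_* suc q ^ c) (trans (samp-sum q n m _)
    (sum-cong m λ i → samp-*ˡ q n (w i) _)))
  (trans (sym (sum-*ʳ m _ _)) (trans (sum-cong m prob) (sum-*ʳ m _ w)))
  where
  prob : ∀ i → w i * samp q n (λ A → ⟦ sub (T i) A ⟧) * suc q ^ c ≡ w i * suc q ^ n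
  prob i with h i
  ... | inj₁ z = trans (cong (λ x → x * samp q n (λ A → ⟦ sub (T i) A ⟧) * suc q ^ c) z)
                   (cong (_* suc q ^ n) (sym z))
  ... | inj₂ e = trans (*-assoc (w i) _ _) (cong (w i *_)
                   (trans (cong (λ x → samp q n (λ A → ⟦ sub (T i) A ⟧) * suc q ^ x) (sym e)) (samp-sub q n (T i))))

samp-sets₂ : ∀ q n m l (w : Fin m → Fin l → ℕ) (T : Fin m → Fin l → Subset n) c →
  (∀ i j → w i j ≡ 0 ⊎ card (T i j) ≡ c) →
  samp q n (λ A → ∑[ i < m ] ∑[ j < l ] (w i j * ⟦ sub (T i j) A ⟧)) * suc q ^ c
    ≡ (∑[ i < m ] ∑[ j < l ] w i j) * suc q ^ n
samp-sets₂ q n m l w T c h = trans (cong (_* suc q ^ c) (samp-sum q n m _))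
  (trans (sym (sum-*ʳ m _ _)) (trans (sum-cong m λ i → samp-sets q n l (w i) (T i) c (h i))
    (sum-*ʳ m _ _)))

weight-cases : ∀ a b {P : Set} → (b ≡ true → P) → ⟦ a ⟧ * ⟦ b ⟧ ≡ 0 ⊎ P
weight-cases a true h = inj₂ (h refl)
weight-cases a false h = inj₁ (*-zeroʳ ⟦ a ⟧)

edges-as-sum : ∀ {n} (r : Rel n) (X Y : Subset n) →
  edges r X Y ≡ ∑[ u < n ] ∑[ v < n ] (⟦ X u ⟧ * ⟦ Y v ∧ r u v ⟧)
edges-as-sum {n} r X Y = sum-cong n λ u → sym (sum-*ˡ n ⟦ X u ⟧ _)

samp-edges : ∀ q n (r : Rel n) (X Y : Subset n) → (∀ u → r u u ≡ false) →
  samp q n (λ A → edges r (X ∩ A) (Y ∩ A)) * suc q ^ 2 ≤ edges r X Y * suc q ^ n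
samp-edges q n r X Y irr = ≤-trans
  (*-monoˡ-≤ (suc q ^ 2) (samp-mono q n λ A → ≤-trans
    (≤-reflexive (edges-as-sum r (X ∩ A) (Y ∩ A))) (sum-mono n λ u → sum-mono n (point A u))))
  (≤-reflexive (trans (samp-sets₂ q n n n (λ u v → ⟦ X u ⟧ * ⟦ Y v ∧ r u v ⟧) pair 2 distinct)
    (cong (_* suc q ^ n) (sym (edges-as-sum r X Y)))))
  where
  distinct : ∀ u v → ⟦ X u ⟧ * ⟦ Y v ∧ r u v ⟧ ≡ 0 ⊎ card (pair u v) ≡ 2
  distinct u v = weight-cases (X u) (Y v ∧ r u v) λ e → card-pair {u = u} {v}
    λ p → true≢false (∧ʳ (Y v) e) (subst (λ x → r u x ≡ false) p (irr u))
  point : ∀ A u v → ⟦ X u ∧ A u ⟧ * ⟦ (Y v ∧ A v) ∧ r u v ⟧ ≤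
    ⟦ X u ⟧ * ⟦ Y v ∧ r u v ⟧ * ⟦ sub (pair u v) A ⟧
  point A u v = ⟦⟧*≤ (X u ∧ A u) λ hu → ⟦⟧-≤ {(Y v ∧ A v) ∧ r u v} λ hv →
    ≤-reflexive (sym (trans
      (cong₂ (λ x y → ⟦ x ⟧ * ⟦ y ⟧ * ⟦ sub (pair u v) A ⟧) (∧ˡ (X u) hu)
        (∧-intro (∧ˡ (Y v) (∧ˡ (Y v ∧ A v) hv)) (∧ʳ (Y v ∧ A v) hv)))
      (cong (λ x → 1 * 1 * ⟦ x ⟧) (sub-pair u v A (∧ʳ (X u) hu)
        (∧ʳ (Y v) (∧ˡ (Y v ∧ A v) hv))))))

∈⇒card>0 : ∀ {n} {U : Subset n} {v} → U v ≡ true → 1 ≤ card U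
∈⇒card>0 {n} {U} {v} h = ≤-trans (≤-reflexive (cong ⟦_⟧ (sym h))) (term≤sum n (λ w → ⟦ U w ⟧) v)

some : ∀ {n} → Subset n → Bool
some U = does (any? (λ v → U v B.≟ true))

some-∃ : ∀ {n} (U : Subset n) → some U ≡ true → ∃ λ v → U v ≡ true
some-∃ U = dec-proof (any? (λ v → U v B.≟ true))

none : ∀ {n} (U : Subset n) → some U ≡ false → ∀ v → U v ≡ true → ⊥
none U h v e = dec-disproof (any? (λ v → U v B.≟ true)) h (v , e)

-- The deletion method, and the lower tail of a random sample

-- Sampling I with rate 1/Q keeps a 1/Q fraction of the vertices but only a 1/Q² fraction of the conflicting
-- pairs, so that deleting one vertex per surviving conflict is affordable.
deletion-arith : ∀ α β h {C E I N Q sC sE sI} → 0 < N → sE * Q ^ 2 ≤ E * N → sC * Q ^ 2 ≤ C * N →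
  sI * Q ≡ I * N → α * C + β * E + Q ^ 2 * h < α * (Q * I) → β * sE + α * sC + h * N < α * sI
deletion-arith α β h {C} {E} {I} {N@(suc _)} {Q} {sC} {sE} {sI} _ hE hC hI hyp =
  *-cancelʳ-< (Q ^ 2) _ _ (begin-strict
  (β * sE + α * sC + h * N) * Q ^ 2
    ≡⟨ split β sE α sC (h * N) (Q ^ 2) ⟩
  α * (sC * Q ^ 2) + β * (sE * Q ^ 2) + Q ^ 2 * (h * N)
    ≤⟨ +-monoˡ-≤ _ (+-mono-≤ (*-monoʳ-≤ α hC) (*-monoʳ-≤ β hE)) ⟩
  α * (C * N) + β * (E * N) + Q ^ 2 * (h * N)
    ≡⟨ gather β E α C h (Q ^ 2) N ⟩
  (α * C + β * E + Q ^ 2 * h) * N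
    <⟨ *-monoˡ-< N hyp ⟩
  α * (Q * I) * N
    ≡⟨ swapQ α I N Q ⟩
  α * (I * N) * Q
    ≡⟨ cong (λ x → α * x * Q) (sym hI) ⟩
  α * (sI * Q) * Q
    ≡⟨ swapS α sI Q ⟩
  α * sI * Q ^ 2 ∎)
  where
  open ≤-Reasoning
  split : ∀ b x a y h Q → (b * x + a * y + h) * Q ≡ a * (y * Q) + b * (x * Q) + Q * h
  split = solve-∀
  gather : ∀ b x a y h Q N → a * (y * N) + b * (x * N) + Q * (h * N) ≡ (a * y + b * x + Q * h) * N
  gather = solve-∀
  swapQ : ∀ a c N Q → a * (Q * c) * N ≡ a * (c * N) * Q
  swapQ = solve-∀
  swapS : ∀ a s Q → a * (s * Q) * Q ≡ a * s * (Q * (Q * 1))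
  swapS = solve-∀

-- A vertex with a conflict inside `J` is dropped and charged to one of its own conflicts, so the
-- loss is at most the number of ordered conflicting pairs.
prune : ∀ {n} (J : Subset n) (conf : Rel n) → Σ (Subset n) λ B → B ⊑ J ×
  (∀ u v → B u ≡ true → B v ≡ true → conf u v ≡ false) × card J ≤ card B + edges conf J J
prune {n} J conf = B , B⊑J , free , ≤-trans (sum-mono n loss) (≤-reflexive (sum-+ n _ _))
  where
  B : Subset n
  B v = J v ∧ not (some (J ∩ conf v))
  B⊑J : B ⊑ J
  B⊑J v = ∧ˡ (J v)
  free : ∀ u v → B u ≡ true → B v ≡ true → conf u v ≡ false
  free u v hu hv with conf u v in eq
  ... | false = refl
  ... | true = ⊥-elim (none (J ∩ conf u) (not-true (∧ʳ (J u) hu)) v (∧-intro (∧ˡ (J v) hv) eq))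
  loss : ∀ v → ⟦ J v ⟧ ≤ ⟦ B v ⟧ + ⟦ J v ⟧ * card (J ∩ conf v)
  loss v with some (J ∩ conf v) in eq
  ... | false = ≤-trans (≤-reflexive (cong ⟦_⟧ (sym (B.∧-identityʳ (J v))))) (m≤m+n _ _)
  ... | true with some-∃ (J ∩ conf v) eq
  ... | w , e = ≤-trans (≤-trans (≤-reflexive (sym (*-identityʳ ⟦ J v ⟧)))
      (*-monoʳ-≤ ⟦ J v ⟧ (∈⇒card>0 {U = J ∩ conf v} e))) (m≤n+m _ _)

-- The weights serve two purposes. With `α` = 1 and `β` = 0 the outcome is a conflict-free set
-- larger than `h`. With `β` positive, the edges of a second relation, which are not destroyed, stay
-- few relative to card B, and `h` carries a cost that a later step has to beat.
deletion : ∀ q {n} (I : Subset n) (conf edge : Rel n) →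
  (∀ u → conf u u ≡ false) → (∀ u → edge u u ≡ false) → ∀ α β h →
  α * edges conf I I + β * edges edge I I + suc q ^ 2 * h < α * (suc q * card I) →
  Σ (Subset n) λ B → B ⊑ I × (∀ u v → B u ≡ true → B v ≡ true → conf u v ≡ false) ×
    β * edges edge B B + h < α * card B
deletion q {n} I conf edge irrᶜ irrᵉ α β h hyp with samp-∃ q n expect
  where
  open ≤-Reasoning
  expect : samp q n (λ A → β * edges edge (I ∩ A) (I ∩ A) + α * edges conf (I ∩ A) (I ∩ A) + h)
         < samp q n (λ A → α * card (I ∩ A))
  expect = begin-strict
    samp q n (λ A → β * edges edge (I ∩ A) (I ∩ A) + α * edges conf (I ∩ A) (I ∩ A) + h)
      ≡⟨ trans (samp-+ q n _ _) (cong₂ _+_ (trans (samp-+ q n _ _)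
           (cong₂ _+_ (samp-*ˡ q n β _) (samp-*ˡ q n α _))) (samp-const q n h)) ⟩
    β * samp q n (λ A → edges edge (I ∩ A) (I ∩ A))
      + α * samp q n (λ A → edges conf (I ∩ A) (I ∩ A)) + h * suc q ^ n
      <⟨ deletion-arith α β h (m^n>0 (suc q) n) (samp-edges q n edge I I irrᵉ) (samp-edges q n conf I I irrᶜ)
           (samp-card q n I) hyp ⟩
    α * samp q n (λ A → card (I ∩ A))
      ≡⟨ samp-*ˡ q n α _ ⟨
    samp q n (λ A → α * card (I ∩ A)) ∎
... | A , found with prune (I ∩ A) conf
... | B , B⊑J , free , loss = B , (λ v e → ∧ˡ (I v) (B⊑J v e)) , free ,
  +-cancelʳ-< (α * edges conf J J) _ _ (begin-strict
    β * edges edge B B + h + α * edges conf J J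
      ≤⟨ +-monoˡ-≤ _ (+-monoˡ-≤ h (*-monoʳ-≤ β (edges-mono edge {B} {J} {B} {J} B⊑J B⊑J))) ⟩
    β * edges edge J J + h + α * edges conf J J
      ≡⟨ shuffle (β * edges edge J J) h _ ⟩
    β * edges edge J J + α * edges conf J J + h
      <⟨ found ⟩
    α * card J
      ≤⟨ *-monoʳ-≤ α loss ⟩
    α * (card B + edges conf J J)
      ≡⟨ *-distribˡ-+ α (card B) _ ⟩
    α * card B + α * edges conf J J ∎)
  where
  open ≤-Reasoning
  J : Subset n
  J = I ∩ A
  shuffle : ∀ a b c → a + b + c ≡ a + c + b
  shuffle = solve-∀

-- 2 to the number of elements of `T` outside `A`, written as a product over the elements so that
-- its expectation factorises: an element of `T` contributes (1 + 2q) / (1 + q). It is the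
-- exponential moment behind `samp-few`.
halves : ∀ {n} → Subset n → Subset n → ℕ
halves {zero} T A = 1
halves {suc n} T A = (if T zero then (if A zero then 1 else 2) else 1) * halves (T ∘ suc) (A ∘ suc)

halves-count : ∀ {n} (T A : Subset n) → halves T A * 2 ^ card (T ∩ A) ≡ 2 ^ card T
halves-count {zero} T A = refl
halves-count {suc n} T A with T zero | A zero
... | true | true = trans (double (halves (T ∘ suc) (A ∘ suc)) _)
    (cong (2 *_) (halves-count (T ∘ suc) (A ∘ suc)))
  where
  double : ∀ h x → 1 * h * (2 * x) ≡ 2 * (h * x)
  double = solve-∀
... | true | false = trans (*-assoc 2 (halves (T ∘ suc) (A ∘ suc)) _) (cong (2 *_) (halves-count (T ∘ suc) (A ∘ suc)))
... | false | b = trans (cong (_* 2 ^ card ((T ∘ suc) ∩ (A ∘ suc))) (*-identityˡ (halves (T ∘ suc) (A ∘ suc)))) (halves-count (T ∘ suc) (A ∘ suc))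

samp-halves : ∀ q n (T : Subset n) →
  samp q n (halves T) * suc q ^ card T ≡ suc q ^ n * (1 + 2 * q) ^ card T
samp-halves q zero T = refl
samp-halves q (suc n) T with T zero
... | true = trans (cong (_* (suc q * suc q ^ card (T ∘ suc)))
      (cong₂ (λ x y → x + q * y) (samp-*ˡ q n 1 (halves (T ∘ suc))) (samp-*ˡ q n 2 (halves (T ∘ suc)))))
    (trans (step₁ (samp q n (halves (T ∘ suc))) (suc q) (suc q ^ card (T ∘ suc)) q)
    (trans (cong (λ x → (1 + 2 * q) * suc q * x) (samp-halves q n (T ∘ suc)))
      (step₂ q (suc q ^ n) ((1 + 2 * q) ^ card (T ∘ suc)))))
  where
  step₁ : ∀ s Q x q → (1 * s + q * (2 * s)) * (Q * x) ≡ (1 + 2 * q) * Q * (s * x)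
  step₁ = solve-∀
  step₂ : ∀ q N M → (1 + 2 * q) * (1 + q) * (N * M) ≡ (1 + q) * N * ((1 + 2 * q) * M)
  step₂ = solve-∀
... | false = trans (cong (_* suc q ^ card (T ∘ suc))
      (cong₂ (λ x y → x + q * y) (samp-*ˡ q n 1 (halves (T ∘ suc))) (samp-*ˡ q n 1 (halves (T ∘ suc)))))
    (trans (step₁ (samp q n (halves (T ∘ suc))) (suc q ^ card (T ∘ suc)) q)
    (trans (cong ((1 + q) *_) (samp-halves q n (T ∘ suc))) (sym (*-assoc (suc q) (suc q ^ n) _))))
  where
  step₁ : ∀ s x q → (1 * s + q * (1 * s)) * x ≡ (1 + q) * (s * x)
  step₁ = solve-∀

^-distribʳ-* : ∀ t a b → (a * b) ^ t ≡ a ^ t * b ^ t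
^-distribʳ-* zero a b = refl
^-distribʳ-* (suc t) a b = trans (cong (a * b *_) (^-distribʳ-* t a b))
  (*-interchange a b (a ^ t) (b ^ t))

-- Bernoulli's inequality 1 + c/x ≤ (1 + 1/x)^c, multiplied by x^(c + 1).
bernoulli : ∀ x c → (x + c) * x ^ c ≤ x * (1 + x) ^ c
bernoulli x zero = ≤-reflexive (cong (_* 1) (+-identityʳ x))
bernoulli x (suc c) = begin
  (x + suc c) * (x * x ^ c) ≤⟨ m≤m+n _ (c * x ^ c) ⟩
  (x + suc c) * (x * x ^ c) + c * x ^ c ≡⟨ expand x c (x ^ c) ⟩
  (1 + x) * ((x + c) * x ^ c) ≤⟨ *-monoʳ-≤ (1 + x) (bernoulli x c) ⟩
  (1 + x) * (x * (1 + x) ^ c) ≡⟨ exchange (1 + x) x _ ⟩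
  x * ((1 + x) * (1 + x) ^ c) ∎
  where
  open ≤-Reasoning
  expand : ∀ x c p → (x + (1 + c)) * (x * p) + c * p ≡ (1 + x) * ((x + c) * p)
  expand = solve-∀
  exchange : ∀ a b c → a * (b * c) ≡ b * (a * c)
  exchange = solve-∀

samp-few-arith : ∀ {s G N y t k} c Q .⦃ _ : NonZero y ⦄ .⦃ _ : NonZero Q ⦄ →
  2 ^ t * s ≤ k * G → G * Q ^ t ≡ N * y ^ t → c * k * y ≤ t → 1 + y ≡ 2 * Q → c * s ≤ N
samp-few-arith {s} {G} {N} {y} {t} {k} c Q markov expect large double =
  *-cancelʳ-≤ _ _ (2 ^ t * Q ^ t) ⦃ m*n≢0 _ _ ⦃ m^n≢0 2 t ⦄ ⦃ m^n≢0 Q t ⦄ ⦄ (begin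
  c * s * (2 ^ t * Q ^ t) ≡⟨ rearrange c s (2 ^ t) (Q ^ t) ⟩
  c * (2 ^ t * s) * Q ^ t ≤⟨ *-monoˡ-≤ (Q ^ t) (*-monoʳ-≤ c markov) ⟩
  c * (k * G) * Q ^ t ≡⟨ regroup c k G (Q ^ t) ⟩
  c * k * (G * Q ^ t) ≡⟨ cong (c * k *_) expect ⟩
  c * k * (N * y ^ t) ≡⟨ x∙yz≈y∙xz (c * k) N _ ⟩
  N * (c * k * y ^ t) ≤⟨ *-monoʳ-≤ N (*-cancelˡ-≤ y (begin
    y * (c * k * y ^ t) ≡⟨ rot y (c * k) _ ⟩
    c * k * y * y ^ t ≤⟨ *-monoˡ-≤ (y ^ t) (≤-trans large (m≤n+m t y)) ⟩
    (y + t) * y ^ t ≤⟨ bernoulli y t ⟩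
    y * (1 + y) ^ t ∎)) ⟩
  N * (1 + y) ^ t ≡⟨ cong (λ x → N * x ^ t) double ⟩
  N * (2 * Q) ^ t ≡⟨ cong (N *_) (^-distribʳ-* t 2 Q) ⟩
  N * (2 ^ t * Q ^ t) ∎)
  where
  open ≤-Reasoning
  rearrange : ∀ c s a b → c * s * (a * b) ≡ c * (a * s) * b
  rearrange = solve-∀
  regroup : ∀ c k s b → c * (k * s) * b ≡ c * k * (s * b)
  regroup = solve-∀
  rot : ∀ y a b → y * (a * b) ≡ a * y * b
  rot = solve-∀

-- Let y = 1 + 2q and t = card T. Markov's inequality for the exponential moment bounds the
-- probability of fewer than `κ` sampled elements by 2^κ (y / (1 + y))^t, and Bernoulli's inequality
-- bounds this by 2^κ y / (y + t), which is at most 1/c.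
samp-few : ∀ q n (T : Subset n) κ c → c * 2 ^ κ * (1 + 2 * q) ≤ card T →
  c * samp q n (λ A → ⟦ does (card (T ∩ A) <? κ) ⟧) ≤ suc q ^ n
samp-few q n T κ c large = samp-few-arith c (suc q) (begin
    2 ^ card T * samp q n (λ A → ⟦ few A ⟧) ≡⟨ samp-*ˡ q n (2 ^ card T) _ ⟨
    samp q n (λ A → 2 ^ card T * ⟦ few A ⟧) ≤⟨ samp-mono q n point ⟩
    samp q n (λ A → 2 ^ κ * halves T A) ≡⟨ samp-*ˡ q n (2 ^ κ) _ ⟩
    2 ^ κ * samp q n (halves T) ∎)
  (samp-halves q n T) large (double q)
  where
  open ≤-Reasoning
  few : Subset n → Bool
  few A = does (card (T ∩ A) <? κ)
  double : ∀ q → 1 + (1 + 2 * q) ≡ 2 * (1 + q)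
  double = solve-∀
  -- Markov's inequality for 2 ^ (κ ∸ card (T ∩ A))
  point : ∀ A → 2 ^ card T * ⟦ few A ⟧ ≤ 2 ^ κ * halves T A
  point A = ≤-trans (≤-reflexive (*-comm (2 ^ card T) _)) (⟦⟧*≤ (few A) λ e → begin
    2 ^ card T ≡⟨ halves-count T A ⟨
    halves T A * 2 ^ card (T ∩ A) ≤⟨ *-monoʳ-≤ (halves T A)
      (^-monoʳ-≤ 2 (<⇒≤ (dec-proof (card (T ∩ A) <? κ) e))) ⟩
    halves T A * 2 ^ κ ≡⟨ *-comm _ (2 ^ κ) ⟩
    2 ^ κ * halves T A ∎)

-- Extracting an induced bipartite subgraph from a family of stars

extraction-arith : ∀ {Q N p E cI cH sI sC sH Q₂} .⦃ _ : NonZero Q ⦄ .⦃ _ : NonZero N ⦄ .⦃ _ : NonZero p ⦄ →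
  cI * (Q * N) ≤ 2 * (sI * (Q * p)) → sC * (p * p) ≤ E * N → sH * Q ≤ cH * N →
  2 * (Q * E + Q₂ * Q₂ * (p * p) * cH) < Q₂ * (Q * p) * cI → sC + Q₂ * Q₂ * sH < Q₂ * sI
extraction-arith {Q} {N} {p} {E} {cI} {cH} {sI} {sC} {sH} {Q₂} hI hC hH hyp =
  *-cancelʳ-< (2 * (Q * (p * p))) _ _ (begin-strict
  (sC + Q₂ * Q₂ * sH) * (2 * (Q * (p * p)))
    ≡⟨ split sC Q₂ sH Q p ⟩
  2 * (Q * (sC * (p * p)) + Q₂ * Q₂ * (p * p) * (sH * Q))
    ≤⟨ *-monoʳ-≤ 2 (+-mono-≤ (*-monoʳ-≤ Q hC) (*-monoʳ-≤ (Q₂ * Q₂ * (p * p)) hH)) ⟩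
  2 * (Q * (E * N) + Q₂ * Q₂ * (p * p) * (cH * N))
    ≡⟨ gather Q E N Q₂ p cH ⟩
  2 * (Q * E + Q₂ * Q₂ * (p * p) * cH) * N
    <⟨ *-monoˡ-< N hyp ⟩
  Q₂ * (Q * p) * cI * N
    ≡⟨ regroup Q₂ Q p cI N ⟩
  Q₂ * p * (cI * (Q * N))
    ≤⟨ *-monoʳ-≤ (Q₂ * p) hI ⟩
  Q₂ * p * (2 * (sI * (Q * p)))
    ≡⟨ finish Q₂ p sI Q ⟩
  Q₂ * sI * (2 * (Q * (p * p))) ∎)
  where
  open ≤-Reasoning
  split : ∀ sC R sH Q p → (sC + R * R * sH) * (2 * (Q * (p * p))) ≡
    2 * (Q * (sC * (p * p)) + R * R * (p * p) * (sH * Q))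
  split = solve-∀
  gather : ∀ Q E N R p c → 2 * (Q * (E * N) + R * R * (p * p) * (c * N)) ≡
    2 * (Q * E + R * R * (p * p) * c) * N
  gather = solve-∀
  regroup : ∀ R Q p c N → R * (Q * p) * c * N ≡ R * p * (c * (Q * N))
  regroup = solve-∀
  finish : ∀ R p s Q → R * p * (2 * (s * (Q * p))) ≡ R * s * (2 * (Q * (p * p)))
  finish = solve-∀

-- Every edge inside H ∩ A is oriented by o, so keeping the vertices without out-neighbour leaves an independent set.
pruned : ∀ {n} → Rel n → Subset n → Subset n → Subset n
pruned o H A v = (H ∩ A) v ∧ not (some ((H ∩ A) ∩ o v))

-- The stars S i of adjacent centres being disjoint, two adjacent centres survive together with probability
-- 1/p², against about 1/p for one; this is what makes the final deletion possible when |I| and |H| are comparable.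
module _ {n : ℕ} (adj o : Rel n) (I H : Subset n) (S : Fin n → Subset n) (κ q : ℕ)
  (S⊑H : ∀ i → I i ≡ true → S i ⊑ H)
  (card-S : ∀ i → I i ≡ true → card (S i) ≡ κ)
  (S-indep : ∀ i → I i ≡ true → ∀ h g → S i h ≡ true → S i g ≡ true → o h g ≡ false)
  (S-out : ∀ i → I i ≡ true → 2 * edges o (S i) H ≤ suc q)
  where

  private
    Q N p : ℕ
    Q = suc q
    N = suc q ^ n
    p = suc q ^ κ

  survivors : Subset n → Subset n
  survivors A = I ∩ (λ i → sub (S i) (pruned o H A))

  -- Counts the witnesses for a sampled star that does not survive: a leaf with a sampled
  -- out-neighbour. The union bound over these witnesses thereby becomes an expectation.
  lost : Fin n → Subset n → ℕ
  lost i A = ∑[ h < n ] ∑[ g < n ] (⟦ S i h ⟧ * ⟦ H g ∧ o h g ⟧ * ⟦ sub (S i ∪ single g) A ⟧)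

  lost-witness : ∀ A i h g → S i ⊑ A → S i h ≡ true → ((H ∩ A) ∩ o h) g ≡ true → 1 ≤ lost i A
  lost-witness A i h g hS eh eg = ≤-trans (≤-reflexive (sym value))
    (≤-trans (term≤sum n (λ g → ⟦ S i h ⟧ * ⟦ H g ∧ o h g ⟧ * ⟦ sub (S i ∪ single g) A ⟧) g)
      (term≤sum n (λ h → ∑[ g < n ] (⟦ S i h ⟧ * ⟦ H g ∧ o h g ⟧ * ⟦ sub (S i ∪ single g) A ⟧)) h))
    where
    HA = ∧ˡ ((H ∩ A) g) eg
    value : ⟦ S i h ⟧ * ⟦ H g ∧ o h g ⟧ * ⟦ sub (S i ∪ single g) A ⟧ ≡ 1
    value = trans (cong₂ (λ x y → ⟦ x ⟧ * ⟦ y ⟧ * ⟦ sub (S i ∪ single g) A ⟧) eh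
        (∧-intro (∧ˡ (H g) HA) (∧ʳ ((H ∩ A) g) eg)))
      (cong (λ x → 1 * 1 * ⟦ x ⟧) (sub-∪ {T = S i} {single g} {A} hS
        (sub-sound (single g) A (sub-single g A (∧ʳ (H g) HA)))))

  survivor-or-lost : ∀ A i → I i ≡ true → ⟦ sub (S i) A ⟧ ≤ ⟦ survivors A i ⟧ + lost i A
  survivor-or-lost A i hi = ⟦⟧-≤ {sub (S i) A} λ hS → by-cases (sub-sound (S i) A hS) (lost i A) refl
    where
    by-cases : S i ⊑ A → ∀ l → lost i A ≡ l → 1 ≤ ⟦ survivors A i ⟧ + l
    by-cases hS (suc l) _ = m≤n⇒m≤o+n ⟦ survivors A i ⟧ (s≤s z≤n)
    by-cases hS zero e = ≤-trans (≤-reflexive (cong ⟦_⟧ (sym alive))) (m≤m+n _ 0)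
      where
      kept : S i ⊑ pruned o H A
      kept h eh = ∧-intro (∧-intro (S⊑H i hi h eh) (hS h eh)) (isolated (some ((H ∩ A) ∩ o h)) refl)
        where
        isolated : ∀ b → some ((H ∩ A) ∩ o h) ≡ b → not b ≡ true
        isolated false _ = refl
        isolated true q = ⊥-elim (<⇒≱ (lost-witness A i h (proj₁ w) hS eh (proj₂ w)) (≤-reflexive e))
          where w = some-∃ ((H ∩ A) ∩ o h) q
      alive : survivors A i ≡ true
      alive = ∧-intro hi (sub-complete (S i) (pruned o H A) kept)

  expected-lost : ∀ i → I i ≡ true → samp q n (lost i) * (Q * p) ≡ edges o (S i) H * N
  expected-lost i hi = trans
    (samp-sets₂ q n n n (λ h g → ⟦ S i h ⟧ * ⟦ H g ∧ o h g ⟧) (λ h g → S i ∪ single g) (suc κ) size)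
    (cong (_* N) (sym (edges-as-sum o (S i) H)))
    where
    -- The out-neighbour `g` lies outside `S i`, as no leaf of the star points to another; this
    -- yields the additional factor 1/Q.
    size : ∀ h g → ⟦ S i h ⟧ * ⟦ H g ∧ o h g ⟧ ≡ 0 ⊎ card (S i ∪ single g) ≡ suc κ
    size h g with S i h in eh
    ... | false = inj₁ refl
    ... | true = weight-cases true (H g ∧ o h g) λ e → trans
      (card-∪ {U = S i} {single g} λ v a b → true≢false (∧ʳ (H g) e)
        (S-indep i hi h g eh (subst (λ x → S i x ≡ true) (sym (dec-proof (g F.≟ v) b)) a)))
      (trans (cong₂ _+_ (card-S i hi) (card-single g)) (+-comm κ 1))

  -- A star is sampled with probability 1/p and, given that, lost with probability at most
  -- `edges o (S i) H` / Q ≤ 1/2. So it survives with probability at least 1/(2p).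
  expected-survivor : ∀ i → I i ≡ true → Q * N ≤ 2 * (samp q n (λ A → ⟦ survivors A i ⟧) * (Q * p))
  expected-survivor i hi = arith {samp q n (λ A → ⟦ sub (S i) A ⟧)} {samp q n (λ A → ⟦ survivors A i ⟧)}
      {samp q n (lost i)} {edges o (S i) H} {Q} {N} {p} (≤-trans
      (samp-mono q n λ A → survivor-or-lost A i hi)
      (≤-reflexive (samp-+ q n (λ A → ⟦ survivors A i ⟧) (lost i))))
    (trans (cong (λ c → samp q n (λ A → ⟦ sub (S i) A ⟧) * suc q ^ c) (sym (card-S i hi))) (samp-sub q n (S i)))
    (expected-lost i hi) (S-out i hi)
    where
    arith : ∀ {x s l e Q N p} → x ≤ s + l → x * p ≡ N → l * (Q * p) ≡ e * N → 2 * e ≤ Q →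
      Q * N ≤ 2 * (s * (Q * p))
    arith {x} {s} {l} {e} {Q} {N} {p} h₁ h₂ h₃ h₄ = +-cancelʳ-≤ (2 * (l * (Q * p))) _ _ (begin
      Q * N + 2 * (l * (Q * p)) ≡⟨ cong (λ y → Q * N + 2 * y) h₃ ⟩
      Q * N + 2 * (e * N) ≡⟨ cong (Q * N +_) (sym (*-assoc 2 e N)) ⟩
      Q * N + 2 * e * N ≤⟨ +-monoʳ-≤ (Q * N) (*-monoˡ-≤ N h₄) ⟩
      Q * N + Q * N ≡⟨ cong (λ y → Q * y + Q * y) (sym h₂) ⟩
      Q * (x * p) + Q * (x * p) ≡⟨ double x Q p ⟩
      2 * (x * (Q * p)) ≤⟨ *-monoʳ-≤ 2 (*-monoˡ-≤ (Q * p) h₁) ⟩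
      2 * ((s + l) * (Q * p)) ≡⟨ split s l (Q * p) ⟩
      2 * (s * (Q * p)) + 2 * (l * (Q * p)) ∎)
      where
      open ≤-Reasoning
      double : ∀ x Q p → Q * (x * p) + Q * (x * p) ≡ 2 * (x * (Q * p))
      double = solve-∀
      split : ∀ s l y → 2 * ((s + l) * y) ≡ 2 * (s * y) + 2 * (l * y)
      split = solve-∀

  expected-survivors : card I * (Q * N) ≤ 2 * (samp q n (card ∘ survivors) * (Q * p))
  expected-survivors = begin
    card I * (Q * N)
      ≡⟨ sum-*ʳ n (Q * N) _ ⟨
    ∑[ i < n ] (⟦ I i ⟧ * (Q * N))
      ≤⟨ sum-mono n (λ i → ⟦⟧*≤ (I i) (expected-survivor i)) ⟩
    ∑[ i < n ] (2 * (samp q n (λ A → ⟦ survivors A i ⟧) * (Q * p)))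
      ≡⟨ trans (sum-*ˡ n 2 _) (cong (2 *_) (sum-*ʳ n (Q * p) _)) ⟩
    2 * ((∑[ i < n ] samp q n (λ A → ⟦ survivors A i ⟧)) * (Q * p))
      ≡⟨ cong (λ x → 2 * (x * (Q * p))) (samp-sum q n n _) ⟨
    2 * (samp q n (card ∘ survivors) * (Q * p)) ∎
    where open ≤-Reasoning

  sub-S : ∀ A i → survivors A i ≡ true → S i ⊑ pruned o H A
  sub-S A i e = sub-sound (S i) (pruned o H A) (∧ʳ (I i) e)

  pruned⊑ : ∀ A → pruned o H A ⊑ (H ∩ A)
  pruned⊑ A v = ∧ˡ ((H ∩ A) v)

  pruned-indep : (∀ u v → adj u v ≡ true → o u v ≡ true ⊎ o v u ≡ true) →
    ∀ A u v → pruned o H A u ≡ true → pruned o H A v ≡ true → adj u v ≡ false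
  pruned-indep orient A u v hu hv = by-cases (adj u v) refl
    where
    no-out : ∀ u v → pruned o H A u ≡ true → pruned o H A v ≡ true → o u v ≡ true → ⊥
    no-out u v hu hv e = none ((H ∩ A) ∩ o u) (not-true (∧ʳ ((H ∩ A) u) hu)) v
      (∧-intro (pruned⊑ A v hv) e)
    by-cases : ∀ b → adj u v ≡ b → b ≡ false
    by-cases false _ = refl
    by-cases true e = ⊥-elim (Data.Sum.[ no-out u v hu hv , no-out v u hv hu ] (orient u v e))

  colliding : Subset n → ℕ
  colliding A = ∑[ i < n ] ∑[ j < n ] (⟦ I i ⟧ * ⟦ I j ∧ adj i j ⟧ * ⟦ sub (S i ∪ S j) A ⟧)

  edges≤colliding : ∀ A → edges adj (survivors A) (survivors A) ≤ colliding A
  edges≤colliding A = ≤-trans (≤-reflexive (edges-as-sum adj (survivors A) (survivors A)))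
    (sum-mono n λ i → sum-mono n (point i))
    where
    S⊑A : ∀ i → survivors A i ≡ true → S i ⊑ A
    S⊑A i e v ev = ∧ʳ (H v) (pruned⊑ A v (sub-S A i e v ev))
    point : ∀ i j → ⟦ survivors A i ⟧ * ⟦ survivors A j ∧ adj i j ⟧ ≤
      ⟦ I i ⟧ * ⟦ I j ∧ adj i j ⟧ * ⟦ sub (S i ∪ S j) A ⟧
    point i j = ⟦⟧*≤ (survivors A i) λ hi → ⟦⟧-≤ {survivors A j ∧ adj i j} λ hj →
      ≤-reflexive (sym (trans
        (cong₂ (λ x y → ⟦ x ⟧ * ⟦ y ⟧ * ⟦ sub (S i ∪ S j) A ⟧) (∧ˡ (I i) hi)
          (∧-intro (∧ˡ (I j) (∧ˡ (survivors A j) hj)) (∧ʳ (survivors A j) hj)))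
        (cong (λ x → 1 * 1 * ⟦ x ⟧) (sub-∪ {T = S i} {S j} {A} (S⊑A i hi)
          (S⊑A j (∧ˡ (survivors A j) hj))))))

  DisjointOnEdges : Set
  DisjointOnEdges = ∀ i j → I i ≡ true → I j ≡ true → adj i j ≡ true →
    ∀ h → S i h ≡ true → S j h ≡ true → ⊥

  expected-colliding : DisjointOnEdges → samp q n colliding * (p * p) ≡ edges adj I I * N
  expected-colliding disj = trans (cong (samp q n colliding *_) (sym (^-distribˡ-+-* Q κ κ)))
    (trans (samp-sets₂ q n n n (λ i j → ⟦ I i ⟧ * ⟦ I j ∧ adj i j ⟧) (λ i j → S i ∪ S j) (κ + κ) size)
      (cong (_* N) (sym (edges-as-sum adj I I))))
    where
    size : ∀ i j → ⟦ I i ⟧ * ⟦ I j ∧ adj i j ⟧ ≡ 0 ⊎ card (S i ∪ S j) ≡ κ + κ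
    size i j with I i in hi
    ... | false = inj₁ refl
    ... | true = weight-cases true (I j ∧ adj i j) λ e → trans
      (card-∪ {U = S i} {S j} (disj i j hi (∧ˡ (I j) e) (∧ʳ (I j) e)))
      (cong₂ _+_ (card-S i hi) (card-S j (∧ˡ (I j) e)))

  -- The hypothesis is the comparison of expectations e(I)/p² + Q₂² |H|/Q < Q₂ |I|/(2p), multiplied
  -- by 2Qp².
  extraction-sample : ∀ Q₂ → DisjointOnEdges →
    2 * (Q * edges adj I I + Q₂ * Q₂ * (p * p) * card H) < Q₂ * (Q * p) * card I →
    ∃ λ A → edges adj (survivors A) (survivors A) + Q₂ * Q₂ * card (pruned o H A) < Q₂ * card (survivors A)
  extraction-sample Q₂ disj hyp = samp-∃ q n (begin-strict
    samp q n (λ A → edges adj (survivors A) (survivors A) + Q₂ * Q₂ * card (pruned o H A))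
      ≤⟨ samp-mono q n (λ A → +-mono-≤ (edges≤colliding A) (*-monoʳ-≤ (Q₂ * Q₂)
           (card-mono {U = pruned o H A} {H ∩ A} (pruned⊑ A)))) ⟩
    samp q n (λ A → colliding A + Q₂ * Q₂ * card (H ∩ A))
      ≡⟨ trans (samp-+ q n _ _) (cong (samp q n colliding +_) (samp-*ˡ q n (Q₂ * Q₂) (λ A → card (H ∩ A)))) ⟩
    samp q n colliding + Q₂ * Q₂ * samp q n (λ A → card (H ∩ A))
      <⟨ extraction-arith {Q = Q} {N} {p} {edges adj I I} {card I} {card H} {Q₂ = Q₂} ⦃ _ ⦄ ⦃ m^n≢0 Q n ⦄ ⦃ m^n≢0 Q κ ⦄ expected-survivors
           (≤-reflexive (expected-colliding disj)) (≤-reflexive (samp-card q n H)) hyp ⟩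
    Q₂ * samp q n (card ∘ survivors)
      ≡⟨ samp-*ˡ q n Q₂ (card ∘ survivors) ⟨
    samp q n (λ A → Q₂ * card (survivors A)) ∎)
    where open ≤-Reasoning

  -- A second sampling, now of the surviving centres and with rate 1/(1 + q₂), makes them
  -- independent by deletion. `H′` is not thinned along with them, so every remaining centre keeps
  -- its whole star.
  bipartite-extraction : ∀ q₂ → (∀ u → adj u u ≡ false) →
    (∀ u v → adj u v ≡ true → o u v ≡ true ⊎ o v u ≡ true) → DisjointOnEdges →
    2 * (Q * edges adj I I + suc q₂ * suc q₂ * (p * p) * card H) < suc q₂ * (Q * p) * card I →
    Σ (Subset n) λ B → Σ (Subset n) λ H′ → B ⊑ I × H′ ⊑ H ×
      (∀ u v → B u ≡ true → B v ≡ true → adj u v ≡ false) ×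
      (∀ u v → H′ u ≡ true → H′ v ≡ true → adj u v ≡ false) ×
      (∀ i → B i ≡ true → S i ⊑ H′) × card H′ < card B
  bipartite-extraction q₂ irr orient disj hyp = finish (extraction-sample (suc q₂) disj hyp)
    where
    shape : ∀ x R y → 1 * x + 0 * x + R * (R * 1) * y ≡ x + R * R * y
    shape = solve-∀
    finish : (∃ λ A → edges adj (survivors A) (survivors A) + suc q₂ * suc q₂ * card (pruned o H A)
        < suc q₂ * card (survivors A)) → _
    finish (A , found) = conclude (deletion q₂ (survivors A) adj adj irr irr 1 0 (card (pruned o H A))
        (subst₂ _<_ (sym (shape (edges adj (survivors A) (survivors A)) (suc q₂) (card (pruned o H A))))
          (sym (*-identityˡ (suc q₂ * card (survivors A)))) found))
      where
      conclude : (Σ (Subset n) λ B → B ⊑ survivors A ×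
        (∀ u v → B u ≡ true → B v ≡ true → adj u v ≡ false) ×
        0 * edges adj B B + card (pruned o H A) < 1 * card B) → _
      conclude (B , B⊑ , free , bound) = B , pruned o H A , (λ v e → ∧ˡ (I v) (B⊑ v e)) ,
        (λ v e → ∧ˡ (H v) (pruned⊑ A v e)) , free , pruned-indep orient A ,
        (λ i e → sub-S A i (B⊑ i e)) , <-≤-trans bound (≤-reflexive (*-identityˡ (card B)))

-- Many nonadjacent pairs in the absence of K_{s,s}

HasKss : ∀ {n} → ℕ → Rel n → Set
HasKss {n} s adj = Σ (Fin s → Fin n) λ f → Σ (Fin s → Fin n) λ g →
  Injective _≡_ _≡_ f × Injective _≡_ _≡_ g × (∀ i j → f i ≢ g j) × (∀ i j → adj (f i) (g j) ≡ true)

apart : ∀ {n} → Rel n → Rel n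
apart adj u v = not (adj u v) ∧ not (single u v)

-- Fewer than s vertices of S can be adjacent to nearly all of T, since s of them would have s common neighbours.
nonadjacent-pairs : ∀ {n} (adj : Rel n) (irr : ∀ u → adj u u ≡ false) s .⦃ _ : NonZero s ⦄ →
  ¬ HasKss s adj → (S T : Subset n) →
  card S * card T ≤ 4 * s * (edges (apart adj) S T + (card S + card T))
nonadjacent-pairs {n} adj irr s no-K S T = by-cases (s ≤? card bad) (card T ≤? 4 * s)
  where
  open ≤-Reasoning
  c : Fin n → ℕ
  c p = card (T ∩ apart adj p)
  bad : Subset n
  bad p = S p ∧ does (2 * s * c p <? card T)
  few-bad : card bad < s → card S * card T ≤ 4 * s * (edges (apart adj) S T + (card S + card T))
  few-bad h = begin
    card S * card T ≡⟨ sum-*ʳ n (card T) _ ⟨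
    ∑[ p < n ] (⟦ S p ⟧ * card T) ≤⟨ sum-mono n point ⟩
    ∑[ p < n ] (2 * s * (⟦ S p ⟧ * c p) + ⟦ bad p ⟧ * card T)
      ≡⟨ trans (sum-+ n _ _) (cong₂ _+_ (sum-*ˡ n (2 * s) _) (sum-*ʳ n (card T) _)) ⟩
    2 * s * edges (apart adj) S T + card bad * card T ≤⟨ +-monoʳ-≤ _ (*-monoˡ-≤ (card T) (<⇒≤ h)) ⟩
    2 * s * edges (apart adj) S T + s * card T ≤⟨ m≤m+n _ _ ⟩
    2 * s * edges (apart adj) S T + s * card T + (2 * s * edges (apart adj) S T + 4 * s * card S + 3 * s * card T)
      ≡⟨ collect s _ (card S) (card T) ⟩
    4 * s * (edges (apart adj) S T + (card S + card T)) ∎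
    where
    collect : ∀ s e x y → 2 * s * e + s * y + (2 * s * e + 4 * s * x + 3 * s * y) ≡ 4 * s * (e + (x + y))
    collect = solve-∀
    point : ∀ p → ⟦ S p ⟧ * card T ≤ 2 * s * (⟦ S p ⟧ * c p) + ⟦ bad p ⟧ * card T
    point p with S p
    ... | false = z≤n
    ... | true = by-dec (2 * s * c p <? card T)
      where
      by-dec : (d : Dec (2 * s * c p < card T)) → 1 * card T ≤ 2 * s * (1 * c p) + ⟦ does d ⟧ * card T
      by-dec (yes _) = m≤n+m (1 * card T) (2 * s * (1 * c p))
      by-dec (no ¬l) = ≤-trans (≤-trans (≤-reflexive (*-identityˡ (card T))) (≮⇒≥ ¬l))
        (≤-trans (≤-reflexive (cong (2 * s *_) (sym (*-identityˡ (c p))))) (m≤m+n (2 * s * (1 * c p)) _))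
  many-bad : s ≤ card bad → 4 * s < card T → HasKss s adj
  many-bad h large = f , proj₁ pick-g , f-inj , proj₁ (proj₂ pick-g) ,
    (λ i j e → true≢false (adjacent i j) (subst (λ x → adj (f i) x ≡ false) e (irr (f i)))) , adjacent
    where
    pick-f = choose {s = s} bad h
    f = proj₁ pick-f
    f-inj = proj₁ (proj₂ pick-f)
    common? : ∀ q → Dec (∀ j → adj (f j) q ≡ true)
    common? q = all? λ j → adj (f j) q B.≟ true
    Y : Subset n
    Y q = T q ∧ does (common? q)
    missing : Fin s → Subset n
    missing j = T ∩ (not ∘ adj (f j))
    cover : card T ≤ card Y + ∑[ j < s ] card (missing j)
    cover = ≤-trans (sum-mono n point) (≤-reflexive (trans (sum-+ n _ _)
      (cong (card Y +_) (sum-swap n s λ q j → ⟦ missing j q ⟧))))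
      where
      point : ∀ q → ⟦ T q ⟧ ≤ ⟦ Y q ⟧ + ∑[ j < s ] ⟦ missing j q ⟧
      point q with T q
      ... | false = z≤n
      ... | true = by-dec (common? q)
        where
        by-dec : (d : Dec (∀ j → adj (f j) q ≡ true)) → 1 ≤ ⟦ does d ⟧ + ∑[ j < s ] ⟦ not (adj (f j) q) ⟧
        by-dec (yes _) = s≤s z≤n
        by-dec (no ¬a) = nonneighbour (any? (λ j → adj (f j) q B.≟ false))
          where
          nonneighbour : Dec (∃ λ j → adj (f j) q ≡ false) → 1 ≤ ∑[ j < s ] ⟦ not (adj (f j) q) ⟧
          nonneighbour (yes (j , e)) = ≤-trans (≤-reflexive (cong (λ b → ⟦ not b ⟧) (sym e)))
            (term≤sum s (λ j → ⟦ not (adj (f j) q) ⟧) j)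
          nonneighbour (no ¬e) = ⊥-elim (¬a λ j → B.¬-not λ e → ¬e (j , e))
    -- The additional 2s stands for `f j` itself, which is not adjacent to itself but not `apart`
    -- from itself either.
    missing-few : ∀ j → 2 * s * card (missing j) ≤ card T + 2 * s
    missing-few j = begin
      2 * s * card (missing j) ≤⟨ *-monoʳ-≤ (2 * s) (≤-trans (card-mono {U = missing j} {(T ∩ apart adj (f j)) ∪ single (f j)} split)
          (card-∪-≤ (T ∩ apart adj (f j)) (single (f j)))) ⟩
      2 * s * (c (f j) + card (single (f j))) ≡⟨ *-distribˡ-+ (2 * s) (c (f j)) _ ⟩
      2 * s * c (f j) + 2 * s * card (single (f j))
        ≤⟨ +-mono-≤ (<⇒≤ (dec-proof (2 * s * c (f j) <? card T) (∧ʳ (S (f j)) (proj₂ (proj₂ pick-f) j))))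
             (≤-reflexive (trans (cong (2 * s *_) (card-single (f j))) (*-identityʳ (2 * s)))) ⟩
      card T + 2 * s ∎
      where
      split : missing j ⊑ ((T ∩ apart adj (f j)) ∪ single (f j))
      split v e with T v | adj (f j) v | single (f j) v
      split v refl | true | false | true = refl
      split v refl | true | false | false = refl
    -- The s chosen vertices miss at most |T|/2 + s elements of `T` altogether, and |T| > 4s.
    enough : s ≤ card Y
    enough = ≮⇒≥ λ few → <⇒≱ (*-monoˡ-< s large) (*-cancelˡ-≤ 2 (+-cancelʳ-≤ (0 * s) _ _ (arith s (card T) (card Y) (∑[ j < s ] card (missing j))
      cover (begin
        2 * s * (∑[ j < s ] card (missing j)) ≡⟨ sum-*ˡ s (2 * s) _ ⟨
        ∑[ j < s ] (2 * s * card (missing j)) ≤⟨ sum-mono s missing-few ⟩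
        ∑[ j < s ] (card T + 2 * s) ≡⟨ sum-const s _ ⟩
        s * (card T + 2 * s) ∎) (<⇒≤ few))))
      where
      arith : ∀ s t y m → t ≤ y + m → 2 * s * m ≤ s * (t + 2 * s) → y ≤ s →
        2 * (t * s) + 0 * s ≤ 2 * (4 * s * s) + 0 * s
      arith s t y m h₁ h₂ h₃ = +-cancelʳ-≤ (2 * (s * (t + 2 * s))) _ _ (begin
        2 * (t * s) + 0 * s + 2 * (s * (t + 2 * s)) ≡⟨ e₁ s t ⟩
        2 * (2 * s * t) + 4 * (s * s) ≤⟨ +-monoˡ-≤ _ (*-monoʳ-≤ 2 (*-monoʳ-≤ (2 * s) h₁)) ⟩
        2 * (2 * s * (y + m)) + 4 * (s * s) ≡⟨ e₂ s y m ⟩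
        2 * (2 * s * y) + 2 * (2 * s * m) + 4 * (s * s) ≤⟨ +-monoˡ-≤ _ (+-mono-≤ (*-monoʳ-≤ 2 (*-monoʳ-≤ (2 * s) h₃)) (*-monoʳ-≤ 2 h₂)) ⟩
        2 * (2 * s * s) + 2 * (s * (t + 2 * s)) + 4 * (s * s) ≡⟨ e₃ s t ⟩
        2 * (4 * s * s) + 0 * s + 2 * (s * (t + 2 * s)) ∎)
        where
        e₁ : ∀ s t → 2 * (t * s) + 0 * s + 2 * (s * (t + 2 * s)) ≡ 2 * (2 * s * t) + 4 * (s * s)
        e₁ = solve-∀
        e₂ : ∀ s y m → 2 * (2 * s * (y + m)) + 4 * (s * s) ≡ 2 * (2 * s * y) + 2 * (2 * s * m) + 4 * (s * s)
        e₂ = solve-∀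
        e₃ : ∀ s t → 2 * (2 * s * s) + 2 * (s * (t + 2 * s)) + 4 * (s * s) ≡ 2 * (4 * s * s) + 0 * s + 2 * (s * (t + 2 * s))
        e₃ = solve-∀
    pick-g = choose {s = s} Y enough
    adjacent : ∀ i j → adj (f i) (proj₁ pick-g j) ≡ true
    adjacent i j = dec-proof (common? (proj₁ pick-g j)) (∧ʳ (T (proj₁ pick-g j)) (proj₂ (proj₂ pick-g) j)) i
  by-cases : Dec (s ≤ card bad) → Dec (card T ≤ 4 * s) →
    card S * card T ≤ 4 * s * (edges (apart adj) S T + (card S + card T))
  by-cases (no h) _ = few-bad (≰⇒> h)
  by-cases (yes h) (no large) = ⊥-elim (no-K (many-bad h (≰⇒> large)))
  -- For |T| ≤ 4s the additive term card S alone suffices.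
  by-cases (yes _) (yes small) = begin
    card S * card T ≤⟨ *-monoʳ-≤ (card S) small ⟩
    card S * (4 * s) ≡⟨ *-comm (card S) (4 * s) ⟩
    4 * s * card S ≤⟨ *-monoʳ-≤ (4 * s) (≤-trans (m≤m+n (card S) (card T)) (m≤n+m _ (edges (apart adj) S T))) ⟩
    4 * s * (edges (apart adj) S T + (card S + card T)) ∎

-- Sums over tuples, and homomorphisms of complete bipartite graphs

tsum : ∀ {N n} → (Fin n → Subset N) → (Vec (Fin N) n → ℕ) → ℕ
tsum {N} {zero} X f = f []
tsum {N} {suc n} X f = ∑[ v < N ] (⟦ X zero v ⟧ * tsum (X ∘ suc) (λ x → f (v ∷ x)))

volume : ∀ {N n} → (Fin n → Subset N) → ℕ
volume {n = zero} X = 1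
volume {n = suc n} X = card (X zero) * volume (X ∘ suc)

module _ {N : ℕ} where

  tsum-cong : ∀ {n} (X : Fin n → Subset N) {f g : Vec (Fin N) n → ℕ} → (∀ x → f x ≡ g x) → tsum X f ≡ tsum X g
  tsum-cong {zero} X h = h []
  tsum-cong {suc n} X h = sum-cong N λ v → cong (⟦ X zero v ⟧ *_) (tsum-cong (X ∘ suc) λ x → h (v ∷ x))

  tsum-mono : ∀ {n} (X : Fin n → Subset N) {f g : Vec (Fin N) n → ℕ} → (∀ x → f x ≤ g x) → tsum X f ≤ tsum X g
  tsum-mono {zero} X h = h []
  tsum-mono {suc n} X h = sum-mono N λ v → *-monoʳ-≤ ⟦ X zero v ⟧ (tsum-mono (X ∘ suc) λ x → h (v ∷ x))

  tsum-+ : ∀ {n} (X : Fin n → Subset N) (f g : Vec (Fin N) n → ℕ) →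
    tsum X (λ x → f x + g x) ≡ tsum X f + tsum X g
  tsum-+ {zero} X f g = refl
  tsum-+ {suc n} X f g = trans (sum-cong N λ v → trans (cong (⟦ X zero v ⟧ *_) (tsum-+ (X ∘ suc) _ _))
    (*-distribˡ-+ ⟦ X zero v ⟧ _ _)) (sum-+ N _ _)

  tsum-*ˡ : ∀ {n} (X : Fin n → Subset N) c (f : Vec (Fin N) n → ℕ) →
    tsum X (λ x → c * f x) ≡ c * tsum X f
  tsum-*ˡ {zero} X c f = refl
  tsum-*ˡ {suc n} X c f = trans (sum-cong N λ v → trans (cong (⟦ X zero v ⟧ *_) (tsum-*ˡ (X ∘ suc) c _))
    (x∙yz≈y∙xz ⟦ X zero v ⟧ c _)) (sum-*ˡ N c _)

  tsum-const : ∀ {n} (X : Fin n → Subset N) c → tsum X (λ _ → c) ≡ volume X * c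
  tsum-const {zero} X c = sym (*-identityˡ c)
  tsum-const {suc n} X c = trans (sum-cong N λ v → cong (⟦ X zero v ⟧ *_) (tsum-const (X ∘ suc) c))
    (trans (sum-*ʳ N (volume (X ∘ suc) * c) _) (sym (*-assoc (card (X zero)) _ c)))

  tsum-sum : ∀ {n} (X : Fin n → Subset N) m (f : Fin m → Vec (Fin N) n → ℕ) →
    tsum X (λ x → ∑[ i < m ] f i x) ≡ ∑[ i < m ] tsum X (f i)
  tsum-sum X zero f = trans (tsum-const X 0) (*-zeroʳ (volume X))
  tsum-sum X (suc m) f = trans (tsum-+ X (f zero) _) (cong (tsum X (f zero) +_) (tsum-sum X m (f ∘ suc)))

  tsum>0⇒∃ : ∀ {n} (X : Fin n → Subset N) {f : Vec (Fin N) n → ℕ} → 0 < tsum X f → ∃ λ x → 0 < f x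
  tsum>0⇒∃ {zero} X h = [] , h
  tsum>0⇒∃ {suc n} X {f} h with sum>0⇒∃ N h
  ... | v , h′ with X zero v
  ... | true with tsum>0⇒∃ (X ∘ suc) (subst (0 <_) (+-identityʳ (tsum (X ∘ suc) (λ x → f (v ∷ x)))) h′)
  ... | x , r = v ∷ x , r

  -- Resampling a coordinate: the old entry at `u` is forgotten, so every tuple arises once for each
  -- of the card (X u) possible old entries.
  tsum-update : ∀ {n} (X : Fin n → Subset N) u (f : Vec (Fin N) n → ℕ) →
    tsum X (λ x → ∑[ p < N ] (⟦ X u p ⟧ * f (x [ u ]≔ p))) ≡ card (X u) * tsum X f
  tsum-update X zero f = trans (sum-cong N λ v → cong (⟦ X zero v ⟧ *_)
      (trans (tsum-sum (X ∘ suc) N _) (sum-cong N λ p → tsum-*ˡ (X ∘ suc) ⟦ X zero p ⟧ _)))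
    (sum-*ʳ N _ _)
  tsum-update X (suc u) f = trans (sum-cong N λ v → trans
      (cong (⟦ X zero v ⟧ *_) (tsum-update (X ∘ suc) u (λ x → f (v ∷ x))))
      (x∙yz≈y∙xz ⟦ X zero v ⟧ (card (X (suc u))) _))
    (sum-*ˡ N (card (X (suc u))) _)

  tsum-++ : ∀ a {b} (X : Fin (a + b) → Subset N) (f : Vec (Fin N) (a + b) → ℕ) →
    tsum X f ≡ tsum (X ∘ (F._↑ˡ b)) (λ x → tsum (X ∘ (a F.↑ʳ_)) (λ y → f (x ++ y)))
  tsum-++ zero X f = refl
  tsum-++ (suc a) X f = sum-cong N λ v → cong (⟦ X zero v ⟧ *_) (tsum-++ a (X ∘ suc) (λ x → f (v ∷ x)))

power-threshold : ∀ M y b → M ^ b * y ≤ y ^ suc b + M ^ suc b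
power-threshold M y b with ≤-total M y
... | inj₁ h = ≤-trans (≤-trans (*-monoˡ-≤ y (^-monoˡ-≤ b h)) (≤-reflexive (*-comm (y ^ b) y))) (m≤m+n _ _)
... | inj₂ h = ≤-trans (≤-trans (*-monoʳ-≤ (M ^ b) h) (≤-reflexive (*-comm (M ^ b) M))) (m≤n+m _ (y ^ suc b))

volume-const : ∀ {N} a (X : Subset N) → volume {n = a} (λ _ → X) ≡ card X ^ a
volume-const zero X = refl
volume-const (suc a) X = cong (card X *_) (volume-const a X)

-- The power mean inequality up to a factor 2^(b + 1). Summing `power-threshold` with y = 2c · h x
-- leaves at least two copies of volume X · M^(b + 1) on the left and one on the right, and one
-- cancels.
tsum-power-mean : ∀ {N n} (X : Fin n → Subset N) (h : Vec (Fin N) n → ℕ) M c b →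
  volume X * M ≤ c * tsum X h →
  volume X * M ^ suc b ≤ (2 * c) ^ suc b * tsum X (λ x → h x ^ suc b)
tsum-power-mean X h M c b hyp = +-cancelʳ-≤ (volume X * M ^ suc b) _ _ (begin
  volume X * M ^ suc b + volume X * M ^ suc b
    ≡⟨ double (volume X) M (M ^ b) ⟩
  M ^ b * 2 * (volume X * M)
    ≤⟨ *-monoʳ-≤ (M ^ b * 2) hyp ⟩
  M ^ b * 2 * (c * tsum X h)
    ≡⟨ regroup (M ^ b) c (tsum X h) ⟩
  M ^ b * (2 * c) * tsum X h
    ≡⟨ tsum-*ˡ X (M ^ b * (2 * c)) h ⟨
  tsum X (λ x → M ^ b * (2 * c) * h x)
    ≤⟨ tsum-mono X (λ x → ≤-trans (≤-reflexive (*-assoc (M ^ b) (2 * c) (h x)))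
         (≤-trans (power-threshold M (2 * c * h x) b)
           (≤-reflexive (cong (_+ M ^ suc b) (^-distribʳ-* (suc b) (2 * c) (h x)))))) ⟩
  tsum X (λ x → (2 * c) ^ suc b * h x ^ suc b + M ^ suc b)
    ≡⟨ trans (tsum-+ X _ _) (cong₂ _+_ (tsum-*ˡ X ((2 * c) ^ suc b) _) (tsum-const X (M ^ suc b))) ⟩
  (2 * c) ^ suc b * tsum X (λ x → h x ^ suc b) + volume X * M ^ suc b ∎)
  where
  open ≤-Reasoning
  double : ∀ v M p → v * (M * p) + v * (M * p) ≡ p * 2 * (v * M)
  double = solve-∀
  regroup : ∀ p c t → p * 2 * (c * t) ≡ p * (2 * c) * t
  regroup = solve-∀

allV : ∀ {N n} → Subset N → Vec (Fin N) n → Bool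
allV P [] = true
allV P (v ∷ x) = P v ∧ allV P x

allV-lookup : ∀ {N n} (P : Subset N) (x : Vec (Fin N) n) → allV P x ≡ true → ∀ i → P (lookup x i) ≡ true
allV-lookup P (v ∷ x) h zero = ∧ˡ (P v) h
allV-lookup P (v ∷ x) h (suc i) = allV-lookup P x (∧ʳ (P v) h) i

tsum-allV : ∀ {N} n (X P : Subset N) → tsum {n = n} (λ _ → X) (λ x → ⟦ allV P x ⟧) ≡ card (X ∩ P) ^ n
tsum-allV zero X P = refl
tsum-allV {N} (suc n) X P = trans (sum-cong N λ v → trans (cong (⟦ X v ⟧ *_)
      (trans (tsum-cong {n = n} (λ _ → X) λ x → ⟦∧⟧ (P v) (allV P x)) (tsum-*ˡ {n = n} (λ _ → X) ⟦ P v ⟧ (λ x → ⟦ allV P x ⟧))))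
    (trans (sym (*-assoc ⟦ X v ⟧ ⟦ P v ⟧ _)) (cong₂ _*_ (sym (⟦∧⟧ (X v) (P v))) (tsum-allV n X P))))
  (sum-*ʳ N (card (X ∩ P) ^ n) _)

tsum-cong-sets : ∀ {N n} {X Y : Fin n → Subset N} (f : Vec (Fin N) n → ℕ) →
  (∀ i v → X i v ≡ Y i v) → tsum X f ≡ tsum Y f
tsum-cong-sets {N} {zero} f h = refl
tsum-cong-sets {N} {suc n} f h = sum-cong N λ v → cong₂ (λ b y → ⟦ b ⟧ * y) (h zero v)
  (tsum-cong-sets (λ x → f (v ∷ x)) (h ∘ suc))

-- Two power means. Over the vertices of `Y`, the degrees into `X` yield many stars with a + 1
-- leaves; double counting makes common neighbourhoods of (a + 1)-tuples large on average, and the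
-- second power mean, over these tuples, counts (b + 1)-tuples in them.
complete-bipartite-count : ∀ {N} (adj : Rel N) (X Y : Subset N) t a b →
  card X * card Y ≤ t * edges adj Y X →
  card X ^ suc a * card Y ^ suc b ≤ (2 * (2 * t) ^ suc a) ^ suc b *
    tsum {n = suc a} (λ _ → X) (λ x → tsum {n = suc b} (λ _ → Y) (λ y → ⟦ allV (λ v → allV (adj v) x) y ⟧))
complete-bipartite-count {N} adj X Y t a b hyp = begin
  card X ^ suc a * card Y ^ suc b
    ≡⟨ cong (_* card Y ^ suc b) (volume-const (suc a) X) ⟨
  volume {n = suc a} (λ _ → X) * card Y ^ suc b
    ≤⟨ tsum-power-mean {n = suc a} (λ _ → X) codeg (card Y) ((2 * t) ^ suc a) b first ⟩
  (2 * (2 * t) ^ suc a) ^ suc b * tsum {n = suc a} (λ _ → X) (λ x → codeg x ^ suc b)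
    ≡⟨ cong ((2 * (2 * t) ^ suc a) ^ suc b *_) (tsum-cong {n = suc a} (λ _ → X) λ x → tsum-allV (suc b) Y (λ v → allV (adj v) x)) ⟨
  (2 * (2 * t) ^ suc a) ^ suc b *
    tsum {n = suc a} (λ _ → X) (λ x → tsum {n = suc b} (λ _ → Y) (λ y → ⟦ allV (λ v → allV (adj v) x) y ⟧)) ∎
  where
  open ≤-Reasoning
  codeg : Vec (Fin N) (suc a) → ℕ
  codeg x = card (Y ∩ (λ v → allV (adj v) x))
  d : Vec (Fin N) 1 → ℕ
  d (v ∷ []) = card (X ∩ adj v)
  first : volume {n = suc a} (λ _ → X) * card Y ≤ (2 * t) ^ suc a * tsum {n = suc a} (λ _ → X) codeg
  first = begin
    volume {n = suc a} (λ _ → X) * card Y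
      ≡⟨ trans (cong (_* card Y) (volume-const (suc a) X)) (trans (*-comm _ (card Y))
           (cong (_* card X ^ suc a) (sym (*-identityʳ (card Y))))) ⟩
    card Y * 1 * card X ^ suc a
      ≤⟨ tsum-power-mean {n = 1} (λ _ → Y) d (card X) t a (≤-trans
           (≤-reflexive (trans (cong (_* card X) (*-identityʳ (card Y))) (*-comm (card Y) (card X)))) hyp) ⟩
    (2 * t) ^ suc a * ∑[ v < N ] (⟦ Y v ⟧ * card (X ∩ adj v) ^ suc a)
      ≡⟨ cong ((2 * t) ^ suc a *_) (sum-cong N λ v → cong (⟦ Y v ⟧ *_) (sym (tsum-allV (suc a) X (adj v)))) ⟩
    (2 * t) ^ suc a * ∑[ v < N ] (⟦ Y v ⟧ * tsum {n = suc a} (λ _ → X) (λ x → ⟦ allV (adj v) x ⟧))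
      ≡⟨ cong ((2 * t) ^ suc a *_) (sum-cong N λ v → sym (trans
           (tsum-cong {n = suc a} (λ _ → X) λ x → ⟦∧⟧ (Y v) (allV (adj v) x)) (tsum-*ˡ {n = suc a} (λ _ → X) ⟦ Y v ⟧ (λ x → ⟦ allV (adj v) x ⟧)))) ⟩
    (2 * t) ^ suc a * ∑[ v < N ] tsum {n = suc a} (λ _ → X) (λ x → ⟦ Y v ∧ allV (adj v) x ⟧)
      ≡⟨ cong ((2 * t) ^ suc a *_) (tsum-sum {n = suc a} (λ _ → X) N (λ v x → ⟦ Y v ∧ allV (adj v) x ⟧)) ⟨
    (2 * t) ^ suc a * tsum {n = suc a} (λ _ → X) codeg ∎

-- Making pairs nonadjacent one at a time

Constraints : ℕ → ℕ → Set
Constraints N n = Fin n → Fin n → Rel N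

-- A separate relation for each pair of coordinates expresses all stages between a homomorphism,
-- which has no requirement off the edges, and an induced copy, which has `apart` there.
Sat : ∀ {N n} → Constraints N n → Vec (Fin N) n → Set
Sat C x = ∀ i j → i F.< j → C i j (lookup x i) (lookup x j) ≡ true

sat? : ∀ {N n} (C : Constraints N n) x → Dec (Sat C x)
sat? C x = all? λ i → all? λ j → (i F.<? j) →-dec (C i j (lookup x i) (lookup x j) B.≟ true)

sat : ∀ {N n} → Constraints N n → Vec (Fin N) n → Bool
sat C x = does (sat? C x)

solutions : ∀ {N n} → (Fin n → Subset N) → Constraints N n → ℕ
solutions X C = tsum X (λ x → ⟦ sat C x ⟧)

impose : ∀ {N n} → Rel N → Fin n × Fin n → Constraints N n → Constraints N n
impose r (u , v) C i j = if single u i ∧ single v j then r else C i j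

impose-hit : ∀ {N n} (r : Rel N) (u v : Fin n) C → impose r (u , v) C u v ≡ r
impose-hit r u v C rewrite dec-true (u F.≟ u) refl | dec-true (v F.≟ v) refl = refl

impose-miss : ∀ {N n} (r : Rel N) (u v : Fin n) C i j → ¬ (i ≡ u × j ≡ v) → impose r (u , v) C i j ≡ C i j
impose-miss r u v C i j h with u F.≟ i | v F.≟ j
... | yes p | yes q = ⊥-elim (h (sym p , sym q))
... | yes p | no q = refl
... | no p | _ = refl

module _ {N : ℕ} (adj : Rel N) (irr : ∀ u → adj u u ≡ false) (s : ℕ) .⦃ s≢0 : NonZero s ⦄
  (no-K : ¬ HasKss s adj) where

  module _ {n : ℕ} (X : Fin n → Subset N) (C : Constraints N n) (u v : Fin n) (u<v : u F.< v) where
    private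
      r : Rel N
      r = apart adj
      C′ : Constraints N n
      C′ = impose r (u , v) C
      cu cv : ℕ
      cu = card (X u)
      cv = card (X v)
      u≢v : u ≢ v
      u≢v refl = F.<-irrefl {n = n} refl u<v
      put : Vec (Fin N) n → Fin N → Fin N → Vec (Fin N) n
      put x p q = (x [ u ]≔ p) [ v ]≔ q
      put-≢v : ∀ x p q q′ i → i ≢ v → lookup (put x p q) i ≡ lookup (put x p q′) i
      put-≢v x p q q′ i h = trans (lookup∘update′ h (x [ u ]≔ p) q) (sym (lookup∘update′ h (x [ u ]≔ p) q′))
      put-≢u : ∀ x p p′ q i → i ≢ u → lookup (put x p q) i ≡ lookup (put x p′ q) i
      put-≢u x p p′ q i h with i F.≟ v
      ... | yes refl = trans (lookup∘update v (x [ u ]≔ p) q) (sym (lookup∘update v (x [ u ]≔ p′) q))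
      ... | no h′ = trans (trans (lookup∘update′ h′ (x [ u ]≔ p) q) (lookup∘update′ h x p))
        (sym (trans (lookup∘update′ h′ (x [ u ]≔ p′) q) (lookup∘update′ h x p′)))
      put-u : ∀ x p q → lookup (put x p q) u ≡ p
      put-u x p q = trans (lookup∘update′ u≢v (x [ u ]≔ p) q) (lookup∘update u x p)
      put-v : ∀ x p q → lookup (put x p q) v ≡ q
      put-v x p q = lookup∘update v (x [ u ]≔ p) q

      S T : Vec (Fin N) n → Subset N
      S x p = X u p ∧ some (λ q → X v q ∧ sat C (put x p q))
      T x q = X v q ∧ some (λ p → X u p ∧ sat C (put x p q))

      total : Constraints N n → Vec (Fin N) n → ℕ
      total D x = ∑[ p < N ] (⟦ X u p ⟧ * ∑[ q < N ] (⟦ X v q ⟧ * ⟦ sat D (put x p q) ⟧))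

      total-sum : ∀ D → tsum X (total D) ≡ cu * (cv * solutions X D)
      total-sum D = trans (tsum-update X u (λ x → ∑[ q < N ] (⟦ X v q ⟧ * ⟦ sat D (x [ v ]≔ q) ⟧)))
        (cong (cu *_) (tsum-update X v (λ x → ⟦ sat D x ⟧)))

      some-intro : ∀ (U : Subset N) w → U w ≡ true → some U ≡ true
      some-intro U w e = dec-true (any? (λ v → U v B.≟ true)) (w , e)

      total≤ : ∀ x → total C x ≤ card (S x) * card (T x)
      total≤ x = ≤-trans (sum-mono N λ p → ≤-trans (≤-reflexive (sym (sum-*ˡ N ⟦ X u p ⟧ _))) (≤-trans (sum-mono N (point p))
          (≤-reflexive (sum-*ˡ N ⟦ S x p ⟧ _)))) (≤-reflexive (sum-*ʳ N (card (T x)) _))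
        where
        point : ∀ p q → ⟦ X u p ⟧ * (⟦ X v q ⟧ * ⟦ sat C (put x p q) ⟧) ≤ ⟦ S x p ⟧ * ⟦ T x q ⟧
        point p q = ⟦⟧*≤ (X u p) λ hp → ⟦⟧*≤ (X v q) λ hq → ⟦⟧-≤ {sat C (put x p q)} λ e →
          ≤-reflexive (sym (cong₂ (λ a b → ⟦ a ⟧ * ⟦ b ⟧)
            (∧-intro hp (some-intro (λ q → X v q ∧ sat C (put x p q)) q (∧-intro hq e)))
            (∧-intro hq (some-intro (λ p → X u p ∧ sat C (put x p q)) p (∧-intro hp e)))))

      -- A pair i < j other than (u , v) avoids `v` or avoids `u`. In the first case its constraint
      -- is inherited from the tuple witnessing that `p` lies in `S x`, in the second from the one
      -- for `q` in `T x`. Only the constraint at (u , v) is lost, and `r` takes its place.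
      recombine : ∀ x p q → S x p ≡ true → T x q ≡ true → r p q ≡ true → Sat C′ (put x p q)
      recombine x p q hS hT hr i j i<j = by-cases (i F.≟ u) (j F.≟ v) (i F.≟ v) (j F.≟ v)
        where
        w₁ = some-∃ (λ q → X v q ∧ sat C (put x p q)) (∧ʳ (X u p) hS)
        w₂ = some-∃ (λ p → X u p ∧ sat C (put x p q)) (∧ʳ (X v q) hT)
        q′ = proj₁ w₁
        p′ = proj₁ w₂
        sat₁ : Sat C (put x p q′)
        sat₁ = dec-proof (sat? C (put x p q′)) (∧ʳ (X v q′) (proj₂ w₁))
        sat₂ : Sat C (put x p′ q)
        sat₂ = dec-proof (sat? C (put x p′ q)) (∧ʳ (X u p′) (proj₂ w₂))
        Goal : Set
        Goal = C′ i j (lookup (put x p q) i) (lookup (put x p q) j) ≡ true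
        via-v : ¬ (i ≡ u × j ≡ v) → i ≢ v → j ≢ v → Goal
        via-v h hi hj = trans (cong (λ c → c (lookup (put x p q) i) (lookup (put x p q) j)) (impose-miss r u v C i j h))
          (trans (cong₂ (C i j) (put-≢v x p q q′ i hi) (put-≢v x p q q′ j hj)) (sat₁ i j i<j))
        via-u : ¬ (i ≡ u × j ≡ v) → i ≢ u → j ≢ u → Goal
        via-u h hi hj = trans (cong (λ c → c (lookup (put x p q) i) (lookup (put x p q) j)) (impose-miss r u v C i j h))
          (trans (cong₂ (C i j) (put-≢u x p p′ q i hi) (put-≢u x p p′ q j hj)) (sat₂ i j i<j))
        by-cases : Dec (i ≡ u) → Dec (j ≡ v) → Dec (i ≡ v) → Dec (j ≡ v) → Goal
        by-cases (yes refl) (yes refl) _ _ = trans (cong (λ c → c (lookup (put x p q) u) (lookup (put x p q) v)) (impose-hit r u v C))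
          (trans (cong₂ r (put-u x p q) (put-v x p q)) hr)
        by-cases (yes refl) (no j≢v) _ _ = via-v (λ h → j≢v (proj₂ h)) u≢v j≢v
        by-cases (no i≢u) _ (yes refl) _ = via-u (λ h → i≢u (proj₁ h)) i≢u
          (λ { refl → F.<-asym {n = n} u<v i<j })
        by-cases (no i≢u) _ (no i≢v) (yes refl) = via-u (λ h → i≢u (proj₁ h)) i≢u (λ e → u≢v (sym e))
        by-cases (no i≢u) _ (no i≢v) (no j≢v) = via-v (λ h → i≢u (proj₁ h)) i≢v j≢v

      edges≤total : ∀ x → edges r (S x) (T x) ≤ total C′ x
      edges≤total x = sum-mono N λ p → ≤-trans (≤-reflexive (sym (sum-*ˡ N ⟦ S x p ⟧ _))) (≤-trans (sum-mono N (point p))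
          (≤-reflexive (sum-*ˡ N ⟦ X u p ⟧ _)))
        where
        point : ∀ p q → ⟦ S x p ⟧ * ⟦ T x q ∧ r p q ⟧ ≤ ⟦ X u p ⟧ * (⟦ X v q ⟧ * ⟦ sat C′ (put x p q) ⟧)
        point p q = ⟦⟧*≤ (S x p) λ hp → ⟦⟧-≤ {T x q ∧ r p q} λ hq → ≤-reflexive (sym (trans
          (cong₂ (λ a b → ⟦ a ⟧ * (⟦ b ⟧ * ⟦ sat C′ (put x p q) ⟧)) (∧ˡ (X u p) hp) (∧ˡ (X v q) (∧ˡ (T x q) hq)))
          (cong (λ a → 1 * (1 * ⟦ a ⟧)) (dec-true (sat? C′ (put x p q))
            (recombine x p q hp (∧ˡ (T x q) hq) (∧ʳ (T x q) hq))))))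

      pointwise : ∀ x → total C x ≤ 4 * s * (total C′ x + (cu + cv))
      pointwise x = ≤-trans (total≤ x) (≤-trans (nonadjacent-pairs adj irr s no-K (S x) (T x))
        (*-monoʳ-≤ (4 * s) (+-mono-≤ (edges≤total x) (+-mono-≤
          (card-mono {U = S x} {X u} (λ p → ∧ˡ (X u p))) (card-mono {U = T x} {X v} (λ p → ∧ˡ (X v p)))))))

      summed : cu * (cv * solutions X C) ≤ 4 * s * (cu * (cv * solutions X C′) + volume X * (cu + cv))
      summed = begin
        cu * (cv * solutions X C) ≡⟨ total-sum C ⟨
        tsum X (total C) ≤⟨ tsum-mono X pointwise ⟩
        tsum X (λ x → 4 * s * (total C′ x + (cu + cv))) ≡⟨ tsum-*ˡ X (4 * s) _ ⟩
        4 * s * tsum X (λ x → total C′ x + (cu + cv))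
          ≡⟨ cong (4 * s *_) (trans (tsum-+ X (total C′) _) (cong₂ _+_ (total-sum C′) (tsum-const X (cu + cv)))) ⟩
        4 * s * (cu * (cv * solutions X C′) + volume X * (cu + cv)) ∎
        where open ≤-Reasoning

    -- The factor 4 s is the loss of nonadjacent-pairs; the volume term accounts for tuples with few extensions.
    switch : ∀ m → m ≤ cu → m ≤ cv →
      m * solutions X C ≤ 4 * s * (m * solutions X C′ + 2 * volume X)
    switch zero _ _ = z≤n
    switch m@(suc _) hu hv = arith (solutions X C) (solutions X C′) (volume X) (4 * s)
      ⦃ m*n≢0 cu cv ⦃ >-nonZero (≤-trans (s≤s z≤n) hu) ⦄ ⦃ >-nonZero (≤-trans (s≤s z≤n) hv) ⦄ ⦄ hu hv summed
      where
      arith : ∀ {m cu cv} T T′ V c .⦃ _ : NonZero (cu * cv) ⦄ → m ≤ cu → m ≤ cv →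
        cu * (cv * T) ≤ c * (cu * (cv * T′) + V * (cu + cv)) → m * T ≤ c * (m * T′ + 2 * V)
      arith {m} {cu} {cv} T T′ V c hu hv h = *-cancelˡ-≤ (cu * cv) (begin
        cu * cv * (m * T) ≡⟨ e₁ cu cv m T ⟩
        m * (cu * (cv * T)) ≤⟨ *-monoʳ-≤ m h ⟩
        m * (c * (cu * (cv * T′) + V * (cu + cv))) ≡⟨ e₂ m c cu cv T′ V ⟩
        c * (cu * cv * (m * T′) + V * (cu * m + m * cv))
          ≤⟨ *-monoʳ-≤ c (+-monoʳ-≤ (cu * cv * (m * T′)) (*-monoʳ-≤ V (+-mono-≤ (*-monoʳ-≤ cu hv) (*-monoˡ-≤ cv hu)))) ⟩
        c * (cu * cv * (m * T′) + V * (cu * cv + cu * cv)) ≡⟨ e₃ m c (cu * cv) T′ V ⟩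
        cu * cv * (c * (m * T′ + 2 * V)) ∎)
        where
        open ≤-Reasoning
        e₁ : ∀ a b m T → a * b * (m * T) ≡ m * (a * (b * T))
        e₁ = solve-∀
        e₂ : ∀ m c a b T V → m * (c * (a * (b * T) + V * (a + b))) ≡ c * (a * b * (m * T) + V * (a * m + m * b))
        e₂ = solve-∀
        e₃ : ∀ m c p T V → c * (p * (m * T) + V * (p + p)) ≡ p * (c * (m * T + 2 * V))
        e₃ = solve-∀

  imposeAll : ∀ {n} → List (Fin n × Fin n) → Constraints N n → Constraints N n
  imposeAll [] C = C
  imposeAll (p ∷ ps) C = impose (apart adj) p (imposeAll ps C)

  imposeAll-∈ : ∀ {n} ps (C : Constraints N n) i j → (i , j) ∈ ps → imposeAll ps C i j ≡ apart adj
  imposeAll-∈ ((u , v) ∷ ps) C i j h with i F.≟ u | j F.≟ v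
  ... | yes refl | yes refl = impose-hit (apart adj) u v (imposeAll ps C)
  imposeAll-∈ ((u , v) ∷ ps) C i j (here refl) | no ¬p | _ = ⊥-elim (¬p refl)
  imposeAll-∈ ((u , v) ∷ ps) C i j (here refl) | yes _ | no ¬p = ⊥-elim (¬p refl)
  imposeAll-∈ ((u , v) ∷ ps) C i j (there h) | no ¬p | _ =
    trans (impose-miss (apart adj) u v (imposeAll ps C) i j (¬p ∘ proj₁)) (imposeAll-∈ ps C i j h)
  imposeAll-∈ ((u , v) ∷ ps) C i j (there h) | yes _ | no ¬p =
    trans (impose-miss (apart adj) u v (imposeAll ps C) i j (¬p ∘ proj₂)) (imposeAll-∈ ps C i j h)

  imposeAll-∉ : ∀ {n} ps (C : Constraints N n) i j → ¬ ((i , j) ∈ ps) → imposeAll ps C i j ≡ C i j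
  imposeAll-∉ [] C i j h = refl
  imposeAll-∉ ((u , v) ∷ ps) C i j h = trans
    (impose-miss (apart adj) u v (imposeAll ps C) i j λ { (refl , refl) → h (here refl) })
    (imposeAll-∉ ps C i j (h ∘ there))

  -- Works backwards: few solutions with all pairs imposed mean few solutions with none imposed. One
  -- pair turns `K` into 4s (K + 2), at most 12s K because K ≥ 1.
  switch-all : ∀ {n} (X : Fin n → Subset N) m → (∀ i → m ≤ card (X i)) → ∀ C ps →
    (∀ {p} → p ∈ ps → proj₁ p F.< proj₂ p) → ∀ K → 1 ≤ K →
    m * solutions X (imposeAll ps C) ≤ K * volume X →
    m * solutions X C ≤ (12 * s) ^ length ps * K * volume X
  switch-all X m large C [] ord K hK h = ≤-trans h (≤-reflexive (cong (_* volume X) (sym (*-identityˡ K))))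
  switch-all X m large C ((u , v) ∷ ps) ord K hK h = ≤-trans
    (switch-all X m large C ps (ord ∘ there) (12 * s * K)
      (*-mono-≤ (≤-trans (s≤s z≤n) (*-monoʳ-≤ 12 (>-nonZero⁻¹ s))) hK) (begin
        m * solutions X (imposeAll ps C)
          ≤⟨ switch X (imposeAll ps C) u v (ord (here refl)) m (large u) (large v) ⟩
        4 * s * (m * solutions X (imposeAll ((u , v) ∷ ps) C) + 2 * volume X)
          ≤⟨ *-monoʳ-≤ (4 * s) (+-mono-≤ h (*-monoˡ-≤ (volume X) (*-monoʳ-≤ 2 hK))) ⟩
        4 * s * (K * volume X + 2 * K * volume X)
          ≡⟨ collect s K (volume X) ⟩
        12 * s * K * volume X ∎))
    (≤-reflexive (cong (_* volume X) (reorder ((12 * s) ^ length ps) s K)))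
    where
    open ≤-Reasoning
    collect : ∀ s K V → 4 * s * (K * V + 2 * K * V) ≡ 12 * s * K * V
    collect = solve-∀
    reorder : ∀ L s K → L * (12 * s * K) ≡ 12 * s * L * K
    reorder = solve-∀

-- Induced copies of a bipartite pattern between two dense sets

apart-sym : ∀ {n} (adj : Rel n) → (∀ u v → adj u v ≡ adj v u) → ∀ u v → apart adj u v ≡ true → apart adj v u ≡ true
apart-sym adj adj-sym u v h = ∧-intro
  (trans (cong not (adj-sym v u)) (∧ˡ (not (adj u v)) h))
  (cong not (dec-false (v F.≟ u) λ e → true≢false (dec-true (u F.≟ v) (sym e))
    (not-true (∧ʳ (not (adj u v)) h))))

apart⇒nonadj : ∀ {n} (adj : Rel n) u v → apart adj u v ≡ true → adj u v ≡ false
apart⇒nonadj adj u v h = not-true (∧ˡ (not (adj u v)) h)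

apart⇒≢ : ∀ {n} (adj : Rel n) u v → apart adj u v ≡ true → u ≢ v
apart⇒≢ adj u v h e = true≢false (dec-true (u F.≟ v) e) (not-true (∧ʳ (not (adj u v)) h))

↑ˡ<↑ʳ : ∀ {A B} (i : Fin A) (j : Fin B) → (i ↑ˡ B) F.< (A ↑ʳ j)
↑ˡ<↑ʳ {A} {B} i j = subst₂ _<_ (sym (toℕ-↑ˡ i B)) (sym (toℕ-↑ʳ A j)) (<-≤-trans (toℕ<n i) (m≤m+n A _))

-- Nonadjacency is required as `apart`, which includes distinctness; so `f` and `g` are injective
-- without separate fields.
record InducedCopy {N A B} (adj : Rel N) (φ : Fin A → Fin B → Bool) : Set where
  field
    f : Fin A → Fin N
    g : Fin B → Fin N
    f-apart : ∀ i j → i ≢ j → apart adj (f i) (f j) ≡ true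
    g-apart : ∀ i j → i ≢ j → apart adj (g i) (g j) ≡ true
    fg-adj : ∀ i j → φ i j ≡ true → adj (f i) (g j) ≡ true
    fg-apart : ∀ i j → φ i j ≡ false → apart adj (f i) (g j) ≡ true

module Pattern {A B : ℕ} (φ : Fin A → Fin B → Bool) where

  isEdge : Fin (A + B) → Fin (A + B) → Bool
  isEdge i j = Data.Sum.[ (λ i′ → Data.Sum.[ (λ _ → false) , φ i′ ] (splitAt A j)) , (λ _ → false) ] (splitAt A i)

  isMissing? : ∀ p → Dec (proj₁ p F.< proj₂ p × isEdge (proj₁ p) (proj₂ p) ≡ false)
  isMissing? (i , j) = (i F.<? j) ×-dec (isEdge i j B.≟ false)

  missingPairs : List (Fin (A + B) × Fin (A + B))
  missingPairs = filter isMissing? (cartesianProduct (allFin (A + B)) (allFin (A + B)))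

  ∈-missing⁺ : ∀ i j → i F.< j → isEdge i j ≡ false → (i , j) ∈ missingPairs
  ∈-missing⁺ i j h e = ∈-filter⁺ isMissing? (∈-cartesianProduct⁺ (∈-allFin i) (∈-allFin j)) (h , e)

  ∈-missing⁻ : ∀ {p} → p ∈ missingPairs → proj₁ p F.< proj₂ p × isEdge (proj₁ p) (proj₂ p) ≡ false
  ∈-missing⁻ h = proj₂ (∈-filter⁻ isMissing? {xs = cartesianProduct (allFin (A + B)) (allFin (A + B))} h)

  isEdge-ˡʳ : ∀ i j → isEdge (i ↑ˡ B) (A ↑ʳ j) ≡ φ i j
  isEdge-ˡʳ i j rewrite splitAt-↑ˡ A i B | splitAt-↑ʳ A B j = refl

  isEdge-ˡˡ : ∀ i j → isEdge (i ↑ˡ B) (j ↑ˡ B) ≡ false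
  isEdge-ˡˡ i j rewrite splitAt-↑ˡ A i B | splitAt-↑ˡ A j B = refl

  isEdge-ʳ : ∀ i j → isEdge (A ↑ʳ i) j ≡ false
  isEdge-ʳ i j rewrite splitAt-↑ʳ A B i = refl

module _ {N : ℕ} (adj : Rel N) (irr : ∀ u → adj u u ≡ false) (adj-sym : ∀ u v → adj u v ≡ adj v u)
  (s : ℕ) .⦃ s≢0 : NonZero s ⦄ (no-K : ¬ HasKss s adj)
  {a b : ℕ} (φ : Fin (suc a) → Fin (suc b) → Bool) (X Y : Subset N) where

  open Pattern φ
  private
    A B : ℕ
    A = suc a
    B = suc b
    side : Fin (A + B) → Subset N
    side i = Data.Sum.[ (λ _ → X) , (λ _ → Y) ] (splitAt A i)
    side-ˡ : ∀ i v → side (i ↑ˡ B) v ≡ X v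
    side-ˡ i v rewrite splitAt-↑ˡ A i B = refl
    side-ʳ : ∀ j v → side (A ↑ʳ j) v ≡ Y v
    side-ʳ j v rewrite splitAt-↑ʳ A B j = refl
    anyPair : Rel N
    anyPair _ _ = true
    -- The arguments of `adj` are exchanged because `complete-bipartite-count` reads adjacency from
    -- the side of `Y`.
    complete : Constraints N (A + B)
    complete i j = Data.Sum.[ (λ _ → Data.Sum.[ (λ _ → anyPair) , (λ _ u v → adj v u) ] (splitAt A j)) , (λ _ → anyPair) ] (splitAt A i)

  complete-sat : ∀ (x : Vec (Fin N) A) (y : Vec (Fin N) B) → allV (λ v → allV (adj v) x) y ≡ true → Sat complete (x ++ y)
  complete-sat x y h i j _ with splitAt A i in ei | splitAt A j in ej
  ... | inj₂ _ | _ = refl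
  ... | inj₁ _ | inj₁ _ = refl
  ... | inj₁ i′ | inj₂ j′ = trans (cong₂ adj
      (trans (cong (lookup (x ++ y)) (sym (F.splitAt⁻¹-↑ʳ {i = j} ej))) (lookup-++ʳ x y j′))
      (trans (cong (lookup (x ++ y)) (sym (F.splitAt⁻¹-↑ˡ {i = i} ei))) (lookup-++ˡ x y i′)))
    (allV-lookup (adj (lookup y j′)) x (allV-lookup (λ v → allV (adj v) x) y h j′) i′)

  volume-side : volume side ≡ card X ^ A * card Y ^ B
  volume-side = begin
    volume side
      ≡⟨ trans (sym (*-identityʳ _)) (sym (tsum-const side 1)) ⟩
    tsum side (λ _ → 1)
      ≡⟨ tsum-++ A {B} side (λ _ → 1) ⟩
    tsum (side ∘ (λ (i : Fin A) → i ↑ˡ B)) (λ x → tsum (side ∘ (λ (j : Fin B) → A ↑ʳ j)) (λ y → 1))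
      ≡⟨ tsum-cong (side ∘ (λ (i : Fin A) → i ↑ˡ B)) (λ x → tsum-cong-sets {n = B} {Y = λ _ → Y} (λ y → 1)
           side-ʳ) ⟩
    tsum (side ∘ (λ (i : Fin A) → i ↑ˡ B)) (λ x → tsum {n = B} (λ _ → Y) (λ y → 1))
      ≡⟨ tsum-cong-sets {n = A} {Y = λ _ → X} (λ x → tsum {n = B} (λ _ → Y) (λ y → 1))
           side-ˡ ⟩
    tsum {n = A} (λ _ → X) (λ x → tsum {n = B} (λ _ → Y) (λ y → 1))
      ≡⟨ trans (tsum-const {n = A} (λ _ → X) _) (cong₂ _*_ (volume-const A X)
           (trans (tsum-const {n = B} (λ _ → Y) 1) (trans (*-identityʳ _) (volume-const B Y)))) ⟩
    card X ^ A * card Y ^ B ∎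
    where open ≡-Reasoning

  complete-count : ∀ t → card X * card Y ≤ t * edges adj Y X →
    volume side ≤ (2 * (2 * t) ^ A) ^ B * solutions side complete
  complete-count t hyp = begin
    volume side
      ≡⟨ volume-side ⟩
    card X ^ A * card Y ^ B
      ≤⟨ complete-bipartite-count adj X Y t a b hyp ⟩
    (2 * (2 * t) ^ A) ^ B * tsum {n = A} (λ _ → X) (λ x → tsum {n = B} (λ _ → Y) (λ y → ⟦ allV (λ v → allV (adj v) x) y ⟧))
      ≤⟨ *-monoʳ-≤ ((2 * (2 * t) ^ A) ^ B) (tsum-mono {n = A} (λ _ → X) λ x → tsum-mono {n = B} (λ _ → Y) λ y →
           ⟦⟧-mono {allV (λ v → allV (adj v) x) y} {sat complete (x ++ y)} λ h →
             dec-true (sat? complete (x ++ y)) (complete-sat x y h)) ⟩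
    (2 * (2 * t) ^ A) ^ B * tsum {n = A} (λ _ → X) (λ x → tsum {n = B} (λ _ → Y) (λ y → F (x ++ y)))
      ≡⟨ cong ((2 * (2 * t) ^ A) ^ B *_) (tsum-cong {n = A} (λ _ → X) λ x → tsum-cong-sets {n = B} {X = side ∘ (λ (j : Fin B) → A ↑ʳ j)} (λ y → F (x ++ y))
           side-ʳ) ⟨
    (2 * (2 * t) ^ A) ^ B * tsum {n = A} (λ _ → X) (λ x → tsum (side ∘ (λ (j : Fin B) → A ↑ʳ j)) (λ y → F (x ++ y)))
      ≡⟨ cong ((2 * (2 * t) ^ A) ^ B *_) (tsum-cong-sets {n = A} {X = side ∘ (λ (i : Fin A) → i ↑ˡ B)} (λ x → tsum (side ∘ (λ (j : Fin B) → A ↑ʳ j)) (λ y → F (x ++ y)))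
           side-ˡ) ⟨
    (2 * (2 * t) ^ A) ^ B * tsum (side ∘ (λ (i : Fin A) → i ↑ˡ B)) (λ x → tsum (side ∘ (λ (j : Fin B) → A ↑ʳ j)) (λ y → F (x ++ y)))
      ≡⟨ cong ((2 * (2 * t) ^ A) ^ B *_) (tsum-++ A {B} side F) ⟨
    (2 * (2 * t) ^ A) ^ B * solutions side complete ∎
    where
    open ≤-Reasoning
    F : Vec (Fin N) (A + B) → ℕ
    F x = ⟦ sat complete x ⟧

  private
    target : Constraints N (A + B)
    target = imposeAll adj irr s no-K missingPairs complete

  copy : ∀ x → Sat target x → InducedCopy adj φ
  copy x h = record
    { f = f ; g = g
    ; f-apart = λ i j i≢j → separate (i ↑ˡ B) (j ↑ˡ B) (i≢j ∘ F.↑ˡ-injective B i j) (isEdge-ˡˡ i j) (isEdge-ˡˡ j i)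
    ; g-apart = λ i j i≢j → separate (A ↑ʳ i) (A ↑ʳ j) (i≢j ∘ F.↑ʳ-injective A i j) (isEdge-ʳ i (A ↑ʳ j)) (isEdge-ʳ j (A ↑ʳ i))
    ; fg-adj = λ i j e → trans (adj-sym (f i) (g j)) (trans (sym (cong (λ c → c (f i) (g j)) (is-adj i j e))) (h _ _ (↑ˡ<↑ʳ i j)))
    ; fg-apart = λ i j e → missing (i ↑ˡ B) (A ↑ʳ j) (↑ˡ<↑ʳ i j) (trans (isEdge-ˡʳ i j) e)
    }
    where
    f : Fin A → Fin N
    f i = lookup x (i ↑ˡ B)
    g : Fin B → Fin N
    g j = lookup x (A ↑ʳ j)
    missing : ∀ i j → i F.< j → isEdge i j ≡ false → apart adj (lookup x i) (lookup x j) ≡ true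
    missing i j i<j e = trans (cong (λ c → c (lookup x i) (lookup x j))
      (sym (imposeAll-∈ adj irr s no-K missingPairs complete i j (∈-missing⁺ i j i<j e)))) (h i j i<j)
    separate : ∀ i j → i ≢ j → isEdge i j ≡ false → isEdge j i ≡ false → apart adj (lookup x i) (lookup x j) ≡ true
    separate i j i≢j e e′ with F.<-cmp i j
    ... | tri< i<j _ _ = missing i j i<j e
    ... | tri≈ _ i≡j _ = ⊥-elim (i≢j i≡j)
    ... | tri> _ _ j<i = apart-sym adj adj-sym (lookup x j) (lookup x i) (missing j i j<i e′)
    complete-ˡʳ : ∀ i j → complete (i ↑ˡ B) (A ↑ʳ j) ≡ (λ u v → adj v u)
    complete-ˡʳ i j rewrite splitAt-↑ˡ A i B | splitAt-↑ʳ A B j = refl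
    is-adj : ∀ i j → φ i j ≡ true → target (i ↑ˡ B) (A ↑ʳ j) ≡ (λ u v → adj v u)
    is-adj i j e = trans (imposeAll-∉ adj irr s no-K missingPairs complete (i ↑ˡ B) (A ↑ʳ j)
      (λ k → true≢false (trans (isEdge-ˡʳ i j) e) (proj₂ (∈-missing⁻ k)))) (complete-ˡʳ i j)

  -- If no tuple satisfied `target`, `complete-count` with loss `c` and `switch-all` with loss `L`
  -- would together give m ≤ c · L.
  induced-copy : ∀ t m → m ≤ card X → m ≤ card Y → card X * card Y ≤ t * edges adj Y X →
    (2 * (2 * t) ^ A) ^ B * (12 * s) ^ length missingPairs < m → InducedCopy adj φ
  induced-copy t m hX hY dense large = by-cases (solutions side target ≟ 0)
    where
    c : ℕ
    c = (2 * (2 * t) ^ A) ^ B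
    L : ℕ
    L = (12 * s) ^ length missingPairs
    large-side : ∀ i → m ≤ card (side i)
    large-side i with splitAt A i
    ... | inj₁ _ = hX
    ... | inj₂ _ = hY
    volume>0 : 0 < volume side
    volume>0 = subst (0 <_) (sym volume-side) (*-mono-≤ (m^n>0 (card X) ⦃ >-nonZero (<-≤-trans (≤-<-trans z≤n large) hX) ⦄ A)
      (m^n>0 (card Y) ⦃ >-nonZero (<-≤-trans (≤-<-trans z≤n large) hY) ⦄ B))
    by-cases : Dec (solutions side target ≡ 0) → InducedCopy adj φ
    by-cases (no pos) = extract (tsum>0⇒∃ side (n≢0⇒n>0 pos))
      where
      extract : (∃ λ x → 0 < ⟦ sat target x ⟧) → InducedCopy adj φ
      extract (x , p) = copy x (dec-proof (sat? target x) (⟦⟧>0 p))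
    by-cases (yes z) = ⊥-elim (<⇒≱ large (*-cancelʳ-≤ m (c * L) (volume side) ⦃ >-nonZero volume>0 ⦄ (begin
      m * volume side ≤⟨ *-monoʳ-≤ m (complete-count t dense) ⟩
      m * (c * solutions side complete) ≡⟨ x∙yz≈y∙xz m c _ ⟩
      c * (m * solutions side complete)
        ≤⟨ *-monoʳ-≤ c (switch-all adj irr s no-K side m large-side complete missingPairs (proj₁ ∘ ∈-missing⁻) 1 ≤-refl
             (≤-trans (≤-reflexive (trans (cong (m *_) z) (*-zeroʳ m))) z≤n)) ⟩
      c * (L * 1 * volume side) ≡⟨ trans (sym (*-assoc c _ _)) (cong (λ x → c * x * volume side) (*-identityʳ L)) ⟩
      c * L * volume side ∎)))
      where open ≤-Reasoning

-- Edge counts, degeneracy and sparse neighbourhoods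

edges≤product : ∀ {n} (r : Rel n) (X Y : Subset n) → edges r X Y ≤ card X * card Y
edges≤product {n} r X Y = ≤-trans (sum-mono n λ u → *-monoʳ-≤ ⟦ X u ⟧ (card-∩ˡ Y (r u)))
  (≤-reflexive (sum-*ʳ n (card Y) _))

edges-sym : ∀ {n} (r : Rel n) → (∀ u v → r u v ≡ r v u) → (X Y : Subset n) → edges r X Y ≡ edges r Y X
edges-sym {n} r r-sym X Y = trans (edges-as-sum r X Y) (trans (sum-swap n n _)
  (trans (sum-cong n λ v → sum-cong n λ u → swap u v) (sym (edges-as-sum r Y X))))
  where
  swap : ∀ u v → ⟦ X u ⟧ * ⟦ Y v ∧ r u v ⟧ ≡ ⟦ Y v ⟧ * ⟦ X u ∧ r v u ⟧
  swap u v rewrite r-sym u v | ⟦∧⟧ (Y v) (r v u) | ⟦∧⟧ (X u) (r v u) = x∙yz≈y∙xz ⟦ X u ⟧ ⟦ Y v ⟧ _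

edges≤ : ∀ {n} (r : Rel n) (X Y : Subset n) d → (∀ u → X u ≡ true → card (Y ∩ r u) ≤ d) → edges r X Y ≤ card X * d
edges≤ {n} r X Y d h = ≤-trans (sum-mono n λ u → ⟦⟧*-≤ (X u) (h u)) (≤-reflexive (sum-*ʳ n d _))

low-degree : ∀ {n} (r : Rel n) (X Y : Subset n) t d → t * edges r X Y < card X * d →
  ∃ λ v → X v ≡ true × t * card (Y ∩ r v) < d
low-degree {n} r X Y t d h with sum<⇒∃ n {λ v → ⟦ X v ⟧ * (t * card (Y ∩ r v))} {λ v → ⟦ X v ⟧ * d}
  (subst₂ _<_ (trans (sym (sum-*ˡ n t _)) (sum-cong n λ v → x∙yz≈y∙xz t ⟦ X v ⟧ _)) (sym (sum-*ʳ n d _)) h)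
... | v , l = v , extract (X v) l
  where
  extract : ∀ b {x y} → ⟦ b ⟧ * x < ⟦ b ⟧ * y → b ≡ true × x < y
  extract true l = refl , *-cancelˡ-< 1 _ _ l

remove : ∀ {n} → Fin n → Subset n → Subset n
remove v U = U ∩ (not ∘ single v)

card-remove : ∀ {n} (U : Subset n) v → U v ≡ true → card U ≡ 1 + card (remove v U)
card-remove {n} U v h = trans (card-split U (single v)) (cong (_+ card (remove v U))
  (trans (sum-cong n λ w → pointwise w) (card-single v)))
  where
  pointwise : ∀ w → ⟦ U w ∧ single v w ⟧ ≡ ⟦ single v w ⟧
  pointwise w with v F.≟ w
  ... | yes refl = cong (λ b → ⟦ b ∧ true ⟧) h
  ... | no _ = cong ⟦_⟧ (B.∧-zeroʳ (U w))

Orientation : ∀ {n} → Rel n → ℕ → Subset n → Set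
Orientation {n} adj d U = Σ (Rel n) λ o →
  (∀ u v → U u ≡ true → U v ≡ true → adj u v ≡ true → o u v ≡ true ⊎ o v u ≡ true) ×
  (∀ u v → o u v ≡ true → adj u v ≡ true) × (∀ u → card (o u) ≤ d)

-- Degeneracy: `edges` counts ordered pairs, so some vertex of `U` has at most `d` neighbours in
-- `U`. It is directed to all of them and removed.
orientation : ∀ {n} (adj : Rel n) → (∀ u v → adj u v ≡ adj v u) → ∀ d →
  (∀ U → edges adj U U ≤ d * card U) → ∀ c U → card U ≡ c → Orientation adj d U
orientation {n} adj adj-sym d sparse zero U e = (λ _ _ → false) ,
  (λ u v hu _ _ → ⊥-elim (<⇒≱ (∈⇒card>0 {U = U} hu) (≤-reflexive e))) ,
  (λ _ _ ()) , (λ _ → ≤-trans (≤-reflexive (sum-zero n)) z≤n)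
orientation {n} adj adj-sym d sparse (suc c) U e = extend
  (low-degree adj U U 1 (suc d) (≤-<-trans (≤-trans (≤-reflexive (*-identityˡ _)) (sparse U))
    (≤-<-trans (≤-reflexive (*-comm d (card U))) (*-monoʳ-< (card U) ⦃ >-nonZero (subst (0 <_) (sym e) (s≤s z≤n)) ⦄ (n<1+n d)))))
  where
  extend : (∃ λ v → U v ≡ true × 1 * card (U ∩ adj v) < suc d) → Orientation adj d U
  extend (v , hv , deg) with orientation adj adj-sym d sparse c (remove v U)
    (suc-injective (trans (sym (card-remove U v hv)) e))
  ... | o , cover , o⊑adj , out = o′ , cover′ , o′⊑adj , out′
    where
    o′ : Rel n
    o′ u w = if single v u then (U w ∧ adj u w) else o u w
    cover′ : ∀ u w → U u ≡ true → U w ≡ true → adj u w ≡ true → o′ u w ≡ true ⊎ o′ w u ≡ true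
    cover′ u w hu hw a with v F.≟ u | v F.≟ w
    ... | yes refl | _ = inj₁ (∧-intro hw a)
    ... | no _ | yes refl = inj₂ (∧-intro hu (trans (adj-sym v u) a))
    ... | no v≢u | no v≢w = cover u w (∧-intro hu (cong not (dec-false (v F.≟ u) v≢u)))
      (∧-intro hw (cong not (dec-false (v F.≟ w) v≢w))) a
    o′⊑adj : ∀ u w → o′ u w ≡ true → adj u w ≡ true
    o′⊑adj u w h with v F.≟ u
    ... | yes refl = ∧ʳ (U w) h
    ... | no _ = o⊑adj u w h
    out′ : ∀ u → card (o′ u) ≤ d
    out′ u with v F.≟ u
    ... | yes refl = ≤-pred (subst (_< suc d) (*-identityˡ (card (U ∩ adj v))) deg)
    ... | no _ = out u

module Sparse {N : ℕ} (adj : Rel N) (t m : ℕ)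
  (sparse : ∀ X Y → m ≤ card X → m ≤ card Y → t * edges adj Y X < card X * card Y) where

  -- Extends the density bound to sets of any size. If one set has fewer than `m` elements, the
  -- trivial count is at most `m` times the bound on the other, and m t ≤ M₁ or m t ≤ M₂ absorbs the
  -- factor `t`.
  sparse-≤ : ∀ X Y M₁ M₂ → card X ≤ M₁ → card Y ≤ M₂ → m * t ≤ M₁ → m * t ≤ M₂ → t * edges adj Y X ≤ M₁ * M₂
  sparse-≤ X Y M₁ M₂ hX hY h₁ h₂ = by-cases (m ≤? card X) (m ≤? card Y)
    where
    by-cases : Dec (m ≤ card X) → Dec (m ≤ card Y) → t * edges adj Y X ≤ M₁ * M₂
    by-cases (yes p) (yes q) = ≤-trans (<⇒≤ (sparse X Y p q)) (*-mono-≤ hX hY)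
    by-cases (no p) _ = begin
      t * edges adj Y X ≤⟨ *-monoʳ-≤ t (edges≤product adj Y X) ⟩
      t * (card Y * card X) ≤⟨ *-monoʳ-≤ t (*-mono-≤ hY (<⇒≤ (≰⇒> p))) ⟩
      t * (M₂ * m) ≡⟨ rot t M₂ m ⟩
      m * t * M₂ ≤⟨ *-monoˡ-≤ M₂ h₁ ⟩
      M₁ * M₂ ∎
      where
      open ≤-Reasoning
      rot : ∀ a b c → a * (b * c) ≡ c * a * b
      rot = solve-∀
    by-cases (yes _) (no q) = begin
      t * edges adj Y X ≤⟨ *-monoʳ-≤ t (edges≤product adj Y X) ⟩
      t * (card Y * card X) ≤⟨ *-monoʳ-≤ t (*-mono-≤ (<⇒≤ (≰⇒> q)) hX) ⟩
      t * (m * M₁) ≡⟨ rot t m M₁ ⟩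
      M₁ * (m * t) ≤⟨ *-monoʳ-≤ M₁ h₂ ⟩
      M₁ * M₂ ∎
      where
      open ≤-Reasoning
      rot : ∀ a b c → a * (b * c) ≡ c * (b * a)
      rot = solve-∀

  -- Greedy choice. While at least `m` vertices remain, one of them has fewer than M/t ≤ `u`
  -- neighbours among them, so taking it and discarding those costs at most `u` vertices.
  independent-subset : (∀ u v → adj u v ≡ adj v u) → (∀ u → adj u u ≡ false) → 0 < m →
    ∀ j X M u → card X ≤ M → M ≤ t * u → m + j * u ≤ card X →
    Σ (Subset N) λ S → S ⊑ X × card S ≡ j × (∀ g h → S g ≡ true → S h ≡ true → adj g h ≡ false)
  independent-subset adj-sym irr m>0 zero X M u hX hM large = (λ _ → false) , (λ _ ()) , sum-zero N , (λ _ _ ())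
  independent-subset adj-sym irr m>0 (suc j) X M u hX hM large = extend
    (low-degree adj X X t (card X) (sparse X X m≤X m≤X))
    where
    m≤X : m ≤ card X
    m≤X = ≤-trans (m≤m+n m _) large
    extend : (∃ λ v → X v ≡ true × t * card (X ∩ adj v) < card X) → _
    extend (v , hv , deg) = conclude (independent-subset adj-sym irr m>0 j X′ M u
        (≤-trans (card-mono {U = X′} {X} (λ w e → ∧ˡ (X w) (∧ˡ (remove v X w) e))) hX) hM large′)
      where
      X′ : Subset N
      X′ = remove v X ∩ (not ∘ adj v)
      deg<u : card (X ∩ adj v) < u
      deg<u = *-cancelˡ-< t _ _ (<-≤-trans deg (≤-trans hX hM))
      split : card X ≤ u + card X′
      split = begin
        card X ≡⟨ card-remove X v hv ⟩
        1 + card (remove v X) ≡⟨ cong suc (card-split (remove v X) (adj v)) ⟩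
        1 + (card (remove v X ∩ adj v) + card X′) ≤⟨ +-monoˡ-≤ (card X′) (s≤s (card-mono {U = remove v X ∩ adj v} {X ∩ adj v}
          λ w e → ∧-intro (∧ˡ (X w) (∧ˡ (remove v X w) e)) (∧ʳ (remove v X w) e))) ⟩
        1 + card (X ∩ adj v) + card X′ ≤⟨ +-monoˡ-≤ (card X′) deg<u ⟩
        u + card X′ ∎
        where open ≤-Reasoning
      large′ : m + j * u ≤ card X′
      large′ = +-cancelˡ-≤ u _ _ (≤-trans (≤-reflexive (shift u m (j * u))) (≤-trans large split))
        where
        shift : ∀ u m x → u + (m + x) ≡ m + (u + x)
        shift = solve-∀
      conclude : (Σ (Subset N) λ S → S ⊑ X′ × card S ≡ j × (∀ g h → S g ≡ true → S h ≡ true → adj g h ≡ false)) → _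
      conclude (S , S⊑ , size , indep) = S ∪ single v , inside , trans (card-∪ {U = S} {single v} disjoint)
          (trans (cong₂ _+_ size (card-single v)) (+-comm j 1)) , indep′
        where
        disjoint : ∀ w → S w ≡ true → single v w ≡ true → ⊥
        disjoint w hw e = true≢false e (not-true (∧ʳ (X w) (∧ˡ (remove v X w) (S⊑ w hw))))
        inside : (S ∪ single v) ⊑ X
        inside w e with S w in eq
        ... | true = ∧ˡ (X w) (∧ˡ (remove v X w) (S⊑ w eq))
        ... | false = subst (λ x → X x ≡ true) (dec-proof (v F.≟ w) e) hv
        nonadj : ∀ w → S w ≡ true → adj v w ≡ false
        nonadj w hw = not-true (∧ʳ (remove v X w) (S⊑ w hw))
        indep′ : ∀ g h → (S ∪ single v) g ≡ true → (S ∪ single v) h ≡ true → adj g h ≡ false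
        indep′ g h eg eh with S g in hg | S h in hh
        ... | true | true = indep g h hg hh
        ... | true | false = trans (adj-sym g h) (subst (λ x → adj x g ≡ false) (dec-proof (v F.≟ h) eh) (nonadj g hg))
        ... | false | true = subst (λ x → adj x h ≡ false) (dec-proof (v F.≟ g) eg) (nonadj h hh)
        ... | false | false = trans (cong₂ adj (sym (dec-proof (v F.≟ g) eg)) (sym (dec-proof (v F.≟ h) eh))) (irr v)

-- Scales

-- The ratio |I| / |H| grows by the factor l at each step, at the price of R neighbours per vertex of I.
module Scales {N : ℕ} (adj : Rel N) (adj-sym : ∀ u v → adj u v ≡ adj v u) (D l R : ℕ) .⦃ _ : NonZero D ⦄ .⦃ _ : NonZero l ⦄ where

  Bounded : Subset N → Set
  Bounded I = ∀ i → I i ≡ true → card (adj i) ≤ 4 * D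

  -- `L` is the size of `H` before its vertices of high degree were taken out. The degree bound
  -- refers to that size, while what is left of `H` may be much smaller.
  SingleScale : Set
  SingleScale = Σ (Subset N) λ I → Σ (Subset N) λ H → Σ ℕ λ L → Bounded I × 0 < card I × card H ≤ L × L ≤ 4 * card I ×
    (∀ i → I i ≡ true → R ≤ card (H ∩ adj i)) × (∀ h → H h ≡ true → L * card (I ∩ adj h) ≤ 16 * D * l * card I)

  Unbalanced : ℕ → ℕ → Set
  Unbalanced w d = Σ (Subset N) λ I → Σ (Subset N) λ H → Bounded I × 0 < card I × w * card H ≤ 2 * card I ×
    (∀ i → I i ≡ true → d ≤ card (H ∩ adj i))

  module Step (I H : Subset N) (bounded : Bounded I) (I>0 : 0 < card I) where
    isLow : Subset N
    isLow h = does (card H * card (I ∩ adj h) ≤? 8 * D * l * card I)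
    Low High : Subset N
    Low = H ∩ isLow
    High = H ∩ (not ∘ isLow)

    -- Markov's inequality, as at most 4D |I| edges join `I` to `H`. The factor 2 pays for the
    -- halving of `I` in `descend`.
    few-high : 2 * l * card High ≤ card H
    few-high = *-cancelˡ-≤ (4 * D * card I) ⦃ m*n≢0 (4 * D) (card I) ⦃ m*n≢0 4 D ⦄ ⦃ >-nonZero I>0 ⦄ ⦄ (begin
      4 * D * card I * (2 * l * card High) ≡⟨ e₁ D (card I) l (card High) ⟩
      card High * (8 * D * l * card I) ≡⟨ sum-*ʳ N (8 * D * l * card I) _ ⟨
      ∑[ h < N ] (⟦ High h ⟧ * (8 * D * l * card I))
        ≤⟨ sum-mono N (λ h → ⟦⟧*-≤ (High h) λ e → <⇒≤ (≰⇒> (dec-disproof (card H * card (I ∩ adj h) ≤? 8 * D * l * card I)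
             (not-true (∧ʳ (H h) e))))) ⟩
      ∑[ h < N ] (⟦ High h ⟧ * (card H * card (I ∩ adj h)))
        ≡⟨ trans (sum-cong N λ h → x∙yz≈y∙xz ⟦ High h ⟧ (card H) _) (sum-*ˡ N (card H) _) ⟩
      card H * edges adj High I ≡⟨ cong (card H *_) (edges-sym adj adj-sym High I) ⟩
      card H * edges adj I High ≤⟨ *-monoʳ-≤ (card H) (edges≤ adj I High (4 * D) λ i e →
        ≤-trans (card-∩ʳ High (adj i)) (bounded i e)) ⟩
      card H * (card I * (4 * D)) ≡⟨ e₂ (card H) (card I) (4 * D) ⟩
      4 * D * card I * card H ∎)
      where
      open ≤-Reasoning
      e₁ : ∀ D i l h → 4 * D * i * (2 * l * h) ≡ h * (8 * D * l * i)
      e₁ = solve-∀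
      e₂ : ∀ h i d → h * (i * d) ≡ d * i * h
      e₂ = solve-∀

    toLow : Subset N
    toLow i = does (R ≤? card (Low ∩ adj i))
    Ia Ib : Subset N
    Ia = I ∩ toLow
    Ib = I ∩ (not ∘ toLow)

    half : card I ≤ 2 * card Ia ⊎ card I ≤ 2 * card Ib
    half with ≤-total (card Ib) (card Ia)
    ... | inj₁ h = inj₁ (≤-trans (≤-reflexive (card-split I toLow)) (≤-trans (+-monoʳ-≤ (card Ia) h) (≤-reflexive (cong (card Ia +_) (sym (+-identityʳ _))))))
    ... | inj₂ h = inj₂ (≤-trans (≤-reflexive (card-split I toLow)) (≤-trans (+-monoˡ-≤ (card Ib) h) (≤-reflexive (cong (card Ib +_) (sym (+-identityʳ _))))))

    positive-half : ∀ {x} → card I ≤ 2 * x → 0 < x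
    positive-half {zero} h = ⊥-elim (<⇒≱ I>0 h)
    positive-half {suc x} h = s≤s z≤n

    single-scale : card H ≤ 2 * card I → card I ≤ 2 * card Ia → SingleScale
    single-scale hH h = Ia , Low , card H , (λ i e → bounded i (∧ˡ (I i) e)) , positive-half h ,
      card-mono {U = Low} {H} (λ v → ∧ˡ (H v)) ,
      ≤-trans hH (≤-trans (*-monoʳ-≤ 2 h) (≤-reflexive (sym (*-assoc 2 2 (card Ia))))) ,
      (λ i e → dec-proof (R ≤? card (Low ∩ adj i)) (∧ʳ (I i) e)) , (λ v e → begin
        card H * card (Ia ∩ adj v) ≤⟨ *-monoʳ-≤ (card H) (card-mono {U = Ia ∩ adj v} {I ∩ adj v} λ w k →
          ∧-intro (∧ˡ (I w) (∧ˡ (Ia w) k)) (∧ʳ (Ia w) k)) ⟩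
        card H * card (I ∩ adj v) ≤⟨ dec-proof (card H * card (I ∩ adj v) ≤? 8 * D * l * card I) (∧ʳ (H v) e) ⟩
        8 * D * l * card I ≤⟨ *-monoʳ-≤ (8 * D * l) h ⟩
        8 * D * l * (2 * card Ia) ≡⟨ double D l (card Ia) ⟩
        16 * D * l * card Ia ∎)
      where
      open ≤-Reasoning
      double : ∀ D l i → 8 * D * l * (2 * i) ≡ 16 * D * l * i
      double = solve-∀

    high-degree : ∀ i → Ib i ≡ true → ∀ x → x + R ≤ card (H ∩ adj i) → x ≤ card (High ∩ adj i)
    high-degree i e x h = +-cancelʳ-≤ R _ _ (≤-trans h (begin
      card (H ∩ adj i)
        ≡⟨ card-split (H ∩ adj i) isLow ⟩
      card ((H ∩ adj i) ∩ isLow) + card ((H ∩ adj i) ∩ (not ∘ isLow))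
        ≤⟨ +-mono-≤ (card-mono {U = (H ∩ adj i) ∩ isLow} {Low ∩ adj i} (reorder isLow))
             (card-mono {U = (H ∩ adj i) ∩ (not ∘ isLow)} {High ∩ adj i} (reorder (not ∘ isLow))) ⟩
      card (Low ∩ adj i) + card (High ∩ adj i)
        ≤⟨ +-monoˡ-≤ _ (<⇒≤ (≰⇒> (dec-disproof (R ≤? card (Low ∩ adj i)) (not-true (∧ʳ (I i) e))))) ⟩
      R + card (High ∩ adj i)
        ≡⟨ +-comm R _ ⟩
      card (High ∩ adj i) + R ∎))
      where
      open ≤-Reasoning
      reorder : ∀ P → ((H ∩ adj i) ∩ P) ⊑ ((H ∩ P) ∩ adj i)
      reorder P v k = ∧-intro (∧-intro (∧ˡ (H v) (∧ˡ ((H ∩ adj i) v) k)) (∧ʳ ((H ∩ adj i) v) k)) (∧ʳ (H v) (∧ˡ ((H ∩ adj i) v) k))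

  scales : ∀ J I H w d → Bounded I → 0 < card I → 1 ≤ w → w * card H ≤ 2 * card I →
    (∀ i → I i ≡ true → d + J * R ≤ card (H ∩ adj i)) → SingleScale ⊎ Unbalanced (w * l ^ J) d
  scales zero I H w d bounded I>0 w≥1 ratio deg = inj₂ (I , H , bounded , I>0 ,
    subst (λ x → x * card H ≤ 2 * card I) (sym (*-identityʳ w)) ratio ,
    λ i e → subst (_≤ card (H ∩ adj i)) (+-identityʳ d) (deg i e))
  scales (suc J) I H w d bounded I>0 w≥1 ratio deg = Data.Sum.[ (λ h → inj₁ (single-scale
      (≤-trans (≤-trans (≤-reflexive (sym (*-identityˡ (card H)))) (*-monoˡ-≤ (card H) w≥1)) ratio) h)) , descend ] half
    where
    open Step I H bounded I>0
    shift : ∀ d x R → d + x + R ≡ d + (R + x)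
    shift = solve-∀
    double : ∀ w l h → 2 * (w * l * h) ≡ w * (2 * l * h)
    double = solve-∀
    descend : card I ≤ 2 * card Ib → SingleScale ⊎ Unbalanced (w * l ^ suc J) d
    descend h = subst (λ x → SingleScale ⊎ Unbalanced x d) (*-assoc w l (l ^ J))
      (scales J Ib High (w * l) d (λ i e → bounded i (∧ˡ (I i) e)) (positive-half h)
        (*-mono-≤ w≥1 (>-nonZero⁻¹ l)) (*-cancelˡ-≤ 2 (begin
          2 * (w * l * card High) ≡⟨ double w l (card High) ⟩
          w * (2 * l * card High) ≤⟨ *-monoʳ-≤ w few-high ⟩
          w * card H ≤⟨ ratio ⟩
          2 * card I ≤⟨ *-monoʳ-≤ 2 h ⟩
          2 * (2 * card Ib) ∎))
        λ i e → high-degree i e (d + J * R) (≤-trans (≤-reflexive (shift d (J * R) R)) (deg i (∧ˡ (I i) e))))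
      where open ≤-Reasoning

-- The unbalanced case

choice : ∀ {n} (I : Subset n) {P : Fin n → Subset n → Set} →
  (∀ i → I i ≡ true → Σ (Subset n) (P i)) → Σ (Fin n → Subset n) λ S → ∀ i → I i ≡ true → P i (S i)
choice {n} I {P} f = (λ i → pick i (I i) refl) , (λ i → spec i (I i) refl)
  where
  pick : ∀ i b → I i ≡ b → Subset n
  pick i true e = proj₁ (f i e)
  pick i false e = λ _ → false
  spec : ∀ i b (e : I i ≡ b) → b ≡ true → P i (pick i b e)
  spec i true e _ = proj₂ (f i e)

Independent : ∀ {n} → Rel n → Subset n → Set
Independent adj U = ∀ u v → U u ≡ true → U v ≡ true → adj u v ≡ false

no-edges : ∀ {n} (r : Rel n) (U : Subset n) → Independent r U → edges r U U ≡ 0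
no-edges {n} r U h = n≤0⇒n≡0 (≤-trans (edges≤ r U U 0 λ u hu → ≮⇒≥ λ pos → contradict u hu (card>0⇒∃ {U = U ∩ r u} pos))
  (≤-reflexive (*-zeroʳ (card U))))
  where
  contradict : ∀ u → U u ≡ true → (∃ λ v → (U ∩ r u) v ≡ true) → ⊥
  contradict u hu (v , e) = true≢false (∧ʳ (U v) e) (h u v hu (∧ˡ (U v) e))

-- At rate 1/(2d) the sample has |I|/(2d) vertices in expectation but at most |I|/(4d) ordered
-- adjacent pairs, so |I|/(4d) vertices are left after deletion.
independent-part : ∀ {n} (adj : Rel n) → (∀ u → adj u u ≡ false) → (I : Subset n) → ∀ d h .⦃ _ : NonZero d ⦄ →
  (∀ i → I i ≡ true → card (adj i) ≤ d) → 4 * d * h < card I →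
  Σ (Subset n) λ I₁ → I₁ ⊑ I × Independent adj I₁ × h < card I₁
independent-part adj irr I d@(suc _) h bounded large = conclude (deletion (pred (2 * d)) I adj adj irr irr 1 0 h (subst (λ Q →
    1 * edges adj I I + 0 * edges adj I I + Q ^ 2 * h < 1 * (Q * card I)) (sym (suc-pred (2 * d))) (begin-strict
      1 * edges adj I I + 0 * edges adj I I + (2 * d) ^ 2 * h ≡⟨ e₁ (edges adj I I) d h ⟩
      edges adj I I + d * (4 * d * h) <⟨ +-mono-≤-< (edges≤ adj I I d λ i e →
        ≤-trans (card-∩ʳ I (adj i)) (bounded i e)) (*-monoʳ-< d large) ⟩
      card I * d + d * card I ≡⟨ e₂ (card I) d ⟩
      1 * (2 * d * card I) ∎)))
  where
  open ≤-Reasoning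
  e₁ : ∀ E d h → 1 * E + 0 * E + (2 * d) * ((2 * d) * 1) * h ≡ E + d * (4 * d * h)
  e₁ = solve-∀
  e₂ : ∀ c d → c * d + d * c ≡ 1 * (2 * d * c)
  e₂ = solve-∀
  conclude : (Σ (Subset _) λ B → B ⊑ I × (∀ u v → B u ≡ true → B v ≡ true → adj u v ≡ false) ×
    0 * edges adj B B + h < 1 * card B) → _
  conclude (B , B⊑I , free , bound) = B , B⊑I , free , <-≤-trans bound (≤-reflexive (*-identityˡ (card B)))

module _ {N : ℕ} (adj : Rel N) (irr : ∀ u → adj u u ≡ false) (adj-sym : ∀ u v → adj u v ≡ adj v u)
  (D : ℕ) .⦃ _ : NonZero D ⦄
  (o : Rel N) (orient : ∀ u v → adj u v ≡ true → o u v ≡ true ⊎ o v u ≡ true)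
  (o⊑adj : ∀ u v → o u v ≡ true → adj u v ≡ true) (o-out : ∀ u → card (o u) ≤ 2 * D)
  (t m : ℕ) (m>0 : 0 < m) (sparse : ∀ X Y → m ≤ card X → m ≤ card Y → t * edges adj Y X < card X * card Y)
  (k : ℕ) .⦃ _ : NonZero k ⦄
  (no-bipartite : ∀ B H → Independent adj B → Independent adj H →
    (∀ i → B i ≡ true → k ≤ card (H ∩ adj i)) → card B ≤ card H) where

  -- With p = Q^k, where Q = 1 + q, the bound on `w` collects a loss 16 D for passing to an
  -- independent part of `I`, 2p for the survival of a star, and 2 from the form of the ratio.
  -- Beyond that, surviving centres outnumber all of `H`.
  unbalanced-case : ∀ q u d w (I H : Subset N) → (∀ i → I i ≡ true → card (adj i) ≤ 4 * D) → 0 < card I →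
    w * card H ≤ 2 * card I → (∀ i → I i ≡ true → d ≤ card (H ∩ adj i)) →
    4 * D ≤ t * u → m + k * u ≤ d → 4 * D * k ≤ suc q → 64 * D * suc q ^ k < w → ⊥
  unbalanced-case q u d w I H bounded I>0 ratio deg hu hd hQ hw =
    finish (choice I {λ i S → S ⊑ (H ∩ adj i) × card S ≡ k × Independent adj S} λ i e →
      Sparse.independent-subset adj t m sparse adj-sym irr m>0 k (H ∩ adj i) (4 * D) u
        (≤-trans (card-∩ʳ H (adj i)) (bounded i e)) hu (≤-trans hd (deg i e)))
    where
    p h : ℕ
    p = suc q ^ k
    h = 2 * p * card H
    H>0 : 0 < card H
    H>0 = nonempty (card>0⇒∃ {U = I} I>0)
      where
      nonempty : (∃ λ i → I i ≡ true) → 0 < card H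
      nonempty (i , e) = ≤-trans (≤-trans m>0 (≤-trans (m≤m+n m _) (≤-trans hd (deg i e))))
        (card-∩ˡ H (adj i))
    large : 4 * (4 * D) * h < card I
    large = *-cancelˡ-< 2 _ _ (begin-strict
      2 * (4 * (4 * D) * h) ≡⟨ e D p (card H) ⟩
      64 * D * p * card H <⟨ *-monoˡ-< (card H) ⦃ >-nonZero H>0 ⦄ hw ⟩
      w * card H ≤⟨ ratio ⟩
      2 * card I ∎)
      where
      open ≤-Reasoning
      e : ∀ D p c → 2 * (4 * (4 * D) * (2 * p * c)) ≡ 64 * D * p * c
      e = solve-∀
    finish : (Σ (Fin N → Subset N) λ S → ∀ i → I i ≡ true → S i ⊑ (H ∩ adj i) × card (S i) ≡ k × Independent adj (S i)) → ⊥
    finish (S , spec) = second (independent-part adj irr I (4 * D) h ⦃ m*n≢0 4 D ⦄ bounded large)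
      where
      second : (Σ (Subset N) λ I₁ → I₁ ⊑ I × Independent adj I₁ × h < card I₁) → ⊥
      second (I₁ , I₁⊑I , indep , big) = third (bipartite-extraction adj o I₁ H S k q
          (λ i e v hv → ∧ˡ (H v) (proj₁ (spec i (I₁⊑I i e)) v hv))
          (λ i e → proj₁ (proj₂ (spec i (I₁⊑I i e))))
          (λ i e g h hg hh → nonadj⇒no-o g h (proj₂ (proj₂ (spec i (I₁⊑I i e))) g h hg hh))
          (λ i e → ≤-trans (*-monoʳ-≤ 2 (≤-trans (edges≤ o (S i) H (2 * D) λ v _ →
              ≤-trans (card-∩ʳ H (o v)) (o-out v))
            (≤-reflexive (cong (_* (2 * D)) (proj₁ (proj₂ (spec i (I₁⊑I i e))))))))
            (≤-trans (≤-reflexive (regroup k D)) hQ))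
          -- `I₁` is independent already: with q₂ = 0 the second sampling keeps everything, and
          -- disjointness on edges is vacuous.
          0 irr orient (λ i j hi hj e _ _ _ → true≢false e (indep i j hi hj)) (≤-trans (≤-reflexive
            (cong (λ x → suc (2 * (suc q * x + 1 * 1 * (p * p) * card H))) (no-edges adj I₁ indep))) (ineq (suc q) p ⦃ m^n≢0 (suc q) k ⦄ (card H) (card I₁) big)))
        where
        regroup : ∀ k D → 2 * (k * (2 * D)) ≡ 4 * D * k
        regroup = solve-∀
        nonadj⇒no-o : ∀ g h → adj g h ≡ false → o g h ≡ false
        nonadj⇒no-o g h e with o g h in eq
        ... | false = refl
        ... | true = ⊥-elim (true≢false (o⊑adj g h eq) e)
        ineq : ∀ Q .⦃ _ : NonZero Q ⦄ p .⦃ _ : NonZero p ⦄ c i → 2 * p * c < i → 2 * (Q * 0 + 1 * 1 * (p * p) * c) < 1 * (Q * p) * i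
        ineq Q p c i h = begin-strict
          2 * (Q * 0 + 1 * 1 * (p * p) * c) ≡⟨ e₁ Q p c ⟩
          1 * p * (2 * p * c) <⟨ *-monoʳ-< (1 * p) ⦃ m*n≢0 1 p ⦄ h ⟩
          1 * p * i ≤⟨ *-monoˡ-≤ i (*-monoʳ-≤ 1 (m≤n*m p Q)) ⟩
          1 * (Q * p) * i ∎
          where
          open ≤-Reasoning
          e₁ : ∀ Q p c → 2 * (Q * 0 + 1 * 1 * (p * p) * c) ≡ 1 * p * (2 * p * c)
          e₁ = solve-∀
        third : _ → ⊥
        third (B , H′ , B⊑ , H′⊑ , B-indep , H′-indep , S⊑H′ , fewer) = <⇒≱ fewer (no-bipartite B H′ B-indep H′-indep λ i e →
          ≤-trans (≤-reflexive (sym (proj₁ (proj₂ (spec i (I₁⊑I i (B⊑ i e)))))))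
            (card-mono {U = S i} {H′ ∩ adj i} λ v hv → ∧-intro (S⊑H′ i e v hv)
              (∧ʳ (H v) (proj₁ (spec i (I₁⊑I i (B⊑ i e))) v hv))))

-- The single-scale case

subset-of-size : ∀ {n} k (U : Subset n) → k ≤ card U → Σ (Subset n) λ S → S ⊑ U × card S ≡ k
subset-of-size {n} zero U h = (λ _ → false) , (λ _ ()) , sum-zero n
subset-of-size {n} (suc k) U h = extend (card>0⇒∃ {U = U} (≤-trans (s≤s z≤n) h))
  where
  extend : (∃ λ v → U v ≡ true) → _
  extend (v , hv) with subset-of-size k (remove v U) (≤-pred (≤-trans h (≤-reflexive (card-remove U v hv))))
  ... | S , S⊑ , size = S ∪ single v , inside ,
    trans (card-∪ {U = S} {single v} λ w hw e → true≢false e (not-true (∧ʳ (U w) (S⊑ w hw))))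
      (trans (cong₂ _+_ size (card-single v)) (+-comm k 1))
    where
    inside : (S ∪ single v) ⊑ U
    inside w e with S w in eq
    ... | true = ∧ˡ (U w) (S⊑ w eq)
    ... | false = subst (λ x → U x ≡ true) (dec-proof (v F.≟ w) e) hv

pairSum : ∀ {n} → Subset n → (Fin n → Fin n → ℕ) → ℕ
pairSum {n} I f = ∑[ i < n ] (⟦ I i ⟧ * ∑[ j < n ] (⟦ I j ⟧ * f i j))

module _ {n : ℕ} (I : Subset n) where

  pairSum-mono : ∀ {f g : Fin n → Fin n → ℕ} → (∀ i j → f i j ≤ g i j) → pairSum I f ≤ pairSum I g
  pairSum-mono h = sum-mono n λ i → *-monoʳ-≤ ⟦ I i ⟧ (sum-mono n λ j → *-monoʳ-≤ ⟦ I j ⟧ (h i j))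

  pairSum-*ʳ : ∀ c (f : Fin n → Fin n → ℕ) → pairSum I (λ i j → f i j * c) ≡ pairSum I f * c
  pairSum-*ʳ c f = trans (sum-cong n λ i → trans (cong (⟦ I i ⟧ *_) (trans
      (sum-cong n λ j → sym (*-assoc ⟦ I j ⟧ (f i j) c)) (sum-*ʳ n c _))) (sym (*-assoc ⟦ I i ⟧ _ c)))
    (sum-*ʳ n c _)

  pairSum-+ : ∀ (f g : Fin n → Fin n → ℕ) → pairSum I (λ i j → f i j + g i j) ≡ pairSum I f + pairSum I g
  pairSum-+ f g = trans (sum-cong n λ i → trans (cong (⟦ I i ⟧ *_) (trans
      (sum-cong n λ j → *-distribˡ-+ ⟦ I j ⟧ (f i j) (g i j)) (sum-+ n _ _))) (*-distribˡ-+ ⟦ I i ⟧ _ _))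
    (sum-+ n _ _)

  samp-pairSum : ∀ q (f : Fin n → Fin n → Subset n → ℕ) →
    samp q n (λ A → pairSum I (λ i j → f i j A)) ≡ pairSum I (λ i j → samp q n (f i j))
  samp-pairSum q f = trans (samp-sum q n n _) (sum-cong n λ i → trans (samp-*ˡ q n ⟦ I i ⟧ _)
    (cong (⟦ I i ⟧ *_) (trans (samp-sum q n n _) (sum-cong n λ j → samp-*ˡ q n ⟦ I j ⟧ _))))

-- Too few sampled neighbours, an edge among them, too many out-edges: each defect takes at most 1/8
-- of the total weight, so 5/8 remains, of which 1/2 is claimed.
good-arith : ∀ {d M g f e₁ e₅ E₁ E₅ Q² t D} .⦃ _ : NonZero d ⦄ .⦃ _ : NonZero Q² ⦄ .⦃ _ : NonZero t ⦄ →
  d * M ≤ d * g + d * f + d * e₁ + e₅ → 8 * f ≤ M → e₁ * Q² ≤ E₁ * M → t * E₁ ≤ 4 * D * (4 * D) →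
  e₅ * Q² ≤ E₅ * M → E₅ ≤ 4 * D * (2 * D) → 128 * (D * D) ≤ t * Q² → 64 * (D * D) ≤ d * Q² → M ≤ 2 * g
good-arith {d} {M} {g} {f} {e₁} {e₅} {E₁} {E₅} {Q²} {t} {D} h hf h₁ h₁′ h₅ h₅′ n₁ n₅ =
  *-cancelˡ-≤ (5 * d) ⦃ m*n≢0 5 d ⦄ (+-cancelʳ-≤ (3 * (d * M)) _ _ (begin
    5 * d * M + 3 * (d * M) ≡⟨ a₁ d M ⟩
    8 * (d * M) ≤⟨ *-monoʳ-≤ 8 h ⟩
    8 * (d * g + d * f + d * e₁ + e₅) ≡⟨ a₂ d g f e₁ e₅ ⟩
    8 * (d * g) + (d * (8 * f) + d * (8 * e₁) + 8 * e₅)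
      ≤⟨ +-mono-≤ (*-monoˡ-≤ (d * g) {8} {10} (s≤s (s≤s (s≤s (s≤s (s≤s (s≤s (s≤s (s≤s z≤n)))))))))
           (+-mono-≤ (+-mono-≤ (*-monoʳ-≤ d hf) (*-monoʳ-≤ d few-triangles)) few-out) ⟩
    10 * (d * g) + (d * M + d * M + d * M) ≡⟨ a₃ d g M ⟩
    5 * d * (2 * g) + 3 * (d * M) ∎))
  where
  open ≤-Reasoning
  a₁ : ∀ d M → 5 * d * M + 3 * (d * M) ≡ 8 * (d * M)
  a₁ = solve-∀
  a₂ : ∀ d g f e e′ → 8 * (d * g + d * f + d * e + e′) ≡ 8 * (d * g) + (d * (8 * f) + d * (8 * e) + 8 * e′)
  a₂ = solve-∀
  a₃ : ∀ d g M → 10 * (d * g) + (d * M + d * M + d * M) ≡ 5 * d * (2 * g) + 3 * (d * M)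
  a₃ = solve-∀
  few-triangles : 8 * e₁ ≤ M
  few-triangles = *-cancelˡ-≤ (t * Q²) ⦃ m*n≢0 t Q² ⦄ (begin
    t * Q² * (8 * e₁) ≡⟨ b₁ t Q² e₁ ⟩
    8 * t * (e₁ * Q²) ≤⟨ *-monoʳ-≤ (8 * t) h₁ ⟩
    8 * t * (E₁ * M) ≡⟨ b₂ t E₁ M ⟩
    8 * (t * E₁) * M ≤⟨ *-monoˡ-≤ M (*-monoʳ-≤ 8 h₁′) ⟩
    8 * (4 * D * (4 * D)) * M ≡⟨ b₃ D M ⟩
    128 * (D * D) * M ≤⟨ *-monoˡ-≤ M n₁ ⟩
    t * Q² * M ∎)
    where
    b₁ : ∀ t Q e → t * Q * (8 * e) ≡ 8 * t * (e * Q)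
    b₁ = solve-∀
    b₂ : ∀ t E M → 8 * t * (E * M) ≡ 8 * (t * E) * M
    b₂ = solve-∀
    b₃ : ∀ D M → 8 * (4 * D * (4 * D)) * M ≡ 128 * (D * D) * M
    b₃ = solve-∀
  few-out : 8 * e₅ ≤ d * M
  few-out = *-cancelˡ-≤ Q² (begin
    Q² * (8 * e₅) ≡⟨ b₁ Q² e₅ ⟩
    8 * (e₅ * Q²) ≤⟨ *-monoʳ-≤ 8 (≤-trans h₅ (*-monoˡ-≤ M h₅′)) ⟩
    8 * (4 * D * (2 * D) * M) ≡⟨ b₂ D M ⟩
    64 * (D * D) * M ≤⟨ *-monoˡ-≤ M n₅ ⟩
    d * Q² * M ≡⟨ b₃ d Q² M ⟩
    Q² * (d * M) ∎)
    where
    b₁ : ∀ Q e → Q * (8 * e) ≡ 8 * (e * Q)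
    b₁ = solve-∀
    b₂ : ∀ D M → 8 * (4 * D * (2 * D) * M) ≡ 64 * (D * D) * M
    b₂ = solve-∀
    b₃ : ∀ d Q M → d * Q * M ≡ Q * (d * M)
    b₃ = solve-∀

-- With Z = Q · y · qI · cI · M, each of the three costs on the left is at most Z/8, while the right
-- side is at least Z/2.
round-arith : ∀ {sG sC sH M Q₁ triangles fourCycles cI cH t D Δ qI y Q} .⦃ _ : NonZero M ⦄ .⦃ _ : NonZero Q₁ ⦄ .⦃ _ : NonZero cI ⦄
  .⦃ _ : NonZero t ⦄ .⦃ _ : NonZero qI ⦄ .⦃ _ : NonZero y ⦄ .⦃ _ : NonZero Q ⦄ →
  cI * M ≤ 2 * sG → sC * (Q₁ * Q₁) ≤ (Q₁ * triangles + fourCycles) * M → sH * Q₁ ≡ cH * M →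
  t * triangles ≤ cI * (4 * D * (4 * D)) → t * fourCycles ≤ cI * (4 * D * (4 * D * Δ)) →
  128 * (D * D) * (Q₁ + Δ) ≤ t * (Q₁ * Q₁) * qI → 64 * D ≤ y * qI → 16 * (qI * y * cH) ≤ Q * cI * Q₁ →
  Q * y * sC + 2 * Q * (cI * (4 * D)) * M + qI * qI * (2 * (y * y)) * sH < Q * y * (qI * sG)
round-arith {sG} {sC} {sH} {M} {Q₁} {triangles} {fourCycles} {cI} {cH} {t} {D} {Δ} {qI} {y} {Q} hG hC hH h₃ h₄ n₅ n₆ n₇ =
  *-cancelˡ-< 8 _ _ (begin-strict
    8 * (Q * y * sC + 2 * Q * (cI * (4 * D)) * M + qI * qI * (2 * (y * y)) * sH)
      ≡⟨ a₁ Q y sC cI D M qI sH ⟩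
    Q * y * (8 * sC) + Q * cI * M * (64 * D) + qI * y * (16 * (qI * y * sH))
      ≤⟨ +-mono-≤ (+-mono-≤ (*-monoʳ-≤ (Q * y) conflicts) (*-monoʳ-≤ (Q * cI * M) n₆)) (*-monoʳ-≤ (qI * y) vertices) ⟩
    Q * y * (qI * cI * M) + Q * cI * M * (y * qI) + qI * y * (Q * cI * M)
      ≡⟨ a₂ Q y qI cI M ⟩
    3 * (Q * y * qI * cI * M)
      <⟨ *-monoˡ-< (Q * y * qI * cI * M) ⦃ m*n≢0 _ M ⦃ m*n≢0 _ cI ⦃ m*n≢0 _ qI ⦃ m*n≢0 Q y ⦄ ⦄ ⦄ ⦄ {3} {4} ≤-refl ⟩
    4 * (Q * y * qI * cI * M)
      ≡⟨ a₃ Q y qI (cI) M ⟩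
    4 * (Q * y * qI) * (cI * M)
      ≤⟨ *-monoʳ-≤ (4 * (Q * y * qI)) hG ⟩
    4 * (Q * y * qI) * (2 * sG)
      ≡⟨ a₄ Q y qI sG ⟩
    8 * (Q * y * (qI * sG)) ∎)
  where
  open ≤-Reasoning
  a₁ : ∀ Q y s c D M q h → 8 * (Q * y * s + 2 * Q * (c * (4 * D)) * M + q * q * (2 * (y * y)) * h) ≡
    Q * y * (8 * s) + Q * c * M * (64 * D) + q * y * (16 * (q * y * h))
  a₁ = solve-∀
  a₂ : ∀ Q y q c M → Q * y * (q * c * M) + Q * c * M * (y * q) + q * y * (Q * c * M) ≡ 3 * (Q * y * q * c * M)
  a₂ = solve-∀
  a₃ : ∀ Q y q c M → 4 * (Q * y * q * c * M) ≡ 4 * (Q * y * q) * (c * M)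
  a₃ = solve-∀
  a₄ : ∀ Q y q s → 4 * (Q * y * q) * (2 * s) ≡ 8 * (Q * y * (q * s))
  a₄ = solve-∀
  conflicts : 8 * sC ≤ qI * cI * M
  conflicts = *-cancelˡ-≤ (t * (Q₁ * Q₁)) ⦃ m*n≢0 t (Q₁ * Q₁) ⦃ it ⦄ ⦃ m*n≢0 Q₁ Q₁ ⦄ ⦄ (begin
    t * (Q₁ * Q₁) * (8 * sC) ≡⟨ b₁ t (Q₁ * Q₁) sC ⟩
    8 * t * (sC * (Q₁ * Q₁)) ≤⟨ *-monoʳ-≤ (8 * t) hC ⟩
    8 * t * ((Q₁ * triangles + fourCycles) * M) ≡⟨ b₂ t Q₁ triangles fourCycles M ⟩
    8 * (Q₁ * (t * triangles) + t * fourCycles) * M ≤⟨ *-monoˡ-≤ M (*-monoʳ-≤ 8 (+-mono-≤ (*-monoʳ-≤ Q₁ h₃) h₄)) ⟩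
    8 * (Q₁ * (cI * (4 * D * (4 * D))) + cI * (4 * D * (4 * D * Δ))) * M ≡⟨ b₃ Q₁ cI D Δ M ⟩
    128 * (D * D) * (Q₁ + Δ) * (cI * M) ≤⟨ *-monoˡ-≤ (cI * M) n₅ ⟩
    t * (Q₁ * Q₁) * qI * (cI * M) ≡⟨ b₄ (t * (Q₁ * Q₁)) qI cI M ⟩
    t * (Q₁ * Q₁) * (qI * cI * M) ∎)
    where
    b₁ : ∀ t Q s → t * Q * (8 * s) ≡ 8 * t * (s * Q)
    b₁ = solve-∀
    b₂ : ∀ t Q a b M → 8 * t * ((Q * a + b) * M) ≡ 8 * (Q * (t * a) + t * b) * M
    b₂ = solve-∀
    b₃ : ∀ Q c D Δ M → 8 * (Q * (c * (4 * D * (4 * D))) + c * (4 * D * (4 * D * Δ))) * M ≡ 128 * (D * D) * (Q + Δ) * (c * M)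
    b₃ = solve-∀
    b₄ : ∀ a q c M → a * q * (c * M) ≡ a * (q * c * M)
    b₄ = solve-∀
  vertices : 16 * (qI * y * sH) ≤ Q * cI * M
  vertices = *-cancelˡ-≤ Q₁ (begin
    Q₁ * (16 * (qI * y * sH)) ≡⟨ b₁ Q₁ qI y sH ⟩
    16 * (qI * y) * (sH * Q₁) ≡⟨ cong (16 * (qI * y) *_) hH ⟩
    16 * (qI * y) * (cH * M) ≡⟨ b₂ qI y cH M ⟩
    16 * (qI * y * cH) * M ≤⟨ *-monoˡ-≤ M n₇ ⟩
    Q * cI * Q₁ * M ≡⟨ b₃ Q cI Q₁ M ⟩
    Q₁ * (Q * cI * M) ∎)
    where
    b₁ : ∀ Q q y s → Q * (16 * (q * y * s)) ≡ 16 * (q * y) * (s * Q)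
    b₁ = solve-∀
    b₂ : ∀ q y c M → 16 * (q * y) * (c * M) ≡ 16 * (q * y * c) * M
    b₂ = solve-∀
    b₃ : ∀ Q c q M → Q * c * q * M ≡ q * (Q * c * M)
    b₃ = solve-∀

-- For independent `B` and `H` this excludes all 4-cycles of the graph induced on their union.
C₄-free : ∀ {n} → Rel n → Subset n → Subset n → Set
C₄-free adj B H = ∀ i j g h → B i ≡ true → B j ≡ true → H g ≡ true → H h ≡ true → i ≢ j → g ≢ h →
  adj i g ≡ true → adj i h ≡ true → adj j g ≡ true → adj j h ≡ true → ⊥

-- A is the sample of H. A vertex i of I is good if its sampled neighbourhood is large, spans no edge and has few
-- out-neighbours; i and j conflict if they lie on a common triangle or 4-cycle through the sample.
module SingleScaleCase {N : ℕ} (adj : Rel N) (irr : ∀ u → adj u u ≡ false) (adj-sym : ∀ u v → adj u v ≡ adj v u)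
  (D : ℕ) .⦃ _ : NonZero D ⦄
  (o : Rel N) (orient : ∀ u v → adj u v ≡ true → o u v ≡ true ⊎ o v u ≡ true)
  (o⊑adj : ∀ u v → o u v ≡ true → adj u v ≡ true) (o-out : ∀ u → card (o u) ≤ 2 * D)
  (t m : ℕ) .⦃ _ : NonZero t ⦄ (sparse : ∀ X Y → m ≤ card X → m ≤ card Y → t * edges adj Y X < card X * card Y)
  (κ : ℕ)
  (no-C₄-free : ∀ B H → Independent adj B → Independent adj H → C₄-free adj B H →
    (∀ i → B i ≡ true → κ ≤ card (H ∩ adj i)) → card B ≤ card H)
  (I H : Subset N) (I>0 : 0 < card I) (bounded : ∀ i → I i ≡ true → card (adj i) ≤ 4 * D)
  (R Δ : ℕ) (deg-I : ∀ i → I i ≡ true → R ≤ card (H ∩ adj i)) (deg-H : ∀ h → H h ≡ true → card (I ∩ adj h) ≤ Δ)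
  (q₁ d : ℕ) .⦃ _ : NonZero d ⦄
  (mt≤4D : m * t ≤ 4 * D) (mt≤Δ : m * t ≤ Δ)
  (num₁ : 8 * 2 ^ κ * (1 + 2 * q₁) ≤ R) (num₂ : 128 * (D * D) ≤ t * (suc q₁ * suc q₁)) (num₃ : 64 * (D * D) ≤ d * (suc q₁ * suc q₁))
  where

  private
    Q₁ M : ℕ
    Q₁ = suc q₁
    M = suc q₁ ^ N

  nb : Fin N → Subset N
  nb i = H ∩ adj i

  nbEdges outEdges : Subset N → Fin N → ℕ
  nbEdges A i = edges adj (nb i ∩ A) (nb i ∩ A)
  outEdges A i = edges o (nb i ∩ A) (H ∩ A)

  fewNb triangleFree fewOut : Subset N → Fin N → Bool
  fewNb A i = does (card (nb i ∩ A) <? κ)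
  triangleFree A i = does (nbEdges A i ≟ 0)
  fewOut A i = does (outEdges A i ≤? d)

  good : Subset N → Subset N
  good A i = I i ∧ ((not (fewNb A i) ∧ triangleFree A i) ∧ fewOut A i)

  -- The union bound in indicator form. The scaling by `d` builds in Markov's inequality for
  -- `outEdges` with threshold `d`.
  good-or-bad : ∀ A i → I i ≡ true → d ≤ d * ⟦ good A i ⟧ + d * ⟦ fewNb A i ⟧ +
    d * nbEdges A i + outEdges A i
  good-or-bad A i hi = subst (λ b → d ≤ d * ⟦ b ∧ ((not (fewNb A i) ∧ triangleFree A i) ∧ fewOut A i) ⟧ + d * ⟦ fewNb A i ⟧ + d * e₁ + e₂)
    (sym hi) (by-cases (fewNb A i) (e₁ ≟ 0) (e₂ ≤? d))
    where
    e₁ e₂ : ℕ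
    e₁ = nbEdges A i
    e₂ = outEdges A i
    by-cases : ∀ b (p : Dec (e₁ ≡ 0)) (q : Dec (e₂ ≤ d)) →
      d ≤ d * ⟦ (not b ∧ does p) ∧ does q ⟧ + d * ⟦ b ⟧ + d * e₁ + e₂
    by-cases true p q = m≤n⇒m≤n+o e₂ (m≤n⇒m≤n+o (d * e₁) (m≤n⇒m≤o+n (d * 0) (≤-reflexive (sym (*-identityʳ d)))))
    by-cases false (no ¬p) q = m≤n⇒m≤n+o e₂ (m≤n⇒m≤o+n (d * 0 + d * 0) (m≤m*n d e₁ ⦃ ≢-nonZero ¬p ⦄))
    by-cases false (yes _) (no ¬q) = m≤n⇒m≤o+n (d * 0 + d * 0 + d * e₁) (<⇒≤ (≰⇒> ¬q))
    by-cases false (yes _) (yes _) = m≤n⇒m≤n+o e₂ (m≤n⇒m≤n+o (d * e₁) (m≤n⇒m≤n+o (d * 0) (≤-reflexive (sym (*-identityʳ d)))))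

  deg-nb : ∀ i → I i ≡ true → card (nb i) ≤ 4 * D
  deg-nb i hi = ≤-trans (card-mono {U = nb i} {adj i} (λ v → ∧ʳ (H v))) (bounded i hi)

  o-irr : ∀ u → o u u ≡ false
  o-irr u with o u u in eq
  ... | false = refl
  ... | true = ⊥-elim (true≢false (o⊑adj u u eq) (irr u))

  square : ∀ x → x ^ 2 ≡ x * x
  square x = cong (x *_) (*-identityʳ x)

  samp-edges′ : (r : Rel N) (X Y : Subset N) → (∀ u → r u u ≡ false) →
    samp q₁ N (λ A → edges r (X ∩ A) (Y ∩ A)) * (Q₁ * Q₁) ≤ edges r X Y * M
  samp-edges′ r X Y h = subst (λ x → samp q₁ N (λ A → edges r (X ∩ A) (Y ∩ A)) * x ≤ edges r X Y * M)
    (square Q₁) (samp-edges q₁ N r X Y h)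

  expected-good-vertex : ∀ i → I i ≡ true → M ≤ 2 * samp q₁ N (λ A → ⟦ good A i ⟧)
  expected-good-vertex i hi = good-arith {d} {M} {samp q₁ N (λ A → ⟦ good A i ⟧)} {samp q₁ N (λ A → ⟦ fewNb A i ⟧)}
      {samp q₁ N (λ A → nbEdges A i)} {samp q₁ N (λ A → outEdges A i)}
      {edges adj (nb i) (nb i)} {edges o (nb i) H} {Q₁ * Q₁} {t} {D}
    (begin
      d * M ≡⟨ samp-const q₁ N d ⟨
      samp q₁ N (λ _ → d) ≤⟨ samp-mono q₁ N (λ A → good-or-bad A i hi) ⟩
      samp q₁ N (λ A → d * ⟦ good A i ⟧ + d * ⟦ fewNb A i ⟧ + d * nbEdges A i + outEdges A i)
        ≡⟨ trans (samp-+ q₁ N _ _) (cong (_+ samp q₁ N (λ A → outEdges A i))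
             (trans (samp-+ q₁ N _ _) (cong₂ _+_ (trans (samp-+ q₁ N _ _) (cong₂ _+_ (samp-*ˡ q₁ N d _) (samp-*ˡ q₁ N d _)))
               (samp-*ˡ q₁ N d _)))) ⟩
      d * samp q₁ N (λ A → ⟦ good A i ⟧) + d * samp q₁ N (λ A → ⟦ fewNb A i ⟧) + d * samp q₁ N (λ A → nbEdges A i)
        + samp q₁ N (λ A → outEdges A i) ∎)
    (samp-few q₁ N (nb i) κ 8 (≤-trans num₁ (deg-I i hi)))
    (samp-edges′ adj (nb i) (nb i) irr)
    (Sparse.sparse-≤ adj t m sparse (nb i) (nb i) (4 * D) (4 * D) (deg-nb i hi) (deg-nb i hi) mt≤4D mt≤4D)
    (samp-edges′ o (nb i) H o-irr)
    (≤-trans (edges≤ o (nb i) H (2 * D) λ u _ → ≤-trans (card-∩ʳ H (o u)) (o-out u))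
      (*-monoˡ-≤ (2 * D) (deg-nb i hi)))
    num₂ num₃
    where open ≤-Reasoning

  expected-good : card I * M ≤ 2 * samp q₁ N (card ∘ good)
  expected-good = begin
    card I * M ≡⟨ sum-*ʳ N M _ ⟨
    ∑[ i < N ] (⟦ I i ⟧ * M) ≤⟨ sum-mono N (λ i → ⟦⟧*≤ (I i) (expected-good-vertex i)) ⟩
    ∑[ i < N ] (2 * samp q₁ N (λ A → ⟦ good A i ⟧)) ≡⟨ sum-*ˡ N 2 _ ⟩
    2 * ∑[ i < N ] samp q₁ N (λ A → ⟦ good A i ⟧) ≡⟨ cong (2 *_) (samp-sum q₁ N N _) ⟨
    2 * samp q₁ N (card ∘ good) ∎
    where open ≤-Reasoning

  common : Fin N → Fin N → Subset N
  common i j = nb i ∩ adj j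

  distinct : Rel N
  distinct u v = not (single u v)

  distinct-irr : ∀ u → distinct u u ≡ false
  distinct-irr u = cong not (dec-true (u F.≟ u) refl)

  shared sharedPairs : Fin N → Fin N → Subset N → ℕ
  shared i j A = card (common i j ∩ A)
  sharedPairs i j A = edges distinct (common i j ∩ A) (common i j ∩ A)

  -- Without conflicts of the first kind, adjacent centres have disjoint stars, as
  -- `bipartite-extraction` demands; without those of the second kind, the extracted graph is free
  -- of 4-cycles.
  conf : Subset N → Rel N
  conf A i j = distinct i j ∧ ((adj i j ∧ some (common i j ∩ A)) ∨ does (2 ≤? shared i j A))

  -- An upper bound for the number of conflicts with a computable expectation: a triangle needs one
  -- sampled vertex and a 4-cycle two, hence the weights 1/Q₁ and 1/Q₁².
  conflicts : Subset N → ℕ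
  conflicts A = pairSum I (λ i j → ⟦ adj i j ⟧ * shared i j A + sharedPairs i j A)

  two-distinct : ∀ (X : Subset N) → 2 ≤ card X → 1 ≤ edges distinct X X
  two-distinct X h = by-witness (card>0⇒∃ {U = X} (<⇒≤ h))
    where
    by-witness : (∃ λ v → X v ≡ true) → 1 ≤ edges distinct X X
    by-witness (v , hv) = ≤-trans (≤-trans (≤-pred (≤-trans h (≤-reflexive (card-remove X v hv))))
        (≤-reflexive (sym (⟦⟧*-1 {X v} (card (X ∩ distinct v)) hv))))
      (term≤sum N (λ u → ⟦ X u ⟧ * card (X ∩ distinct u)) v)

  edges≤conflicts : ∀ A → edges (conf A) I I ≤ conflicts A
  edges≤conflicts A = sum-mono N λ i → *-monoʳ-≤ ⟦ I i ⟧ (sum-mono N λ j → ≤-trans (≤-reflexive (⟦∧⟧ (I j) (conf A i j)))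
      (*-monoʳ-≤ ⟦ I j ⟧ (⟦⟧-≤ {conf A i j} λ e → reason i j (adj i j) refl (∧ʳ (distinct i j) e))))
    where
    reason : ∀ i j b → adj i j ≡ b → (b ∧ some (common i j ∩ A)) ∨ does (2 ≤? shared i j A) ≡ true →
      1 ≤ ⟦ b ⟧ * shared i j A + sharedPairs i j A
    reason i j false _ e = two-distinct (common i j ∩ A) (dec-proof (2 ≤? shared i j A) e)
    reason i j true _ e = by-some (some (common i j ∩ A)) refl e
      where
      by-some : ∀ b → some (common i j ∩ A) ≡ b → b ∨ does (2 ≤? shared i j A) ≡ true →
        1 ≤ 1 * shared i j A + sharedPairs i j A
      by-some true e₁ _ = m≤n⇒m≤n+o _ (≤-trans (∈⇒card>0 {U = common i j ∩ A} (proj₂ (some-∃ (common i j ∩ A) e₁)))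
        (≤-reflexive (sym (*-identityˡ _))))
      by-some false _ e₂ = m≤n⇒m≤o+n (1 * shared i j A) (two-distinct (common i j ∩ A) (dec-proof (2 ≤? shared i j A) e₂))

  triangles fourCycles : ℕ
  triangles = pairSum I (λ i j → ⟦ adj i j ⟧ * card (common i j))
  fourCycles = pairSum I (λ i j → card (common i j) * card (common i j))

  expected-conflicts : samp q₁ N conflicts * (Q₁ * Q₁) ≤ (Q₁ * triangles + fourCycles) * M
  expected-conflicts = begin
    samp q₁ N conflicts * (Q₁ * Q₁)
      ≡⟨ cong (_* (Q₁ * Q₁)) (samp-pairSum I q₁ (λ i j A → ⟦ adj i j ⟧ * shared i j A + sharedPairs i j A)) ⟩
    pairSum I (λ i j → samp q₁ N (λ A → ⟦ adj i j ⟧ * shared i j A + sharedPairs i j A)) * (Q₁ * Q₁)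
      ≡⟨ pairSum-*ʳ I (Q₁ * Q₁) _ ⟨
    pairSum I (λ i j → samp q₁ N (λ A → ⟦ adj i j ⟧ * shared i j A + sharedPairs i j A) * (Q₁ * Q₁))
      ≤⟨ pairSum-mono I pointwise ⟩
    pairSum I (λ i j → (⟦ adj i j ⟧ * card (common i j) * Q₁ + card (common i j) * card (common i j)) * M)
      ≡⟨ pairSum-*ʳ I M _ ⟩
    pairSum I (λ i j → ⟦ adj i j ⟧ * card (common i j) * Q₁ + card (common i j) * card (common i j)) * M
      ≡⟨ cong (_* M) (trans (pairSum-+ I _ _) (cong (_+ fourCycles) (trans (pairSum-*ʳ I Q₁ _) (*-comm triangles Q₁)))) ⟩
    (Q₁ * triangles + fourCycles) * M ∎
    where
    open ≤-Reasoning
    arith : ∀ a {x y c Q M} → x * Q ≡ c * M → y * (Q * Q) ≤ c * c * M →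
      (a * x + y) * (Q * Q) ≤ (a * c * Q + c * c) * M
    arith a {x} {y} {c} {Q} {M} h₁ h₂ = begin
      (a * x + y) * (Q * Q) ≡⟨ b₁ a x y Q ⟩
      a * (x * Q) * Q + y * (Q * Q) ≤⟨ +-mono-≤ (≤-reflexive (cong (λ z → a * z * Q) h₁)) h₂ ⟩
      a * (c * M) * Q + c * c * M ≡⟨ b₂ a c M Q ⟩
      (a * c * Q + c * c) * M ∎
      where
      b₁ : ∀ a x y Q → (a * x + y) * (Q * Q) ≡ a * (x * Q) * Q + y * (Q * Q)
      b₁ = solve-∀
      b₂ : ∀ a c M Q → a * (c * M) * Q + c * c * M ≡ (a * c * Q + c * c) * M
      b₂ = solve-∀
    pointwise : ∀ i j → samp q₁ N (λ A → ⟦ adj i j ⟧ * shared i j A + sharedPairs i j A) * (Q₁ * Q₁)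
      ≤ (⟦ adj i j ⟧ * card (common i j) * Q₁ + card (common i j) * card (common i j)) * M
    pointwise i j = ≤-trans (≤-reflexive (cong (_* (Q₁ * Q₁)) (trans
        (samp-+ q₁ N (λ A → ⟦ adj i j ⟧ * shared i j A) _)
        (cong (_+ samp q₁ N (λ A → sharedPairs i j A)) (samp-*ˡ q₁ N ⟦ adj i j ⟧ _)))))
      (arith ⟦ adj i j ⟧ {samp q₁ N (λ A → shared i j A)} {samp q₁ N (λ A → sharedPairs i j A)}
        {card (common i j)} {Q₁} {M} (samp-card q₁ N (common i j))
        (≤-trans (samp-edges′ distinct (common i j) (common i j) distinct-irr)
          (*-monoˡ-≤ M (edges≤product distinct (common i j) (common i j)))))

  per-vertex : ∀ (f : Fin N → ℕ) c → (∀ i → I i ≡ true → t * f i ≤ c) → t * ∑[ i < N ] (⟦ I i ⟧ * f i) ≤ card I * c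
  per-vertex f c h = begin
    t * ∑[ i < N ] (⟦ I i ⟧ * f i) ≡⟨ sum-*ˡ N t _ ⟨
    ∑[ i < N ] (t * (⟦ I i ⟧ * f i)) ≡⟨ sum-cong N (λ i → x∙yz≈y∙xz t ⟦ I i ⟧ (f i)) ⟩
    ∑[ i < N ] (⟦ I i ⟧ * (t * f i)) ≤⟨ sum-mono N (λ i → ⟦⟧*-≤ (I i) (h i)) ⟩
    ∑[ i < N ] (⟦ I i ⟧ * c) ≡⟨ sum-*ʳ N c _ ⟩
    card I * c ∎
    where open ≤-Reasoning

  few-triangles : t * triangles ≤ card I * (4 * D * (4 * D))
  few-triangles = per-vertex _ (4 * D * (4 * D)) λ i hi → ≤-trans (≤-reflexive (cong (t *_) (sum-cong N λ j →
      trans (sym (*-assoc ⟦ I j ⟧ ⟦ adj i j ⟧ _)) (cong (_* card (common i j)) (sym (⟦∧⟧ (I j) (adj i j)))))))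
    (Sparse.sparse-≤ adj t m sparse (nb i) (I ∩ adj i) (4 * D) (4 * D) (deg-nb i hi)
      (≤-trans (card-∩ʳ I (adj i)) (bounded i hi)) mt≤4D mt≤4D)

  -- The 4-cycles through `i`, degenerate ones included, are opened at a neighbour `h` of `i`: what
  -- remains is an edge between `I ∩ adj h` and `nb i`, and sparsity bounds the number of those.
  few-4-cycles : t * fourCycles ≤ card I * (4 * D * (4 * D * Δ))
  few-4-cycles = per-vertex _ (4 * D * (4 * D * Δ)) λ i hi → begin
    t * ∑[ j < N ] (⟦ I j ⟧ * (card (common i j) * card (common i j)))
      ≡⟨ cong (t *_) (rewrite-sum i) ⟩
    t * ∑[ h < N ] (⟦ nb i h ⟧ * edges adj (I ∩ adj h) (nb i))
      ≡⟨ trans (sym (sum-*ˡ N t _)) (sum-cong N λ h → x∙yz≈y∙xz t ⟦ nb i h ⟧ _) ⟩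
    ∑[ h < N ] (⟦ nb i h ⟧ * (t * edges adj (I ∩ adj h) (nb i)))
      ≤⟨ sum-mono N (λ h → ⟦⟧*-≤ (nb i h) λ e → Sparse.sparse-≤ adj t m sparse (nb i) (I ∩ adj h) (4 * D) Δ
           (deg-nb i hi) (deg-H h (∧ˡ (H h) e)) mt≤4D mt≤Δ) ⟩
    ∑[ h < N ] (⟦ nb i h ⟧ * (4 * D * Δ))
      ≡⟨ sum-*ʳ N (4 * D * Δ) _ ⟩
    card (nb i) * (4 * D * Δ)
      ≤⟨ *-monoˡ-≤ (4 * D * Δ) (deg-nb i hi) ⟩
    4 * D * (4 * D * Δ) ∎
    where
    open ≤-Reasoning
    rewrite-sum : ∀ i → ∑[ j < N ] (⟦ I j ⟧ * (card (common i j) * card (common i j))) ≡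
      ∑[ h < N ] (⟦ nb i h ⟧ * edges adj (I ∩ adj h) (nb i))
    rewrite-sum i = trans (sum-cong N λ j → trans (sym (*-assoc ⟦ I j ⟧ (card (common i j)) _)) (trans
          (cong (_* card (common i j)) (sym (sum-*ˡ N ⟦ I j ⟧ _))) (sym (sum-*ʳ N (card (common i j)) _))))
      (trans (sum-swap N N _) (sum-cong N λ h → trans (sum-cong N (λ j → point h j)) (sum-*ˡ N ⟦ nb i h ⟧ _)))
      where
      regroup : ∀ a b c x → a * (b * c) * x ≡ b * (a * c * x)
      regroup = solve-∀
      point : ∀ h j → ⟦ I j ⟧ * ⟦ nb i h ∧ adj j h ⟧ * card (common i j) ≡ ⟦ nb i h ⟧ * (⟦ I j ∧ adj h j ⟧ * card (common i j))
      point h j = trans (cong (λ x → ⟦ I j ⟧ * x * card (common i j)) (⟦∧⟧ (nb i h) (adj j h)))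
        (trans (regroup ⟦ I j ⟧ ⟦ nb i h ⟧ ⟦ adj j h ⟧ (card (common i j)))
          (cong (λ x → ⟦ nb i h ⟧ * (x * card (common i j))) (trans (cong (λ b → ⟦ I j ⟧ * ⟦ b ⟧) (adj-sym j h)) (sym (⟦∧⟧ (I j) (adj h j))))))

  module Finish (q qI′ q₂ : ℕ) (2d≤Q : 2 * d ≤ suc q)
    (num₅ : 128 * (D * D) * (Q₁ + Δ) ≤ t * (Q₁ * Q₁) * suc qI′)
    (num₆ : 64 * D ≤ suc q₂ * suc q ^ κ * suc qI′)
    (num₇ : 16 * (suc qI′ * (suc q₂ * suc q ^ κ) * card H) ≤ suc q * card I * Q₁) where

    private
      Q qI p y : ℕ
      Q = suc q
      qI = suc qI′
      p = suc q ^ κ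
      y = suc q₂ * p

    -- The weights are found backwards. The extraction needs 2Q e(B) + 2y² |H₁| < Q y |B|; deletion
    -- at rate 1/qI derives this from the present inequality, in which 4D |I| bounds the adjacent
    -- pairs inside `G`.
    round₁ : ∃ λ A → Q * y * conflicts A + 2 * Q * (card I * (4 * D)) + qI * qI * (2 * (y * y)) * card (H ∩ A)
      < Q * y * (qI * card (good A))
    round₁ = samp-∃ q₁ N (begin-strict
      samp q₁ N (λ A → Q * y * conflicts A + 2 * Q * (card I * (4 * D)) + qI * qI * (2 * (y * y)) * card (H ∩ A))
        ≡⟨ trans (samp-+ q₁ N _ _) (cong₂ _+_ (trans (samp-+ q₁ N _ _)
             (cong₂ _+_ (samp-*ˡ q₁ N (Q * y) conflicts) (samp-const q₁ N (2 * Q * (card I * (4 * D))))))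
             (samp-*ˡ q₁ N (qI * qI * (2 * (y * y))) (λ A → card (H ∩ A)))) ⟩
      Q * y * samp q₁ N conflicts + 2 * Q * (card I * (4 * D)) * M + qI * qI * (2 * (y * y)) * samp q₁ N (λ A → card (H ∩ A))
        <⟨ round-arith {samp q₁ N (card ∘ good)} {samp q₁ N conflicts} {samp q₁ N (λ A → card (H ∩ A))} {M} {Q₁} {triangles} {fourCycles}
             {card I} {card H} {t} {D} {Δ} {qI} {y} {Q}
             ⦃ m^n≢0 (suc q₁) N ⦄ ⦃ _ ⦄ ⦃ >-nonZero I>0 ⦄ ⦃ it ⦄ ⦃ _ ⦄ ⦃ m*n≢0 (suc q₂) p ⦃ _ ⦄ ⦃ m^n≢0 (suc q) κ ⦄ ⦄
             expected-good expected-conflicts (samp-card q₁ N H) few-triangles few-4-cycles num₅ num₆ num₇ ⟩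
      Q * y * (qI * samp q₁ N (card ∘ good))
        ≡⟨ trans (sym (*-assoc (Q * y) qI _)) (trans (sym (samp-*ˡ q₁ N (Q * y * qI) (card ∘ good)))
             (samp-cong q₁ N λ A → *-assoc (Q * y) qI (card (good A)))) ⟩
      samp q₁ N (λ A → Q * y * (qI * card (good A))) ∎)
      where open ≤-Reasoning

    module Round₂ (A : Subset N) (found : Q * y * conflicts A + 2 * Q * (card I * (4 * D)) + qI * qI * (2 * (y * y)) * card (H ∩ A)
      < Q * y * (qI * card (good A))) where

      private
        H₁ G : Subset N
        H₁ = H ∩ A
        G = good A

      G⊑I : G ⊑ I
      G⊑I i = ∧ˡ (I i)

      conf-irr : ∀ u → conf A u u ≡ false
      conf-irr u = cong (_∧ ((adj u u ∧ some (common u u ∩ A)) ∨ does (2 ≤? card (common u u ∩ A)))) (distinct-irr u)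

      round₂ : Σ (Subset N) λ B → B ⊑ G × (∀ u v → B u ≡ true → B v ≡ true → conf A u v ≡ false) ×
        2 * Q * edges adj B B + 2 * (y * y) * card H₁ < Q * y * card B
      round₂ = deletion qI′ G (conf A) adj conf-irr irr (Q * y) (2 * Q) (2 * (y * y) * card H₁) (≤-<-trans (+-mono-≤
          (+-mono-≤ (*-monoʳ-≤ (Q * y) (≤-trans (edges-mono (conf A) {G} {I} {G} {I} G⊑I G⊑I) (edges≤conflicts A)))
            (*-monoʳ-≤ (2 * Q) (≤-trans (edges-mono adj {G} {I} {G} {I} G⊑I G⊑I) (edges≤ adj I I (4 * D) λ i e →
              ≤-trans (card-∩ʳ I (adj i)) (bounded i e)))))
          (≤-reflexive (shape qI (2 * (y * y)) (card H₁)))) found)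
        where
        shape : ∀ a b c → a * (a * 1) * (b * c) ≡ a * a * b * c
        shape = solve-∀

      nbA : Fin N → Subset N
      nbA i = nb i ∩ A

      enough : ∀ i → G i ≡ true → κ ≤ card (nbA i)
      enough i e = ≮⇒≥ (dec-disproof (card (nbA i) <? κ) (not-true (∧ˡ (not (fewNb A i))
        (∧ˡ (not (fewNb A i) ∧ triangleFree A i) (∧ʳ (I i) e)))))

      no-triangles : ∀ i → G i ≡ true → edges adj (nbA i) (nbA i) ≡ 0
      no-triangles i e = dec-proof (edges adj (nbA i) (nbA i) ≟ 0) (∧ʳ (not (fewNb A i))
        (∧ˡ (not (fewNb A i) ∧ triangleFree A i) (∧ʳ (I i) e)))

      few-out : ∀ i → G i ≡ true → edges o (nbA i) H₁ ≤ d
      few-out i e = dec-proof (edges o (nbA i) H₁ ≤? d) (∧ʳ (not (fewNb A i) ∧ triangleFree A i) (∧ʳ (I i) e))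

      module Round₃ (B : Subset N) (B⊑G : B ⊑ G) (free : ∀ u v → B u ≡ true → B v ≡ true → conf A u v ≡ false)
        (many : 2 * Q * edges adj B B + 2 * (y * y) * card H₁ < Q * y * card B) where

        B⊑I : B ⊑ I
        B⊑I i e = G⊑I i (B⊑G i e)

        unrelated : ∀ i j → B i ≡ true → B j ≡ true → i ≢ j →
          (adj i j ∧ some (common i j ∩ A)) ∨ does (2 ≤? shared i j A) ≡ false
        unrelated i j hi hj i≢j = trans (cong (_∧ ((adj i j ∧ some (common i j ∩ A)) ∨ does (2 ≤? shared i j A)))
          (cong not (sym (dec-false (i F.≟ j) i≢j)))) (free i j hi hj)

        no-common : ∀ i j → B i ≡ true → B j ≡ true → adj i j ≡ true → ∀ h → (common i j ∩ A) h ≡ true → ⊥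
        no-common i j hi hj e h hh = none (common i j ∩ A) (first-false (adj i j) e
            (unrelated i j hi hj λ p → true≢false e (subst (λ x → adj i x ≡ false) p (irr i)))) h hh
          where
          first-false : ∀ a {b c} → a ≡ true → (a ∧ b) ∨ c ≡ false → b ≡ false
          first-false true {false} _ _ = refl

        no-two-common : ∀ i j → B i ≡ true → B j ≡ true → i ≢ j → ∀ g h → g ≢ h →
          (common i j ∩ A) g ≡ true → (common i j ∩ A) h ≡ true → ⊥
        no-two-common i j hi hj i≢j g h g≢h hg hh = dec-disproof (2 ≤? shared i j A)
          (second-false (adj i j ∧ some (common i j ∩ A)) (unrelated i j hi hj i≢j))
          (≤-trans (≤-reflexive (sym (card-pair g≢h))) (card-mono {U = pair g h} {common i j ∩ A} inside))
          where
          second-false : ∀ a {b} → a ∨ b ≡ false → b ≡ false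
          second-false false e = e
          inside : pair g h ⊑ (common i j ∩ A)
          inside v e with g F.≟ v
          ... | yes refl = hg
          ... | no _ = subst (λ x → (common i j ∩ A) x ≡ true) (dec-proof (h F.≟ v) e) hh

        stars : Σ (Fin N → Subset N) λ S → ∀ i → B i ≡ true → S i ⊑ nbA i × card (S i) ≡ κ
        stars = choice B {λ i S → S ⊑ nbA i × card S ≡ κ} λ i e → subset-of-size κ (nbA i) (enough i (B⊑G i e))

        S : Fin N → Subset N
        S = proj₁ stars

        S⊑nbA : ∀ i → B i ≡ true → S i ⊑ nbA i
        S⊑nbA i e = proj₁ (proj₂ stars i e)

        nbA⊑H₁ : ∀ i → nbA i ⊑ H₁
        nbA⊑H₁ i v e = ∧-intro (∧ˡ (H v) (∧ˡ (nb i v) e)) (∧ʳ (nb i v) e)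

        nbA⊑adj : ∀ i → nbA i ⊑ adj i
        nbA⊑adj i v e = ∧ʳ (H v) (∧ˡ (nb i v) e)

        S-indep : ∀ i → B i ≡ true → ∀ h g → S i h ≡ true → S i g ≡ true → o h g ≡ false
        S-indep i e h g eh eg with o h g in eq
        ... | false = refl
        ... | true = ⊥-elim (<⇒≱ (≤-trans (∈⇒card>0 {U = nbA i ∩ adj h} (∧-intro (S⊑nbA i e g eg) (o⊑adj h g eq)))
          (≤-trans (≤-reflexive (sym (⟦⟧*-1 {nbA i h} _ (S⊑nbA i e h eh)))) (term≤sum N (λ u → ⟦ nbA i u ⟧ * card (nbA i ∩ adj u)) h)))
          (≤-reflexive (no-triangles i (B⊑G i e))))

        round₃ : Σ (Subset N) λ B′ → Σ (Subset N) λ H′ → B′ ⊑ B × H′ ⊑ H₁ × Independent adj B′ × Independent adj H′ ×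
          (∀ i → B′ i ≡ true → S i ⊑ H′) × card H′ < card B′
        round₃ = bipartite-extraction adj o B H₁ S κ q
          (λ i e v h → nbA⊑H₁ i v (S⊑nbA i e v h)) (λ i e → proj₂ (proj₂ stars i e)) S-indep
          (λ i e → ≤-trans (*-monoʳ-≤ 2 (≤-trans (edges-mono o {S i} {nbA i} {H₁} {H₁} (S⊑nbA i e) (λ _ h → h)) (few-out i (B⊑G i e)))) 2d≤Q)
          q₂ irr orient
          -- Adjacent centres with a common leaf would form a triangle through the sample, which is
          -- a conflict.
          (λ i j hi hj e h h₁ h₂ → no-common i j hi hj e h (∧-intro
            (∧-intro (∧ˡ (nb i h) (S⊑nbA i hi h h₁)) (nbA⊑adj j h (S⊑nbA j hj h h₂))) (∧ʳ (nb i h) (S⊑nbA i hi h h₁))))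
          (subst₂ _<_ (shapeˡ Q (edges adj B B) (suc q₂) p (card H₁)) (shapeʳ Q (suc q₂) p (card B)) many)
          where
          shapeˡ : ∀ Q E R p c → 2 * Q * E + 2 * (R * p * (R * p)) * c ≡ 2 * (Q * E + R * R * (p * p) * c)
          shapeˡ = solve-∀
          shapeʳ : ∀ Q R p c → Q * (R * p) * c ≡ R * (Q * p) * c
          shapeʳ = solve-∀

        absurd : ⊥
        absurd = conclude round₃
          where
          conclude : (Σ (Subset N) λ B′ → Σ (Subset N) λ H′ → B′ ⊑ B × H′ ⊑ H₁ × Independent adj B′ × Independent adj H′ ×
            (∀ i → B′ i ≡ true → S i ⊑ H′) × card H′ < card B′) → ⊥
          conclude (B′ , H′ , B′⊑B , H′⊑H₁ , B-indep , H-indep , S⊑H′ , fewer) = <⇒≱ fewer (no-C₄-free B′ H′ B-indep H-indep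
            (λ i j g h hi hj hg hh i≢j g≢h ig ih jg jh → no-two-common i j (B′⊑B i hi) (B′⊑B j hj) i≢j g h g≢h
              (in-common i j g hg ig jg) (in-common i j h hh ih jh))
            λ i e → ≤-trans (≤-reflexive (sym (proj₂ (proj₂ stars i (B′⊑B i e))))) (card-mono {U = S i} {H′ ∩ adj i} λ v h →
              ∧-intro (S⊑H′ i e v h) (nbA⊑adj i v (S⊑nbA i (B′⊑B i e) v h))))
            where
            in-common : ∀ i j g → H′ g ≡ true → adj i g ≡ true → adj j g ≡ true → (common i j ∩ A) g ≡ true
            in-common i j g hg ig jg = ∧-intro (∧-intro (∧-intro (∧ˡ (H g) (H′⊑H₁ g hg)) ig) jg) (∧ʳ (H g) (H′⊑H₁ g hg))

    single-scale-case : ⊥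
    single-scale-case = second round₁
      where
      second : _ → ⊥
      second (A , found) = third round₂
        where
        open Round₂ A found
        third : (Σ (Subset N) λ B → B ⊑ good A × (∀ u v → B u ≡ true → B v ≡ true → conf A u v ≡ false) ×
          2 * Q * edges adj B B + 2 * (y * y) * card (H ∩ A) < Q * y * card B) → ⊥
        third (B , B⊑G , free , many) = Round₃.absurd B B⊑G free many

-- The forbidden pattern: points and lines of a grid

card-≥-injection : ∀ {a n} (f : Fin a → Fin n) (U : Subset n) → Injective _≡_ _≡_ f → (∀ i → U (f i) ≡ true) → a ≤ card U
card-≥-injection {a} {n} f U inj inside = begin
  a ≡⟨ trans (sum-const a 1) (*-identityʳ a) ⟨
  ∑[ i < a ] 1 ≡⟨ sum-cong a (λ i → card-single (f i)) ⟨
  ∑[ i < a ] card (single (f i)) ≡⟨ sum-swap a n (λ i v → ⟦ single (f i) v ⟧) ⟩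
  ∑[ v < n ] card (λ i → single (f i) v) ≤⟨ sum-mono n fibre ⟩
  card U ∎
  where
  open ≤-Reasoning
  fibre : ∀ v → card (λ i → single (f i) v) ≤ ⟦ U v ⟧
  fibre v = by-cases (card (λ i → single (f i) v) ≟ 0)
    where
    by-cases : Dec (card (λ i → single (f i) v) ≡ 0) → card (λ i → single (f i) v) ≤ ⟦ U v ⟧
    by-cases (yes z) = ≤-trans (≤-reflexive z) z≤n
    by-cases (no nz) = from-witness (card>0⇒∃ {U = λ i → single (f i) v} (n≢0⇒n>0 nz))
      where
      from-witness : (∃ λ i → single (f i) v ≡ true) → card (λ i → single (f i) v) ≤ ⟦ U v ⟧
      from-witness (i , e) = ≤-trans (≤-trans (card-mono {U = λ j → single (f j) v} {single i} λ j e′ →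
          dec-true (i F.≟ j) (inj (trans (dec-proof (f i F.≟ v) e) (sym (dec-proof (f j F.≟ v) e′)))))
        (≤-reflexive (card-single i)))
        (≤-reflexive (cong ⟦_⟧ (sym (trans (cong U (sym (dec-proof (f i F.≟ v) e))) (inside i)))))

image : ∀ {a n} → (Fin a → Fin n) → Subset n
image f v = some (λ i → single (f i) v)

image-∋ : ∀ {a n} (f : Fin a → Fin n) i → image f (f i) ≡ true
image-∋ f i = dec-true (any? (λ j → single (f j) (f i) B.≟ true)) (i , dec-true (f i F.≟ f i) refl)

image-∈ : ∀ {a n} (f : Fin a → Fin n) v → image f v ≡ true → ∃ λ i → f i ≡ v
image-∈ f v e = proj₁ w , dec-proof (f (proj₁ w) F.≟ v) (proj₂ w)
  where w = some-∃ (λ i → single (f i) v) e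

card-image-≤ : ∀ {a n} (f : Fin a → Fin n) → card (image f) ≤ a
card-image-≤ {a} {n} f = begin
  card (image f) ≤⟨ sum-mono n (λ v → ⟦⟧-≤ {image f v} λ e →
    ∈⇒card>0 {U = λ i → single (f i) v} (proj₂ (some-∃ (λ i → single (f i) v) e))) ⟩
  ∑[ v < n ] card (λ i → single (f i) v) ≡⟨ sum-swap a n (λ i v → ⟦ single (f i) v ⟧) ⟨
  ∑[ i < a ] card (single (f i)) ≡⟨ sum-cong a (λ i → card-single (f i)) ⟩
  ∑[ i < a ] 1 ≡⟨ trans (sum-const a 1) (*-identityʳ a) ⟩
  a ∎
  where open ≤-Reasoning

slope-unique-< : ∀ m m′ c c′ x x′ → x < x′ → m * x + c ≡ m′ * x + c′ → m * x′ + c ≡ m′ * x′ + c′ → m ≡ m′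
slope-unique-< m m′ c c′ x x′ l h h′ with m≤n⇒∃[o]m+o≡n l
... | d , refl = *-cancelʳ-≡ m m′ (suc d) (+-cancelˡ-≡ (m * x + c) _ _ (trans (expand m x d c)
    (trans h′ (trans (sym (expand m′ x d c′)) (cong (_+ m′ * suc d) (sym h))))))
  where
  expand : ∀ m x d c → m * x + c + m * (1 + d) ≡ m * (1 + x + d) + c
  expand = solve-∀

slope-unique : ∀ m m′ c c′ x x′ → x ≢ x′ → m * x + c ≡ m′ * x + c′ → m * x′ + c ≡ m′ * x′ + c′ → m ≡ m′
slope-unique m m′ c c′ x x′ x≢x′ h h′ with <-cmp x x′
... | tri< l _ _ = slope-unique-< m m′ c c′ x x′ l h h′
... | tri≈ _ e _ = ⊥-elim (x≢x′ e)
... | tri> _ _ l = slope-unique-< m m′ c c′ x′ x l h′ h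

-- Incidences between the lines y = m x + c (m < 2κ, c < 4κ²) and the points (x , y) (x < κ, y < 6κ²):
-- κ points on each line, 8κ³ lines, 6κ³ points.
module Incidence (κ : ℕ) .⦃ _ : NonZero κ ⦄ where

  Line Point : Set
  Line = Fin (2 * κ * (4 * (κ * κ)))
  Point = Fin (κ * (6 * (κ * κ)))

  slope intercept : Line → ℕ
  slope i = toℕ (proj₁ (remQuot {2 * κ} (4 * (κ * κ)) i))
  intercept i = toℕ (proj₂ (remQuot {2 * κ} (4 * (κ * κ)) i))

  xcoord ycoord : Point → ℕ
  xcoord j = toℕ (proj₁ (remQuot {κ} (6 * (κ * κ)) j))
  ycoord j = toℕ (proj₂ (remQuot {κ} (6 * (κ * κ)) j))

  incident : Line → Point → Bool
  incident i j = does (slope i * xcoord j + intercept i ≟ ycoord j)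

  line-≡ : ∀ i i′ → slope i ≡ slope i′ → intercept i ≡ intercept i′ → i ≡ i′
  line-≡ i i′ p q = trans (sym (combine-remQuot {2 * κ} (4 * (κ * κ)) i))
    (trans (cong₂ combine (toℕ-injective p) (toℕ-injective q)) (combine-remQuot {2 * κ} (4 * (κ * κ)) i′))

  point-≡ : ∀ j j′ → xcoord j ≡ xcoord j′ → ycoord j ≡ ycoord j′ → j ≡ j′
  point-≡ j j′ p q = trans (sym (combine-remQuot {κ} (6 * (κ * κ)) j))
    (trans (cong₂ combine (toℕ-injective p) (toℕ-injective q)) (combine-remQuot {κ} (6 * (κ * κ)) j′))

  linear : ∀ i i′ j j′ → i ≢ i′ → j ≢ j′ → incident i j ≡ true → incident i j′ ≡ true →
    incident i′ j ≡ true → incident i′ j′ ≡ true → ⊥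
  linear i i′ j j′ i≢i′ j≢j′ ij ij′ i′j i′j′ = i≢i′ (line-≡ i i′ same-slope same-intercept)
    where
    on : ∀ i j → incident i j ≡ true → slope i * xcoord j + intercept i ≡ ycoord j
    on i j = dec-proof (slope i * xcoord j + intercept i ≟ ycoord j)
    x≢x′ : xcoord j ≢ xcoord j′
    x≢x′ e = j≢j′ (point-≡ j j′ e (trans (sym (on i j ij)) (trans (cong (λ x → slope i * x + intercept i) e) (on i j′ ij′))))
    same-slope : slope i ≡ slope i′
    same-slope = slope-unique (slope i) (slope i′) (intercept i) (intercept i′) (xcoord j) (xcoord j′) x≢x′
      (trans (on i j ij) (sym (on i′ j i′j))) (trans (on i j′ ij′) (sym (on i′ j′ i′j′)))
    same-intercept : intercept i ≡ intercept i′
    same-intercept = +-cancelˡ-≡ (slope i * xcoord j) _ _ (trans (on i j ij)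
      (trans (sym (on i′ j i′j)) (cong (λ m → m * xcoord j + intercept i′) (sym same-slope))))

  -- The reason for the range of y: no point of a line leaves the grid, so every line has its full
  -- `κ` points.
  height< : ∀ i (x : Fin κ) → slope i * toℕ x + intercept i < 6 * (κ * κ)
  height< i x = begin-strict
    slope i * toℕ x + intercept i <⟨ +-mono-≤-< (*-mono-≤ (<⇒≤ (toℕ<n (proj₁ (remQuot {2 * κ} (4 * (κ * κ)) i)))) (<⇒≤ (toℕ<n x)))
                                         (toℕ<n (proj₂ (remQuot {2 * κ} (4 * (κ * κ)) i))) ⟩
    2 * κ * κ + 4 * (κ * κ) ≡⟨ total κ ⟩
    6 * (κ * κ) ∎
    where
    open ≤-Reasoning
    total : ∀ κ → 2 * κ * κ + 4 * (κ * κ) ≡ 6 * (κ * κ)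
    total = solve-∀

  pointOn : Line → Fin κ → Point
  pointOn i x = combine x (fromℕ< (height< i x))

  pointOn-incident : ∀ i x → incident i (pointOn i x) ≡ true
  pointOn-incident i x = dec-true (slope i * xcoord (pointOn i x) + intercept i ≟ ycoord (pointOn i x)) (trans
    (cong (λ p → slope i * toℕ (proj₁ p) + intercept i) (remQuot-combine x (fromℕ< (height< i x))))
    (trans (sym (toℕ-fromℕ< (height< i x))) (cong (toℕ ∘ proj₂) (sym (remQuot-combine x (fromℕ< (height< i x)))))))

  pointOn-injective : ∀ i → Injective _≡_ _≡_ (pointOn i)
  pointOn-injective i {x} {x′} e = trans (sym (cong proj₁ (remQuot-combine x (fromℕ< (height< i x)))))
    (trans (cong (λ j → proj₁ (remQuot {κ} (6 * (κ * κ)) j)) e) (cong proj₁ (remQuot-combine x′ (fromℕ< (height< i x′)))))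

  -- In a copy every line has `κ` neighbours, and there are 8κ³ lines but only 6κ³ points, whereas
  -- `no-C₄-free` allows no more centres than leaves.
  no-copy : ∀ {N} (adj : Rel N) → (∀ u → adj u u ≡ false) →
    (∀ B H → Independent adj B → Independent adj H → C₄-free adj B H →
      (∀ i → B i ≡ true → κ ≤ card (H ∩ adj i)) → card B ≤ card H) → ¬ InducedCopy adj incident
  no-copy {N} adj irr no-C₄-free copy = <⇒≱ fewer-points (≤-trans
      (card-≥-injection f (image f) f-injective (image-∋ f))
      (≤-trans (no-C₄-free (image f) (image g) (independent f f-apart) (independent g g-apart) free line-degree) (card-image-≤ g)))
    where
    open InducedCopy copy
    fewer-points : κ * (6 * (κ * κ)) < 2 * κ * (4 * (κ * κ))
    fewer-points = subst₂ _<_ (e₁ κ) (e₂ κ) (*-monoˡ-< (κ * (κ * κ)) ⦃ m*n≢0 κ (κ * κ) ⦃ it ⦄ ⦃ m*n≢0 κ κ ⦄ ⦄ {6} {8} (m≤n+m 7 1))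
      where
      e₁ : ∀ κ → 6 * (κ * (κ * κ)) ≡ κ * (6 * (κ * κ))
      e₁ = solve-∀
      e₂ : ∀ κ → 8 * (κ * (κ * κ)) ≡ 2 * κ * (4 * (κ * κ))
      e₂ = solve-∀
    injective : ∀ {a} (h : Fin a → Fin N) → (∀ i j → i ≢ j → apart adj (h i) (h j) ≡ true) → Injective _≡_ _≡_ h
    injective h h-apart {i} {j} e with i F.≟ j
    ... | yes p = p
    ... | no p = ⊥-elim (apart⇒≢ adj (h i) (h j) (h-apart i j p) e)
    f-injective : Injective _≡_ _≡_ f
    f-injective = injective f f-apart
    independent : ∀ {a} (h : Fin a → Fin N) → (∀ i j → i ≢ j → apart adj (h i) (h j) ≡ true) → Independent adj (image h)
    independent h h-apart u v hu hv with image-∈ h u hu | image-∈ h v hv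
    ... | i , refl | j , refl with i F.≟ j
    ... | yes refl = irr (h i)
    ... | no i≢j = apart⇒nonadj adj (h i) (h j) (h-apart i j i≢j)
    incident⁻ : ∀ i j → adj (f i) (g j) ≡ true → incident i j ≡ true
    incident⁻ i j e with incident i j in eq
    ... | true = refl
    ... | false = ⊥-elim (true≢false e (apart⇒nonadj adj (f i) (g j) (fg-apart i j eq)))
    free : C₄-free adj (image f) (image g)
    free u u′ v v′ hu hu′ hv hv′ u≢ v≢ uv uv′ u′v u′v′
      with image-∈ f u hu | image-∈ f u′ hu′ | image-∈ g v hv | image-∈ g v′ hv′
    ... | i , refl | i′ , refl | j , refl | j′ , refl = linear i i′ j j′ (u≢ ∘ cong f) (v≢ ∘ cong g)
      (incident⁻ i j uv) (incident⁻ i j′ uv′) (incident⁻ i′ j u′v) (incident⁻ i′ j′ u′v′)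
    line-degree : ∀ u → image f u ≡ true → κ ≤ card (image g ∩ adj u)
    line-degree u hu with image-∈ f u hu
    ... | i , refl = card-≥-injection (g ∘ pointOn i) (image g ∩ adj (f i))
      (λ e → pointOn-injective i (injective g g-apart e))
      (λ x → ∧-intro (image-∋ g (pointOn i x)) (fg-adj i (pointOn i x) (pointOn-incident i x)))

-- Induced subgraphs, and the hypothesis on bipartite graphs

induced : (G : Graph) → Subset (n G) → Graph
induced G U = record
  { n = card U
  ; adj = λ i j → adj G (enum U i) (enum U j)
  ; sym = λ i j → adj-sym G (enum U i) (enum U j)
  ; irrefl = λ i → adj-irrefl G (enum U i)
  }

induced-≤ind : ∀ G U → induced G U ≤ind G
induced-≤ind G U = enum U , enum-injective U , (λ i j → refl)

degreeSum-induced : ∀ G U → degreeSum (induced G U) ≡ edges (adj G) U U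
degreeSum-induced G U = trans (sum-cong (card U) λ j → trans (sum-enum U (λ v → ⟦ adj G (enum U j) v ⟧))
    (sum-cong (n G) λ v → sym (⟦∧⟧ (U v) (adj G (enum U j) v))))
  (sum-enum U (λ u → card (U ∩ adj G u)))

induced-Kss : ∀ G U s → ContainsKss s (induced G U) → ContainsKss s G
induced-Kss G U s (f , g , f-inj , g-inj , f≢g , fg) = enum U ∘ f , enum U ∘ g ,
  (λ e → f-inj (enum-injective U e)) , (λ e → g-inj (enum-injective U e)) ,
  (λ i j e → f≢g i j (enum-injective U e)) , fg

module _ (𝒢 : Graph → Set) (hereditary : Hereditary 𝒢) (s d : ℕ)
  (bound : ∀ G → 𝒢 G → Bipartite G → ¬ ContainsKss s G → AvgDegreeAtMost G d)
  (G : Graph) (G∈ : 𝒢 G) (B H : Subset (n G)) (B-indep : Independent (adj G) B) (H-indep : Independent (adj G) H)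
  (k : ℕ) (d<k : d < k) (degree-B : ∀ i → B i ≡ true → k ≤ card (H ∩ adj G i)) where

  private
    U : Subset (n G)
    U = B ∪ H

  B-disjoint-H : ∀ v → B v ≡ true → H v ≡ true → ⊥
  B-disjoint-H v hb hh = neighbour (card>0⇒∃ {U = H ∩ adj G v} (≤-trans (≤-trans (s≤s z≤n) d<k) (degree-B v hb)))
    where
    neighbour : (∃ λ w → (H ∩ adj G v) w ≡ true) → ⊥
    neighbour (w , e) = true≢false (∧ʳ (H w) e) (H-indep v w hh (∧ˡ (H w) e))

  in-H : ∀ v → U v ≡ true → B v ≡ false → H v ≡ true
  in-H v hu hb = trans (cong (_∨ H v) (sym hb)) hu

  bipartite-sides : ∀ u v → U u ≡ true → U v ≡ true → adj G u v ≡ true → B u ≢ B v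
  bipartite-sides u v hu hv a e = by-side (B u) refl
    where
    by-side : ∀ b → B u ≡ b → ⊥
    by-side true hb = true≢false a (B-indep u v hb (trans (sym e) hb))
    by-side false hb = true≢false a (H-indep u v (in-H u hu hb) (in-H v hv (trans (sym e) hb)))

  edges-between : 2 * edges (adj G) B H ≤ edges (adj G) U U
  edges-between = begin
    2 * edges (adj G) B H ≡⟨ cong (edges (adj G) B H +_) (+-identityʳ _) ⟩
    edges (adj G) B H + edges (adj G) B H ≡⟨ cong (edges (adj G) B H +_) (edges-sym (adj G) (adj-sym G) B H) ⟩
    edges (adj G) B H + edges (adj G) H B ≡⟨ sum-+ (n G) _ _ ⟨
    ∑[ u < n G ] (⟦ B u ⟧ * card (H ∩ adj G u) + ⟦ H u ⟧ * card (B ∩ adj G u)) ≤⟨ sum-mono (n G) point ⟩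
    edges (adj G) U U ∎
    where
    open ≤-Reasoning
    widen : ∀ u (W : Subset (n G)) → W ⊑ U → card (W ∩ adj G u) ≤ card (U ∩ adj G u)
    widen u W h = card-mono {U = W ∩ adj G u} {U ∩ adj G u} λ v e → ∧-intro (h v (∧ˡ (W v) e)) (∧ʳ (W v) e)
    B⊑U : B ⊑ U
    B⊑U v e = cong (_∨ H v) e
    H⊑U : H ⊑ U
    H⊑U v e = trans (cong (B v ∨_) e) (B.∨-zeroʳ (B v))
    by-cases : ∀ a b {x y z} → (a ≡ true → b ≡ true → ⊥) → x ≤ z → y ≤ z → ⟦ a ⟧ * x + ⟦ b ⟧ * y ≤ ⟦ a ∨ b ⟧ * z
    by-cases true true h _ _ = ⊥-elim (h refl refl)
    by-cases true false h p _ = ≤-trans (≤-reflexive (+-identityʳ _)) (*-monoʳ-≤ 1 p)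
    by-cases false true h _ p = *-monoʳ-≤ 1 p
    by-cases false false h _ _ = z≤n
    point : ∀ u → ⟦ B u ⟧ * card (H ∩ adj G u) + ⟦ H u ⟧ * card (B ∩ adj G u) ≤ ⟦ U u ⟧ * card (U ∩ adj G u)
    point u = by-cases (B u) (H u) (B-disjoint-H u) (widen u H H⊑U) (widen u B B⊑U)

  -- If `B` were larger than `H`, their union would have fewer than 2|B| vertices and at least k|B|
  -- edges, so an average degree above d. All extractions contradict the hypothesis in this form.
  bipartite-balance : ¬ ContainsKss s (induced G U) → card B ≤ card H
  bipartite-balance no-K = ≮⇒≥ λ fewer → <⇒≱ (too-many fewer)
    (≤-trans (*-monoʳ-≤ 2 many-edges) (≤-trans edges-between (≤-trans (≤-reflexive (sym (degreeSum-induced G U)))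
      (bound (induced G U) (hereditary G (induced G U) (induced-≤ind G U) G∈)
        (B ∘ enum U , λ i j → bipartite-sides (enum U i) (enum U j) (enum-∈ U i) (enum-∈ U j)) no-K))))
    where
    many-edges : card B * k ≤ edges (adj G) B H
    many-edges = ≤-trans (≤-reflexive (sym (sum-*ʳ (n G) k _))) (sum-mono (n G) λ i → ⟦⟧*-≤ (B i) (degree-B i))
    too-many : card H < card B → d * card U < 2 * (card B * k)
    too-many fewer = begin-strict
      d * card U ≤⟨ *-monoʳ-≤ d (card-∪-≤ B H) ⟩
      d * (card B + card H) ≤⟨ *-monoʳ-≤ d (+-monoʳ-≤ (card B) (<⇒≤ fewer)) ⟩
      d * (card B + card B) ≡⟨ double d (card B) ⟩
      2 * card B * d <⟨ *-monoʳ-< (2 * card B) ⦃ m*n≢0 2 (card B) ⦃ _ ⦄ ⦃ >-nonZero (≤-<-trans z≤n fewer) ⦄ ⦄ d<k ⟩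
      2 * card B * k ≡⟨ *-assoc 2 (card B) k ⟩
      2 * (card B * k) ∎
      where
      open ≤-Reasoning
      double : ∀ d b → d * (b + b) ≡ 2 * b * d
      double = solve-∀

  -- Adjacent vertices lie on opposite sides, so the side of `a zero` determines that of the other
  -- three; the two cases exchange the parts played by `f` and `g`.
  C₄-free⇒no-K₂₂ : C₄-free (adj G) B H → ¬ ContainsKss 2 (induced G U)
  C₄-free⇒no-K₂₂ free (f , g , f-inj , g-inj , _ , fg) = by-side (B (a zero)) refl
    where
    a b : Fin 2 → Fin (n G)
    a = enum U ∘ f
    b = enum U ∘ g
    a₀≢a₁ : a zero ≢ a (suc zero)
    a₀≢a₁ e with f-inj (enum-injective U e)
    ... | ()
    b₀≢b₁ : b zero ≢ b (suc zero)
    b₀≢b₁ e with g-inj (enum-injective U e)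
    ... | ()
    ab : ∀ i j → B (a i) ≢ B (b j)
    ab i j = bipartite-sides (a i) (b j) (enum-∈ U (f i)) (enum-∈ U (g j)) (fg i j)
    opposite : ∀ {x y c} → x ≢ y → x ≡ c → y ≡ not c
    opposite {true} {true} h refl = ⊥-elim (h refl)
    opposite {true} {false} h refl = refl
    opposite {false} {true} h refl = refl
    opposite {false} {false} h refl = ⊥-elim (h refl)
    ba : ∀ i j → adj G (b j) (a i) ≡ true
    ba i j = trans (adj-sym G (b j) (a i)) (fg i j)
    by-side : ∀ c → B (a zero) ≡ c → ⊥
    by-side true e = free (a zero) (a (suc zero)) (b zero) (b (suc zero)) e
      (opposite (λ p → ab (suc zero) zero (sym p)) (opposite (ab zero zero) e))
      (in-H (b zero) (enum-∈ U (g zero)) (opposite (ab zero zero) e))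
      (in-H (b (suc zero)) (enum-∈ U (g (suc zero))) (opposite (ab zero (suc zero)) e))
      a₀≢a₁ b₀≢b₁ (fg zero zero) (fg zero (suc zero)) (fg (suc zero) zero) (fg (suc zero) (suc zero))
    by-side false e = free (b zero) (b (suc zero)) (a zero) (a (suc zero))
      (opposite (ab zero zero) e) (opposite (ab zero (suc zero)) e)
      (in-H (a zero) (enum-∈ U (f zero)) e)
      (in-H (a (suc zero)) (enum-∈ U (f (suc zero))) (opposite (λ p → ab (suc zero) zero (sym p)) (opposite (ab zero zero) e)))
      b₀≢b₁ a₀≢a₁ (ba zero zero) (ba (suc zero) zero) (ba zero (suc zero)) (ba (suc zero) (suc zero))

-- Choice of parameters, and the contradiction

multiple-between : ∀ a b .⦃ _ : NonZero b ⦄ → ∃ λ x → a ≤ b * suc x × b * suc x ≤ a + b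
multiple-between a b = a / b , (begin
    a ≡⟨ m≡m%n+[m/n]*n a b ⟩
    a % b + a / b * b ≤⟨ +-monoˡ-≤ (a / b * b) (<⇒≤ (m%n<n a b)) ⟩
    b + a / b * b ≡⟨ *-comm (suc (a / b)) b ⟩
    b * suc (a / b) ∎) , (begin
    b * suc (a / b) ≡⟨ *-comm b (suc (a / b)) ⟩
    b + a / b * b ≤⟨ +-monoʳ-≤ b (≤-trans (m≤n+m (a / b * b) (a % b)) (≤-reflexive (sym (m≡m%n+[m/n]*n a b)))) ⟩
    b + a ≡⟨ +-comm b a ⟩
    a + b ∎)
  where open ≤-Reasoning

module Powers (l : ℕ) (12≤l : 12 ≤ l) where

  instance
    l≢0 : NonZero l
    l≢0 = >-nonZero (≤-trans (s≤s z≤n) 12≤l)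

  pow-mono : ∀ a b → a ≤ b → l ^ a ≤ l ^ b
  pow-mono a b = ^-monoʳ-≤ l

  pow-+ : ∀ a b → l ^ (a + b) ≡ l ^ a * l ^ b
  pow-+ = ^-distribˡ-+-* l

  -- Numerical constants are paid for in exponents: since l ≥ 12, a constant up to 12^j costs `j`
  -- powers of `l`.
  absorb : ∀ c j a b → c ≤ 12 ^ j → j + a ≤ b → c * l ^ a ≤ l ^ b
  absorb c j a b hc h = begin
    c * l ^ a ≤⟨ *-monoˡ-≤ (l ^ a) (≤-trans hc (^-monoˡ-≤ j 12≤l)) ⟩
    l ^ j * l ^ a ≡⟨ pow-+ j a ⟨
    l ^ (j + a) ≤⟨ pow-mono (j + a) b h ⟩
    l ^ b ∎
    where open ≤-Reasoning

by-slack : ∀ {a b} c → b ≡ a + c → a ≤ b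
by-slack c refl = m≤m+n _ c

full : ∀ {N} → Subset N
full _ = true

card-full : ∀ N → card {N} full ≡ N
card-full N = trans (sum-const N 1) (*-identityʳ N)

-- D = l ^ (X + r + 1), the sampling rate on H is l ^ -X, density l ^ -e is forced on sets of size l ^ μ,
-- and l ^ (al + 2) scales are available.
module Contradiction {N : ℕ} (adj : Rel N) (irr : ∀ u → adj u u ≡ false) (adj-sym : ∀ u v → adj u v ≡ adj v u)
  (l : ℕ) (12≤l : 12 ≤ l) (κ k al r g e μ X E : ℕ) .⦃ κ≢0 : NonZero κ ⦄ .⦃ k≢0 : NonZero k ⦄
  (r≡ : r ≡ al + 3) (g≡ : g ≡ (2 * r + 6) * κ) (e≡ : e ≡ g + 2 * r + 6) (X≡ : X ≡ e + μ) (E≡ : E ≡ X + r + al + 2)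
  (l-κ : 16 * 2 ^ κ ≤ l) (l-E : 2 * E + 3 ≤ l) (k≤ : k ≤ l ^ al)
  (no-C₄-free : ∀ B H → Independent adj B → Independent adj H → C₄-free adj B H →
    (∀ i → B i ≡ true → κ ≤ card (H ∩ adj i)) → card B ≤ card H)
  (no-bipartite : ∀ B H → Independent adj B → Independent adj H →
    (∀ i → B i ≡ true → k ≤ card (H ∩ adj i)) → card B ≤ card H)
  (sparse : ∀ P Y → l ^ μ ≤ card P → l ^ μ ≤ card Y → l ^ e * edges adj Y P < card P * card Y)
  (N>0 : 0 < N) (min-degree : ∀ v → l ^ (X + (r + 1)) ≤ 2 * card (adj v))
  (density : ∀ U → edges adj U U ≤ 2 * l ^ (X + (r + 1)) * card U) where

  open Powers l 12≤l
  open ≤-Reasoning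

  private
    D Q₁ : ℕ
    D = l ^ (X + (r + 1))
    Q₁ = l ^ X

  instance
    D≢0 : NonZero D
    D≢0 = m^n≢0 l (X + (r + 1))

  orient : Orientation adj (2 * D) full
  orient = orientation adj adj-sym (2 * D) density (card {N} full) full refl

  o : Rel N
  o = proj₁ orient

  o-covers : ∀ u v → adj u v ≡ true → o u v ≡ true ⊎ o v u ≡ true
  o-covers u v = proj₁ (proj₂ orient) u v refl refl

  o⊑adj : ∀ u v → o u v ≡ true → adj u v ≡ true
  o⊑adj = proj₁ (proj₂ (proj₂ orient))

  o-out : ∀ u → card (o u) ≤ 2 * D
  o-out = proj₂ (proj₂ (proj₂ orient))

  open Scales adj adj-sym D l (l ^ (X + 1))

  I₀ : Subset N
  I₀ v = does (card (adj v) ≤? 4 * D)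

  -- The average degree is at most 2D, so at most half of the vertices have degree above 4D.
  N≤2I₀ : N ≤ 2 * card I₀
  N≤2I₀ = +-cancelʳ-≤ (2 * card (not ∘ I₀)) _ _ (begin
    N + 2 * card (not ∘ I₀) ≤⟨ +-monoʳ-≤ N few-high ⟩
    N + N ≡⟨ cong₂ _+_ N-split N-split ⟩
    (x + y) + (x + y) ≡⟨ double x y ⟩
    2 * card I₀ + 2 * card (not ∘ I₀) ∎)
    where
    x y : ℕ
    x = card I₀
    y = card (not ∘ I₀)
    double : ∀ x y → x + y + (x + y) ≡ 2 * x + 2 * y
    double = solve-∀
    N-split : N ≡ card I₀ + card (not ∘ I₀)
    N-split = trans (sym (card-full N)) (card-split full I₀)
    few-high : 2 * card (not ∘ I₀) ≤ N
    few-high = *-cancelˡ-≤ (2 * D) ⦃ m*n≢0 2 D ⦄ (begin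
      2 * D * (2 * card (not ∘ I₀)) ≡⟨ regroup D (card (not ∘ I₀)) ⟩
      card (not ∘ I₀) * (4 * D) ≡⟨ sum-*ʳ N (4 * D) _ ⟨
      ∑[ v < N ] (⟦ not (I₀ v) ⟧ * (4 * D)) ≤⟨ sum-mono N (λ v → ⟦⟧*≤ (not (I₀ v)) λ h →
        ≤-trans (<⇒≤ (≰⇒> (dec-disproof (card (adj v) ≤? 4 * D) (not-true h)))) (≤-reflexive (sym (*-identityˡ (card (adj v)))))) ⟩
      edges adj full full ≤⟨ density full ⟩
      2 * D * card {N} full ≡⟨ cong (2 * D *_) (card-full N) ⟩
      2 * D * N ∎)
      where
      regroup : ∀ D y → 2 * D * (2 * y) ≡ y * (4 * D)
      regroup = solve-∀

  -- The number of rounds. Together they consume J · l^(X + 1) = l^(X + r) neighbours, and as many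
  -- are left for the unbalanced case. The growth l^J has to beat (l^E)^k, where `k` may be as large
  -- as l^al.
  J : ℕ
  J = l ^ (al + 2)

  J-steps : J * l ^ (X + 1) ≡ l ^ (X + r)
  J-steps = trans (sym (pow-+ (al + 2) (X + 1))) (cong (l ^_) (trans (exponent al X) (cong (X +_) (sym r≡))))
    where
    exponent : ∀ al X → al + 2 + (X + 1) ≡ X + (al + 3)
    exponent = solve-∀

  start-degree : ∀ v → l ^ (X + r) + J * l ^ (X + 1) ≤ card (full ∩ adj v)
  start-degree v = *-cancelˡ-≤ 2 (begin
    2 * (l ^ (X + r) + J * l ^ (X + 1)) ≡⟨ cong (λ x → 2 * (l ^ (X + r) + x)) J-steps ⟩
    2 * (l ^ (X + r) + l ^ (X + r)) ≡⟨ double (l ^ (X + r)) ⟩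
    4 * l ^ (X + r) ≤⟨ absorb 4 1 (X + r) (X + (r + 1)) (m≤n+m 4 8) (by-slack 0 (exponent X r)) ⟩
    D ≤⟨ min-degree v ⟩
    2 * card (adj v) ∎)
    where
    double : ∀ x → 2 * (x + x) ≡ 4 * x
    double = solve-∀
    exponent : ∀ X r → X + (r + 1) ≡ 1 + (X + r) + 0
    exponent = solve-∀

  dichotomy : SingleScale ⊎ Unbalanced (1 * l ^ J) (l ^ (X + r))
  dichotomy = scales J I₀ full 1 (l ^ (X + r)) (λ i h → dec-proof (card (adj i) ≤? 4 * D) h)
    (half-positive N≤2I₀)
    ≤-refl (≤-trans (≤-reflexive (trans (*-identityˡ (card {N} full)) (card-full N))) N≤2I₀)
    (λ i _ → start-degree i)
    where
    half-positive : ∀ {x} → N ≤ 2 * x → 0 < x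
    half-positive {zero} h = ⊥-elim (<⇒≱ N>0 h)
    half-positive {suc x} h = s≤s z≤n

  m>0 : 0 < l ^ μ
  m>0 = m^n>0 l μ

  no-unbalanced : Unbalanced (1 * l ^ J) (l ^ (X + r)) → ⊥
  no-unbalanced (I , H , bounded , I>0 , ratio , deg) = unbalanced-case adj irr adj-sym D o o-covers o⊑adj o-out
    -- `u` = 4 l^(μ + r + 1) is exactly 4D / l^e, the cost of one greedy choice inside a
    -- neighbourhood.
    (l ^ e) (l ^ μ) m>0 sparse k no-bipartite (pred (l ^ E)) (4 * l ^ (μ + (r + 1))) (l ^ (X + r)) (1 * l ^ J) I H bounded I>0 ratio deg
    (≤-reflexive large-u) small-u
    (subst (4 * D * k ≤_) (sym suc-q) large-Q)
    (subst (λ Q → 64 * D * Q ^ k < 1 * l ^ J) (sym suc-q) large-w)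
    where
    suc-q : suc (pred (l ^ E)) ≡ l ^ E
    suc-q = suc-pred (l ^ E) ⦃ m^n≢0 l E ⦄
    large-u : 4 * D ≡ l ^ e * (4 * l ^ (μ + (r + 1)))
    large-u = trans (cong (4 *_) (trans (cong (l ^_) (trans (cong (_+ (r + 1)) X≡) (+-assoc e μ (r + 1)))) (pow-+ e (μ + (r + 1)))))
      (x∙yz≈y∙xz 4 (l ^ e) _)
    small-u : l ^ μ + k * (4 * l ^ (μ + (r + 1))) ≤ l ^ (X + r)
    small-u = begin
      l ^ μ + k * (4 * l ^ (μ + (r + 1)))
        ≤⟨ +-mono-≤ (pow-mono μ (al + (μ + (r + 1))) (by-slack (al + (r + 1)) (exp₁ al μ r))) (*-monoˡ-≤ (4 * l ^ (μ + (r + 1))) k≤) ⟩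
      l ^ (al + (μ + (r + 1))) + l ^ al * (4 * l ^ (μ + (r + 1)))
        ≡⟨ cong (_+ l ^ al * (4 * l ^ (μ + (r + 1)))) (pow-+ al (μ + (r + 1))) ⟩
      l ^ al * l ^ (μ + (r + 1)) + l ^ al * (4 * l ^ (μ + (r + 1)))
        ≡⟨ five (l ^ al) (l ^ (μ + (r + 1))) ⟩
      5 * (l ^ al * l ^ (μ + (r + 1)))
        ≡⟨ cong (5 *_) (pow-+ al (μ + (r + 1))) ⟨
      5 * l ^ (al + (μ + (r + 1)))
        ≤⟨ absorb 5 1 (al + (μ + (r + 1))) (X + r) (m≤n+m 5 7)
             (by-slack (g + r + 1 + 6) (trans (cong (_+ r) (trans X≡ (cong (_+ μ) e≡))) (trans (exp₂ g r μ) (trans (cong (λ z → g + r + z + 6 + μ + r) r≡) (exp₃ g r al μ))))) ⟩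
      l ^ (X + r) ∎
      where
      exp₁ : ∀ al μ r → al + (μ + (r + 1)) ≡ μ + (al + (r + 1))
      exp₁ = solve-∀
      exp₂ : ∀ g r μ → g + 2 * r + 6 + μ + r ≡ g + r + r + 6 + μ + r
      exp₂ = solve-∀
      exp₃ : ∀ g r al μ → g + r + (al + 3) + 6 + μ + r ≡ 1 + (al + (μ + (r + 1))) + (g + r + 1 + 6)
      exp₃ = solve-∀
      five : ∀ a b → a * b + a * (4 * b) ≡ 5 * (a * b)
      five = solve-∀
    large-Q : 4 * D * k ≤ l ^ E
    large-Q = begin
      4 * D * k ≤⟨ *-monoʳ-≤ (4 * D) k≤ ⟩
      4 * D * l ^ al ≡⟨ trans (*-assoc 4 D (l ^ al)) (cong (4 *_) (sym (pow-+ (X + (r + 1)) al))) ⟩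
      4 * l ^ (X + (r + 1) + al) ≤⟨ absorb 4 1 (X + (r + 1) + al) E (m≤n+m 4 8) (by-slack 0 (trans E≡ (exponent X r al))) ⟩
      l ^ E ∎
      where
      exponent : ∀ X r al → X + r + al + 2 ≡ 1 + (X + (r + 1) + al) + 0
      exponent = solve-∀
    large-w : 64 * D * (l ^ E) ^ k < 1 * l ^ J
    large-w = begin-strict
      64 * D * (l ^ E) ^ k ≡⟨ cong (64 * D *_) (^-*-assoc l E k) ⟩
      64 * D * l ^ (E * k) ≡⟨ trans (*-assoc 64 D _) (cong (64 *_) (sym (pow-+ (X + (r + 1)) (E * k)))) ⟩
      64 * l ^ (X + (r + 1) + E * k) <⟨ *-monoˡ-< (l ^ (X + (r + 1) + E * k)) ⦃ m^n≢0 l (X + (r + 1) + E * k) ⦄ {64} {144} (from-yes (64 <? 144)) ⟩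
      144 * l ^ (X + (r + 1) + E * k) ≤⟨ absorb 144 2 (X + (r + 1) + E * k) J ≤-refl exponents ⟩
      l ^ J ≡⟨ *-identityˡ (l ^ J) ⟨
      1 * l ^ J ∎
      where
      exp₁ : ∀ X r Ek al → X + r + al + 2 + 3 + Ek ≡ 2 + (X + (r + 1) + Ek) + (al + 2)
      exp₁ = solve-∀
      exp₂ : ∀ E y → (E + 3) * y + E * y ≡ (2 * E + 3) * y
      exp₂ = solve-∀
      -- Here `k` multiplies an exponent, so a fixed number of rounds would not do; 2E + 3 ≤ l lets
      -- one further power of `l` cover the factor E.
      exponents : 2 + (X + (r + 1) + E * k) ≤ J
      exponents = begin
        2 + (X + (r + 1) + E * k) ≤⟨ by-slack (al + 2) (trans (cong (λ z → z + 3 + E * k) E≡) (exp₁ X r (E * k) al)) ⟩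
        E + 3 + E * k ≤⟨ +-mono-≤ (m≤m*n (E + 3) (l ^ al) ⦃ m^n≢0 l al ⦄) (*-monoʳ-≤ E k≤) ⟩
        (E + 3) * l ^ al + E * l ^ al ≡⟨ exp₂ E (l ^ al) ⟩
        (2 * E + 3) * l ^ al ≤⟨ *-monoˡ-≤ (l ^ al) l-E ⟩
        l ^ (1 + al) ≤⟨ pow-mono (1 + al) (al + 2) (by-slack 1 (exp₃ al)) ⟩
        J ∎
        where
        exp₃ : ∀ al → al + 2 ≡ 1 + al + 1
        exp₃ = solve-∀

  D≡ : D ≡ Q₁ * l ^ (r + 1)
  D≡ = pow-+ X (r + 1)

  D²≡ : D * D ≡ l ^ (2 * r + 2) * (Q₁ * Q₁)
  D²≡ = trans (cong₂ _*_ D≡ D≡) (trans (regroup Q₁ (l ^ (r + 1))) (cong (_* (Q₁ * Q₁))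
    (trans (sym (pow-+ (r + 1) (r + 1))) (cong (l ^_) (exponent r)))))
    where
    regroup : ∀ a b → a * b * (a * b) ≡ b * b * (a * a)
    regroup = solve-∀
    exponent : ∀ r → r + 1 + (r + 1) ≡ 2 * r + 2
    exponent = solve-∀

  -- The scale of sampled degrees is D / Q₁ = l^(r + 1). Writing D² as l^(2r + 2) Q₁² cancels X, so
  -- the quadratic estimates compare exponents in r and g only.
  square-bound : ∀ c j x → c ≤ 12 ^ j → j + (2 * r + 2) ≤ x → c * (D * D) ≤ l ^ x * (Q₁ * Q₁)
  square-bound c j x hc hx = begin
    c * (D * D) ≡⟨ cong (c *_) D²≡ ⟩
    c * (l ^ (2 * r + 2) * (Q₁ * Q₁)) ≡⟨ *-assoc c _ _ ⟨
    c * l ^ (2 * r + 2) * (Q₁ * Q₁) ≤⟨ *-monoˡ-≤ (Q₁ * Q₁) (absorb c j (2 * r + 2) x hc hx) ⟩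
    l ^ x * (Q₁ * Q₁) ∎

  -- The centres are sampled at rate 1/(1 + qI), tied to the degrees from `H` into `I` by l^g (1 +
  -- qI) ≥ 16 D l |I| / L. The later rate 1/(1 + q₂) is tied to the degrees inside `I` by
  -- `q₂-lower`. The upper bounds limit the loss by rounding and enter `num₇`.
  module _ (I H : Subset N) (L : ℕ) (bounded : Bounded I) (I>0 : 0 < card I) (H≤L : card H ≤ L) (L≤4I : L ≤ 4 * card I)
    (deg-I : ∀ i → I i ≡ true → l ^ (X + 1) ≤ card (H ∩ adj i))
    (deg-H : ∀ h → H h ≡ true → L * card (I ∩ adj h) ≤ 16 * D * l * card I)
    .⦃ L≢0 : NonZero L ⦄ (qI : ℕ)
    (qI-lower : 16 * D * l * card I ≤ L * l ^ g * suc qI) (qI-upper : L * l ^ g * suc qI ≤ 16 * D * l * card I + L * l ^ g)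
    (q₂ : ℕ) (q₂-lower : 64 * D ≤ suc qI * l ^ g * suc q₂) (q₂-upper : suc qI * l ^ g * suc q₂ ≤ 64 * D + suc qI * l ^ g)
    (q₁ q : ℕ) (q₁≡ : suc q₁ ≡ Q₁) (q≡ : suc q ≡ l ^ (2 * r + 6)) where

    private
      Δ : ℕ
      Δ = l ^ g * suc qI

    Δ-large : 4 * D * l ≤ Δ
    Δ-large = *-cancelˡ-≤ L (begin
      L * (4 * D * l) ≤⟨ *-monoˡ-≤ (4 * D * l) L≤4I ⟩
      4 * card I * (4 * D * l) ≡⟨ regroup D l (card I) ⟩
      16 * D * l * card I ≤⟨ qI-lower ⟩
      L * l ^ g * suc qI ≡⟨ *-assoc L (l ^ g) (suc qI) ⟩
      L * Δ ∎)
      where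
      regroup : ∀ D l i → 4 * i * (4 * D * l) ≡ 16 * D * l * i
      regroup = solve-∀

    D≤Δ : D ≤ Δ
    D≤Δ = ≤-trans (≤-trans (m≤n*m D 4) (m≤m*n (4 * D) l)) Δ-large

    mt≤D : l ^ μ * l ^ e ≤ D
    mt≤D = ≤-trans (≤-reflexive (sym (pow-+ μ e))) (pow-mono (μ + e) (X + (r + 1)) (by-slack (r + 1) (cong (_+ (r + 1)) (trans X≡ (+-comm e μ)))))

    Q^κ≡ : suc q ^ κ ≡ l ^ g
    Q^κ≡ = trans (cong (_^ κ) q≡) (trans (^-*-assoc l (2 * r + 6) κ) (cong (l ^_) (sym g≡)))

    num₁ : 8 * 2 ^ κ * (1 + 2 * q₁) ≤ l ^ (X + 1)
    num₁ = begin
      8 * 2 ^ κ * (1 + 2 * q₁) ≤⟨ *-monoʳ-≤ (8 * 2 ^ κ) (by-slack 1 (odd q₁)) ⟩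
      8 * 2 ^ κ * (2 * suc q₁) ≡⟨ regroup (2 ^ κ) (suc q₁) ⟩
      16 * 2 ^ κ * suc q₁ ≤⟨ *-monoˡ-≤ (suc q₁) l-κ ⟩
      l * suc q₁ ≡⟨ cong (l *_) q₁≡ ⟩
      l ^ (1 + X) ≡⟨ cong (l ^_) (+-comm 1 X) ⟩
      l ^ (X + 1) ∎
      where
      odd : ∀ q → 2 * (1 + q) ≡ 1 + 2 * q + 1
      odd = solve-∀
      regroup : ∀ a b → 8 * a * (2 * b) ≡ 16 * a * b
      regroup = solve-∀

    num₂ : 128 * (D * D) ≤ l ^ e * (suc q₁ * suc q₁)
    num₂ = subst (λ x → 128 * (D * D) ≤ l ^ e * (x * x)) (sym q₁≡)
      (square-bound 128 2 e (m≤n+m 128 16) (by-slack (g + 2) (trans e≡ (exponent g r))))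
      where
      exponent : ∀ g r → g + 2 * r + 6 ≡ 2 + (2 * r + 2) + (g + 2)
      exponent = solve-∀

    num₃ : 64 * (D * D) ≤ l ^ (2 * r + 5) * (suc q₁ * suc q₁)
    num₃ = subst (λ x → 64 * (D * D) ≤ l ^ (2 * r + 5) * (x * x)) (sym q₁≡)
      (square-bound 64 2 (2 * r + 5) (m≤n+m 64 80) (by-slack 1 (exponent r)))
      where
      exponent : ∀ r → 2 * r + 5 ≡ 2 + (2 * r + 2) + 1
      exponent = solve-∀

    2d≤Q : 2 * l ^ (2 * r + 5) ≤ suc q
    2d≤Q = subst (2 * l ^ (2 * r + 5) ≤_) (sym q≡) (absorb 2 1 (2 * r + 5) (2 * r + 6) (m≤n+m 2 10) (by-slack 0 (exponent r)))
      where
      exponent : ∀ r → 2 * r + 6 ≡ 1 + (2 * r + 5) + 0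
      exponent = solve-∀

    -- The origin of e: l^e has to cover both the factor l^g of `Δ` and the l^(2r + 2) that D²
    -- leaves after division by Q₁².
    num₅ : 128 * (D * D) * (suc q₁ + Δ) ≤ l ^ e * (suc q₁ * suc q₁) * suc qI
    num₅ = begin
      128 * (D * D) * (suc q₁ + Δ) ≤⟨ *-monoʳ-≤ (128 * (D * D)) (+-monoˡ-≤ Δ (≤-trans (≤-reflexive q₁≡) (≤-trans (pow-mono X (X + (r + 1)) (m≤m+n X (r + 1))) D≤Δ))) ⟩
      128 * (D * D) * (Δ + Δ) ≡⟨ regroup D (l ^ g) (suc qI) ⟩
      256 * (D * D) * l ^ g * suc qI ≤⟨ *-monoˡ-≤ (suc qI) (*-monoˡ-≤ (l ^ g) (square-bound 256 3 (2 * r + 6) (m≤n+m 256 1472) (by-slack 1 (exponent₁ r)))) ⟩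
      l ^ (2 * r + 6) * (Q₁ * Q₁) * l ^ g * suc qI ≡⟨ regroup₂ (l ^ (2 * r + 6)) (Q₁ * Q₁) (l ^ g) (suc qI) ⟩
      l ^ g * l ^ (2 * r + 6) * (Q₁ * Q₁) * suc qI ≡⟨ cong (λ x → x * (Q₁ * Q₁) * suc qI) (trans (sym (pow-+ g (2 * r + 6))) (cong (l ^_) (trans (sym (+-assoc g (2 * r) 6)) (sym e≡)))) ⟩
      l ^ e * (Q₁ * Q₁) * suc qI ≡⟨ cong (λ x → l ^ e * (x * x) * suc qI) q₁≡ ⟨
      l ^ e * (suc q₁ * suc q₁) * suc qI ∎
      where
      regroup : ∀ D g q → 128 * (D * D) * (g * q + g * q) ≡ 256 * (D * D) * g * q
      regroup = solve-∀
      regroup₂ : ∀ a b c d → a * b * c * d ≡ c * a * b * d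
      regroup₂ = solve-∀
      exponent₁ : ∀ r → 2 * r + 6 ≡ 3 + (2 * r + 2) + 1
      exponent₁ = solve-∀

    num₆ : 64 * D ≤ suc q₂ * suc q ^ κ * suc qI
    num₆ = ≤-trans q₂-lower (≤-reflexive (trans (cong (λ x → suc qI * x * suc q₂) (sym Q^κ≡)) (regroup (suc qI) (suc q ^ κ) (suc q₂))))
      where
      regroup : ∀ a b c → a * b * c ≡ c * b * a
      regroup = solve-∀

    -- The cost of the sampled part of `H`, relative to |I|, is of order D l / Q₁ = l^(r + 2), which
    -- Q = l^(2r + 6) exceeds.
    num₇ : 16 * (suc qI * (suc q₂ * suc q ^ κ) * card H) ≤ suc q * card I * suc q₁
    num₇ = begin
      16 * (suc qI * (suc q₂ * suc q ^ κ) * card H)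
        ≡⟨ cong (λ x → 16 * (suc qI * (suc q₂ * x) * card H)) Q^κ≡ ⟩
      16 * (suc qI * (suc q₂ * l ^ g) * card H)
        ≡⟨ regroup₁ (suc qI) (suc q₂) (l ^ g) (card H) ⟩
      16 * (suc qI * l ^ g * suc q₂) * card H
        ≤⟨ *-mono-≤ (*-monoʳ-≤ 16 q₂-upper) H≤L ⟩
      16 * (64 * D + suc qI * l ^ g) * L
        ≡⟨ regroup₂ D (suc qI) (l ^ g) L ⟩
      1024 * D * L + 16 * (L * l ^ g * suc qI)
        ≤⟨ +-mono-≤ (*-monoʳ-≤ (1024 * D) L≤4I) (*-monoʳ-≤ 16 (≤-trans qI-upper (+-monoʳ-≤ (16 * D * l * card I) Ll^g≤))) ⟩
      1024 * D * (4 * card I) + 16 * (16 * D * l * card I + 16 * D * l * card I)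
        ≡⟨ regroup₃ D l (card I) ⟩
      D * card I * (512 * 8 + 512 * l)
        ≤⟨ *-monoʳ-≤ (D * card I) (+-monoˡ-≤ (512 * l) (*-monoʳ-≤ 512 (≤-trans (m≤n+m 8 4) 12≤l))) ⟩
      D * card I * (512 * l + 512 * l)
        ≡⟨ cong (λ x → x * card I * (512 * l + 512 * l)) D≡ ⟩
      Q₁ * l ^ (r + 1) * card I * (512 * l + 512 * l)
        ≡⟨ regroup₄ Q₁ (l ^ (r + 1)) (card I) l ⟩
      1024 * (l * l ^ (r + 1)) * card I * Q₁
        ≤⟨ *-monoˡ-≤ Q₁ (*-monoˡ-≤ (card I) (absorb 1024 3 (1 + (r + 1)) (2 * r + 6) (m≤n+m 1024 704) (by-slack (r + 1) (exponent r)))) ⟩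
      l ^ (2 * r + 6) * card I * Q₁
        ≡⟨ cong₂ (λ a b → a * card I * b) q≡ q₁≡ ⟨
      suc q * card I * suc q₁ ∎
      where
      regroup₁ : ∀ a b c d → 16 * (a * (b * c) * d) ≡ 16 * (a * c * b) * d
      regroup₁ = solve-∀
      regroup₂ : ∀ D a b L → 16 * (64 * D + a * b) * L ≡ 1024 * D * L + 16 * (L * b * a)
      regroup₂ = solve-∀
      regroup₃ : ∀ D l i → 1024 * D * (4 * i) + 16 * (16 * D * l * i + 16 * D * l * i) ≡ D * i * (512 * 8 + 512 * l)
      regroup₃ = solve-∀
      regroup₄ : ∀ q z i l → q * z * i * (512 * l + 512 * l) ≡ 1024 * (l * z) * i * q
      regroup₄ = solve-∀
      exponent : ∀ r → 2 * r + 6 ≡ 3 + (1 + (r + 1)) + (r + 1)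
      exponent = solve-∀
      g≤X : g ≤ X + (r + 1)
      g≤X = by-slack (2 * r + 6 + μ + (r + 1)) (trans (cong (_+ (r + 1)) (trans X≡ (cong (_+ μ) e≡))) (exponent′ g r μ))
        where
        exponent′ : ∀ g r μ → g + 2 * r + 6 + μ + (r + 1) ≡ g + (2 * r + 6 + μ + (r + 1))
        exponent′ = solve-∀
      Ll^g≤ : L * l ^ g ≤ 16 * D * l * card I
      Ll^g≤ = begin
        L * l ^ g ≤⟨ *-mono-≤ L≤4I (pow-mono g (X + (r + 1)) g≤X) ⟩
        4 * card I * D ≡⟨ swap (card I) D ⟩
        4 * D * card I ≤⟨ *-monoˡ-≤ (card I) (≤-trans (*-monoˡ-≤ D (m≤n+m 4 12)) (m≤m*n (16 * D) l)) ⟩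
        16 * D * l * card I ∎
        where
        swap : ∀ i D → 4 * i * D ≡ 4 * D * i
        swap = solve-∀

    contradiction-at-scale : ⊥
    contradiction-at-scale = SingleScaleCase.Finish.single-scale-case adj irr adj-sym D o o-covers o⊑adj o-out (l ^ e) (l ^ μ) ⦃ m^n≢0 l e ⦄ sparse
      κ no-C₄-free I H I>0 bounded (l ^ (X + 1)) Δ deg-I
      (λ h e → *-cancelˡ-≤ L (≤-trans (deg-H h e) (≤-trans qI-lower (≤-reflexive (*-assoc L (l ^ g) (suc qI))))))
      q₁ (l ^ (2 * r + 5)) ⦃ m^n≢0 l (2 * r + 5) ⦄ (≤-trans mt≤D (m≤n*m D 4)) (≤-trans mt≤D D≤Δ)
      num₁ num₂ num₃ q qI q₂ 2d≤Q num₅ num₆ num₇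

  no-single-scale : SingleScale → ⊥
  no-single-scale (I , H , L , bounded , I>0 , H≤L , L≤4I , deg-I , deg-H) =
    with-qI (multiple-between (16 * D * l * card I) (L * l ^ g) ⦃ m*n≢0 L (l ^ g) ⦃ it ⦄ ⦃ m^n≢0 l g ⦄ ⦄)
    where
    H>0 : (∃ λ i → I i ≡ true) → 0 < card H
    H>0 (i , h) = ≤-trans (≤-trans (m^n>0 l (X + 1)) (deg-I i h)) (card-∩ˡ H (adj i))
    instance
      L≢0 : NonZero L
      L≢0 = >-nonZero (<-≤-trans (H>0 (card>0⇒∃ {U = I} I>0)) H≤L)
    with-qI : (∃ λ qI → 16 * D * l * card I ≤ L * l ^ g * suc qI × L * l ^ g * suc qI ≤ 16 * D * l * card I + L * l ^ g) → ⊥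
    with-qI (qI , lower , upper) = with-q₂ (multiple-between (64 * D) (suc qI * l ^ g) ⦃ m*n≢0 (suc qI) (l ^ g) ⦃ _ ⦄ ⦃ m^n≢0 l g ⦄ ⦄)
      where
      with-q₂ : (∃ λ q₂ → 64 * D ≤ suc qI * l ^ g * suc q₂ × suc qI * l ^ g * suc q₂ ≤ 64 * D + suc qI * l ^ g) → ⊥
      with-q₂ (q₂ , lower₂ , upper₂) = contradiction-at-scale I H L bounded I>0 H≤L L≤4I deg-I deg-H qI lower upper q₂ lower₂ upper₂
        (pred Q₁) (pred (l ^ (2 * r + 6))) (suc-pred Q₁ ⦃ m^n≢0 l X ⦄) (suc-pred (l ^ (2 * r + 6)) ⦃ m^n≢0 l (2 * r + 6) ⦄)

  contradiction : ⊥
  contradiction = Data.Sum.[ no-single-scale , no-unbalanced ] dichotomy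

-- The minimal counterexample and the polynomial bound

edges-full : ∀ G → edges (adj G) full full ≡ degreeSum G
edges-full G = sum-cong (n G) λ u → *-identityˡ (degree G u)

edges-remove : ∀ {N} (adj : Rel N) → (∀ u v → adj u v ≡ adj v u) → ∀ v →
  edges adj full full ≤ edges adj (remove v full) (remove v full) + 2 * card (adj v)
edges-remove {N} adj adj-sym v = begin
  edges adj full full
    ≤⟨ sum-mono N point ⟩
  ∑[ u < N ] (⟦ remove v full u ⟧ * card (remove v full ∩ adj u) + (⟦ single v u ⟧ * card (adj v) + ⟦ adj v u ⟧))
    ≡⟨ trans (sum-+ N _ _) (cong (edges adj (remove v full) (remove v full) +_) (trans (sum-+ N _ _)
         (cong (_+ card (adj v)) (trans (sum-*ʳ N (card (adj v)) _) (cong (_* card (adj v)) (card-single v)))))) ⟩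
  edges adj (remove v full) (remove v full) + (1 * card (adj v) + card (adj v))
    ≡⟨ cong (edges adj (remove v full) (remove v full) +_) (double (card (adj v))) ⟩
  edges adj (remove v full) (remove v full) + 2 * card (adj v) ∎
  where
  open ≤-Reasoning
  double : ∀ x → 1 * x + x ≡ 2 * x
  double = solve-∀
  at-v : ∀ u → card (single v ∩ adj u) ≤ ⟦ adj v u ⟧
  at-v u = by-cases (adj u v) refl
    where
    by-cases : ∀ b → adj u v ≡ b → card (single v ∩ adj u) ≤ ⟦ adj v u ⟧
    by-cases true e = ≤-trans (≤-trans (card-∩ˡ (single v) (adj u))
      (≤-reflexive (card-single v))) (≤-reflexive (cong ⟦_⟧ (sym (trans (adj-sym v u) e))))
    by-cases false e = ≤-trans (≮⇒≥ λ pos → empty (card>0⇒∃ {U = single v ∩ adj u} pos)) z≤n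
      where
      empty : (∃ λ w → (single v ∩ adj u) w ≡ true) → ⊥
      empty (w , h) = true≢false (∧ʳ (single v w) h)
        (subst (λ x → adj u x ≡ false) (dec-proof (v F.≟ w) (∧ˡ (single v w) h)) e)
  point : ∀ u → 1 * card (full ∩ adj u) ≤
    ⟦ remove v full u ⟧ * card (remove v full ∩ adj u) + (⟦ single v u ⟧ * card (adj v) + ⟦ adj v u ⟧)
  point u = by-cases (v F.≟ u)
    where
    by-cases : (d : Dec (v ≡ u)) → 1 * card (adj u) ≤
      ⟦ not (does d) ⟧ * card (remove v full ∩ adj u) + (⟦ does d ⟧ * card (adj v) + ⟦ adj v u ⟧)
    by-cases (yes refl) = m≤m+n (1 * card (adj v)) _
    by-cases (no v≢u) = begin
      1 * card (adj u)
        ≡⟨ *-identityˡ (card (adj u)) ⟩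
      card (adj u)
        ≤⟨ card-mono {U = adj u} {(remove v full ∩ adj u) ∪ (single v ∩ adj u)} split ⟩
      card ((remove v full ∩ adj u) ∪ (single v ∩ adj u))
        ≤⟨ card-∪-≤ (remove v full ∩ adj u) (single v ∩ adj u) ⟩
      card (remove v full ∩ adj u) + card (single v ∩ adj u)
        ≤⟨ +-mono-≤ (≤-reflexive (sym (*-identityˡ (card (remove v full ∩ adj u))))) (at-v u) ⟩
      1 * card (remove v full ∩ adj u) + ⟦ adj v u ⟧ ∎
      where
      split : adj u ⊑ ((remove v full ∩ adj u) ∪ (single v ∩ adj u))
      split w h with v F.≟ w
      ... | yes _ = h
      ... | no _ = trans (cong (_∨ false) h) refl

copy-of-pattern : ∀ {N} (adj : Rel N) → (∀ u → adj u u ≡ false) → (∀ u v → adj u v ≡ adj v u) → ∀ s .⦃ _ : NonZero s ⦄ →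
  ¬ HasKss s adj → ∀ {A B} .⦃ _ : NonZero A ⦄ .⦃ _ : NonZero B ⦄ (φ : Fin A → Fin B → Bool) (X Y : Subset N) t m →
  m ≤ card X → m ≤ card Y → card X * card Y ≤ t * edges adj Y X →
  (2 * (2 * t) ^ A) ^ B * (12 * s) ^ length (Pattern.missingPairs φ) < m → InducedCopy adj φ
copy-of-pattern adj irr adj-sym s no-K {suc a} {suc b} φ X Y = induced-copy adj irr adj-sym s no-K φ X Y

-- The size threshold of `induced-copy` at density l^-e, as a power of `l`. The exponent involves
-- only e and the pattern, so it can serve as μ before X is chosen.
pattern-size : ∀ l → 12 ≤ l → ∀ s → 12 * s ≤ l → ∀ e A B L →
  (2 * (2 * l ^ e) ^ A) ^ B * (12 * s) ^ L < l ^ (((e + 1) * A + 1) * B + L + 1)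
pattern-size l 12≤l s 12s≤l e A B L = begin-strict
  (2 * (2 * l ^ e) ^ A) ^ B * (12 * s) ^ L
    ≤⟨ *-mono-≤ (^-monoˡ-≤ B (begin
         2 * (2 * l ^ e) ^ A ≤⟨ *-monoʳ-≤ 2 (^-monoˡ-≤ A (absorb 2 1 e (e + 1) (m≤n+m 2 10) (≤-reflexive (+-comm 1 e)))) ⟩
         2 * (l ^ (e + 1)) ^ A ≡⟨ cong (2 *_) (^-*-assoc l (e + 1) A) ⟩
         2 * l ^ ((e + 1) * A) ≤⟨ absorb 2 1 ((e + 1) * A) ((e + 1) * A + 1) (m≤n+m 2 10) (≤-reflexive (+-comm 1 _)) ⟩
         l ^ ((e + 1) * A + 1) ∎)) (^-monoˡ-≤ L 12s≤l) ⟩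
  (l ^ ((e + 1) * A + 1)) ^ B * l ^ L
    ≡⟨ cong (_* l ^ L) (^-*-assoc l ((e + 1) * A + 1) B) ⟩
  l ^ (((e + 1) * A + 1) * B) * l ^ L
    ≡⟨ pow-+ (((e + 1) * A + 1) * B) L ⟨
  l ^ (((e + 1) * A + 1) * B + L)
    <⟨ ^-monoʳ-< l (≤-trans (s≤s (s≤s z≤n)) 12≤l) (≤-reflexive (+-comm 1 (((e + 1) * A + 1) * B + L))) ⟩
  l ^ (((e + 1) * A + 1) * B + L + 1) ∎
  where
  open Powers l 12≤l
  open ≤-Reasoning

eval-≤ : ∀ p s .⦃ _ : NonZero s ⦄ → eval p s ≤ sum p * s ^ length p
eval-≤ [] s = z≤n
eval-≤ (a ∷ as) s = begin
  a + s * eval as s ≤⟨ +-mono-≤ (m≤m*n a (s ^ suc (length as)) ⦃ m^n≢0 s (suc (length as)) ⦄) (*-monoʳ-≤ s (eval-≤ as s)) ⟩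
  a * s ^ suc (length as) + s * (sum as * s ^ length as) ≡⟨ collect a s (sum as) (s ^ length as) ⟩
  (a + sum as) * s ^ suc (length as) ∎
  where
  open ≤-Reasoning
  collect : ∀ a s c x → a * (s * x) + s * (c * x) ≡ (a + c) * (s * x)
  collect = solve-∀

eval-monomial : ∀ c C s → eval (replicate C 0 List.++ List.[ c ]) s ≡ s ^ C * c
eval-monomial c zero s = trans (cong (c +_) (*-zeroʳ s)) (trans (+-identityʳ c) (sym (*-identityˡ c)))
eval-monomial c (suc C) s = trans (cong (s *_) (eval-monomial c C s)) (sym (*-assoc s (s ^ C) c))

-- No constant here depends on s, which is what makes `p′` a polynomial: a single monomial with
-- value (K s)^C. The exponent `al` exceeds the number of coefficients of `p`, so that p(s) + 1 ≤ (K
-- s)^al.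
module Constants (p : Poly) where

  κ A B L al r g e μ X E K C : ℕ
  κ = suc (eval p 2)
  A = 2 * κ * (4 * (κ * κ))
  B = κ * (6 * (κ * κ))
  L = length (Pattern.missingPairs (Incidence.incident κ))
  al = suc (length p)
  r = al + 3
  g = (2 * r + 6) * κ
  e = g + 2 * r + 6
  μ = ((e + 1) * A + 1) * B + L + 1
  X = e + μ
  E = X + r + al + 2
  -- One summand for each lower bound on l = K s: 12 for `absorb` and for 12s ≤ l, 16 · 2^κ for the
  -- tail bound, 2E + 3 for the number of rounds, 1 + sum p for `small-k`.
  K = 12 + (16 * 2 ^ κ + ((2 * E + 3) + suc (sum p)))
  C = X + (r + 1)

  p′ : Poly
  p′ = replicate C 0 List.++ List.[ K ^ C ]

  eval-p′ : ∀ s → eval p′ s ≡ (K * s) ^ C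
  eval-p′ s = trans (eval-monomial (K ^ C) C s) (trans (*-comm (s ^ C) (K ^ C)) (sym (^-distribʳ-* C K s)))

module _ (𝒢 : Graph → Set) (hereditary : Hereditary 𝒢) (p : Poly)
  (bound : (s : ℕ) → .{{_ : NonZero s}} → (G : Graph) → 𝒢 G → Bipartite G → ¬ ContainsKss s G → AvgDegreeAtMost G (eval p s))
  (s : ℕ) .⦃ s≢0 : NonZero s ⦄ where

  open Constants p

  private
    l D : ℕ
    l = K * s
    D = l ^ C

  below : ∀ {x} → x ≤ K → x ≤ l
  below h = ≤-trans h (m≤m*n K s)

  12≤l : 12 ≤ l
  12≤l = below (m≤m+n 12 _)

  open Powers l 12≤l

  minimal-counterexample : ∀ G → 𝒢 G → ¬ ContainsKss s G →
    (∀ U → card U < n G → edges (adj G) U U ≤ D * card U) → D * n G < degreeSum G → ⊥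
  minimal-counterexample G G∈ no-K proper dense = Contradiction.contradiction (adj G) (adj-irrefl G) (adj-sym G) l 12≤l
    κ (suc (eval p s)) al r g e μ X E refl refl refl refl refl
    (below (m≤n⇒m≤o+n 12 (m≤m+n (16 * 2 ^ κ) _)))
    (below (m≤n⇒m≤o+n 12 (m≤n⇒m≤o+n (16 * 2 ^ κ) (m≤m+n (2 * E + 3) _))))
    small-k no-C₄-free
    (λ B H B-indep H-indep deg → bipartite-balance 𝒢 hereditary s (eval p s) (bound s) G G∈ B H B-indep H-indep
      (suc (eval p s)) ≤-refl deg (no-K ∘ induced-Kss G (B ∪ H) s))
    sparse N>0 min-degree density
    where
    open ≤-Reasoning
    N : ℕ
    N = n G
    small-k : suc (eval p s) ≤ l ^ al
    small-k = begin
      suc (eval p s) ≤⟨ +-mono-≤ (m^n>0 s (length p)) (eval-≤ p s) ⟩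
      suc (sum p) * s ^ length p ≤⟨ *-mono-≤ (below (m≤n⇒m≤o+n 12 (m≤n⇒m≤o+n (16 * 2 ^ κ) (m≤n+m (suc (sum p)) (2 * E + 3)))))
                                                       (^-monoˡ-≤ (length p) (m≤n*m s K)) ⟩
      l ^ al ∎
    no-C₄-free : ∀ B H → Independent (adj G) B → Independent (adj G) H → C₄-free (adj G) B H →
      (∀ i → B i ≡ true → κ ≤ card (H ∩ adj G i)) → card B ≤ card H
    no-C₄-free B H B-indep H-indep free deg = bipartite-balance 𝒢 hereditary 2 (eval p 2) (bound 2) G G∈ B H B-indep H-indep κ ≤-refl deg
      (C₄-free⇒no-K₂₂ 𝒢 hereditary 2 (eval p 2) (bound 2) G G∈ B H B-indep H-indep κ ≤-refl deg free)
    sparse : ∀ P Y → l ^ μ ≤ card P → l ^ μ ≤ card Y → l ^ e * edges (adj G) Y P < card P * card Y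
    sparse P Y hP hY = ≰⇒> λ many → Incidence.no-copy κ (adj G) (adj-irrefl G) no-C₄-free
      (copy-of-pattern (adj G) (adj-irrefl G) (adj-sym G) s no-K (Incidence.incident κ) P Y (l ^ e) (l ^ μ) hP hY many
        (pattern-size l 12≤l s (*-monoˡ-≤ s {12} {K} (m≤m+n 12 _)) e A B L))
    vertex : ∃ λ v → 0 < degree G v
    vertex = sum>0⇒∃ N (≤-<-trans z≤n dense)
    N>0 : 0 < N
    N>0 = ≤-<-trans z≤n (toℕ<n (proj₁ vertex))
    rest : Fin N → Subset N
    rest v = remove v full
    N≡ : ∀ v → N ≡ 1 + card (rest v)
    N≡ v = trans (sym (card-full N)) (card-remove full v refl)
    total-≤ : ∀ v → degreeSum G ≤ D * card (rest v) + 2 * card (adj G v)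
    total-≤ v = begin
      degreeSum G ≡⟨ edges-full G ⟨
      edges (adj G) full full ≤⟨ edges-remove (adj G) (adj-sym G) v ⟩
      edges (adj G) (rest v) (rest v) + 2 * card (adj G v) ≤⟨ +-monoˡ-≤ _ (proper (rest v) (≤-reflexive (sym (N≡ v)))) ⟩
      D * card (rest v) + 2 * card (adj G v) ∎
    -- Deleting a vertex of degree below D/2 would leave a smaller counterexample.
    min-degree : ∀ v → D ≤ 2 * card (adj G v)
    min-degree v = +-cancelˡ-≤ (D * card (rest v)) _ _ (begin
      D * card (rest v) + D ≡⟨ trans (+-comm _ D) (sym (*-suc D (card (rest v)))) ⟩
      D * (1 + card (rest v)) ≡⟨ cong (D *_) (N≡ v) ⟨
      D * N ≤⟨ <⇒≤ dense ⟩
      degreeSum G ≤⟨ total-≤ v ⟩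
      D * card (rest v) + 2 * card (adj G v) ∎)
    2≤D : 2 ≤ D
    2≤D = ≤-trans (≤-trans (≤-trans (s≤s (s≤s z≤n)) 12≤l) (≤-reflexive (sym (*-identityʳ l))))
      (pow-mono 1 C (≤-trans (m≤n+m 1 r) (m≤n+m (r + 1) X)))
    density : ∀ U → edges (adj G) U U ≤ 2 * D * card U
    density U = by-size (card U <? N)
      where
      by-size : Dec (card U < N) → edges (adj G) U U ≤ 2 * D * card U
      by-size (yes small) = ≤-trans (proper U small) (*-monoˡ-≤ (card U) (m≤n*m D 2))
      -- Minimality does not cover the whole vertex set; restoring one deleted vertex adds at most
      -- 2N ≤ D N to the degree sum.
      by-size (no large) = begin
        edges (adj G) U U ≤⟨ edges-mono (adj G) {U} {full} {U} {full} (λ _ _ → refl) (λ _ _ → refl) ⟩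
        edges (adj G) full full ≡⟨ edges-full G ⟩
        degreeSum G ≤⟨ total-≤ v ⟩
        D * card (rest v) + 2 * card (adj G v) ≤⟨ +-mono-≤ (*-monoʳ-≤ D (card≤n (rest v))) (*-mono-≤ 2≤D (card≤n (adj G v))) ⟩
        D * N + D * N ≡⟨ double D N ⟩
        2 * D * N ≤⟨ *-monoʳ-≤ (2 * D) (≮⇒≥ large) ⟩
        2 * D * card U ∎
        where
        v : Fin N
        v = proj₁ vertex
        double : ∀ D N → D * N + D * N ≡ 2 * D * N
        double = solve-∀

  degreeSum-≤ : ∀ N G → n G ≡ N → 𝒢 G → ¬ ContainsKss s G → degreeSum G ≤ D * n G
  degreeSum-≤ = <-rec (λ N → ∀ G → n G ≡ N → 𝒢 G → ¬ ContainsKss s G → degreeSum G ≤ D * n G) step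
    where
    step : ∀ N → (∀ {M} → M < N → ∀ G → n G ≡ M → 𝒢 G → ¬ ContainsKss s G → degreeSum G ≤ D * n G) →
      ∀ G → n G ≡ N → 𝒢 G → ¬ ContainsKss s G → degreeSum G ≤ D * n G
    step N smaller G refl G∈ no-K = ≮⇒≥ (minimal-counterexample G G∈ no-K λ U small →
      ≤-trans (≤-reflexive (sym (degreeSum-induced G U)))
        (smaller small (induced G U) refl (hereditary G (induced G U) (induced-≤ind G U) G∈) (no-K ∘ induced-Kss G U s)))

theorem1p3 : (𝒢 : Graph → Set) → Hereditary 𝒢 →
    Σ Poly (λ p → (s : ℕ) → .{{_ : NonZero s}} → (G : Graph) → 𝒢 G →
    Bipartite G → ¬ ContainsKss s G → AvgDegreeAtMost G (eval p s)) →
    Σ Poly (λ p′ → (s : ℕ) → .{{_ : NonZero s}} → (G : Graph) → 𝒢 G →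
    ¬ ContainsKss s G → AvgDegreeAtMost G (eval p′ s))
theorem1p3 𝒢 hereditary (p , bound) = Constants.p′ p , λ s G G∈ no-K →
  subst (λ d → degreeSum G ≤ d * n G) (sym (Constants.eval-p′ p s))
    (degreeSum-≤ 𝒢 hereditary p bound s (n G) G refl G∈ no-K)
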